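{- For every integer $n\ge 0$ and every $r\in\{132,164,228,292,356,388\}$, $$v_0(416n+r)\equiv 0\pmod{13}.$$
   Context: The integer sequence $v_0(n)$, $n\ge 0$, is defined by the generating function (formal power series in $q$) $$\sum_{n=0}^\infty v_0(n)q^n=\sum_{n=0}^\infty \frac{q^{n^2}(-q;q^2)_n}{(q;q^2)_n},$$ where $(a;q)_0=1$ and $(a;q)_n=\prod_{i=1}^n(1-aq^{i-1})$ for $n\ge1$, so that $(-q;q^2)_n=\prod_{i=1}^n(1+q^{2i-1})$ and $(q;q^2)_n=\prod_{i=1}^n(1-q^{2i-1})$. -}

module Defs where

open import Data.Nat as ℕ using (ℕ; zero; suc; z≤n; s≤s)
import Data.Nat.Properties as ℕₚ
open import Data.Integer as ℤ using (ℤ; 0ℤ; 1ℤ)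
import Data.Integer.Properties as ℤₚ
open import Relation.Binary.PropositionalEquality
open ≡-Reasoning

-- Formal power series in one variable over ℤ, given by their coefficients;
-- two series are equal when they agree pointwise.
Series : Set
Series = ℕ → ℤ

infix  4 _≈_
infixl 6 _-_
infixl 7 _*_ _/_
infix  8 -_
infixr 8 _^_

_≈_ : Series → Series → Set
f ≈ g = ∀ k → f k ≡ g k

-- ∑≤ n f = f 0 + f 1 + ⋯ + f n, with n included.
∑≤ : ℕ → (ℕ → ℤ) → ℤ
∑≤ zero    f = f 0
∑≤ (suc n) f = f 0 ℤ.+ ∑≤ n (λ i → f (suc i))

1# : Series
1# zero    = 1ℤ
1# (suc _) = 0ℤ

q : Series
q zero    = 0ℤ
q (suc k) = 1# k

-_ : Series → Series
(- f) k = ℤ.- f k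

_-_ : Series → Series → Series
(f - g) k = f k ℤ.- g k

_*_ : Series → Series → Series
(f * g) k = ∑≤ k (λ i → f i ℤ.* g (k ℕ.∸ i))

_^_ : Series → ℕ → Series
f ^ zero  = 1#
f ^ suc n = f * f ^ n

-- Long division, meaningful only for g with constant coefficient 1: then
-- f / g is the series whose product with g is f (see /-correct).
_/_ : Series → Series → Series
(f / g) zero    = f 0
(f / g) (suc k) = ((λ i → f (suc i) ℤ.- f 0 ℤ.* g (suc i)) / g) k

-- The q-Pochhammer symbol (a; b)ₙ = ∏_{i=1}^{n} (1 - a b^{i-1}).
poch : Series → Series → ℕ → Series
poch a b zero    = 1#
poch a b (suc n) = poch a b n * (1# - a * b ^ n)

-- The infinite sum ∑_{n≥0} F n, for families in which every exponent
-- occurring in F n is at least n: the coefficient of q^k then only receives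
-- contributions from n ≤ k.
∑∞ : (ℕ → Series) → Series
∑∞ F k = ∑≤ k (λ n → F n k)

v₀-term : ℕ → Series
v₀-term n = q ^ (n ℕ.* n) * poch (- q) (q ^ 2) n / poch q (q ^ 2) n

v₀ : ℕ → ℤ
v₀ = ∑∞ v₀-term

-- The remaining lemmas justify the use of _/_ and ∑∞ in v₀.

/-correct : ∀ f g → g 0 ≡ 1ℤ → (f / g) * g ≈ f
/-correct f g g0 zero    = trans (cong (f 0 ℤ.*_) g0) (ℤₚ.*-identityʳ (f 0))
/-correct f g g0 (suc k) = begin
  c ℤ.+ (r / g * g) k         ≡⟨ cong (λ x → c ℤ.+ x) (/-correct r g g0 k) ⟩
  c ℤ.+ (f (suc k) ℤ.- c)     ≡⟨ ℤₚ.+-comm c _ ⟩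
  (f (suc k) ℤ.- c) ℤ.+ c     ≡⟨ ℤₚ.+-assoc (f (suc k)) (ℤ.- c) c ⟩
  f (suc k) ℤ.+ (ℤ.- c ℤ.+ c) ≡⟨ cong (λ x → f (suc k) ℤ.+ x) (ℤₚ.+-inverseˡ c) ⟩
  f (suc k) ℤ.+ 0ℤ            ≡⟨ ℤₚ.+-identityʳ _ ⟩
  f (suc k)                   ∎
  where
  c : ℤ
  c = f 0 ℤ.* g (suc k)
  r : Series
  r i = f (suc i) ℤ.- f 0 ℤ.* g (suc i)

denominator-unit : ∀ n → poch q (q ^ 2) n 0 ≡ 1ℤ
denominator-unit zero    = refl
denominator-unit (suc n) = cong (ℤ._* 1ℤ) (denominator-unit n)

v₀-term-correct : ∀ n →
  v₀-term n * poch q (q ^ 2) n ≈ q ^ (n ℕ.* n) * poch (- q) (q ^ 2) n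
v₀-term-correct n = /-correct _ _ (denominator-unit n)

∑≤-zero : ∀ n f → (∀ i → i ℕ.≤ n → f i ≡ 0ℤ) → ∑≤ n f ≡ 0ℤ
∑≤-zero zero    f h = h 0 z≤n
∑≤-zero (suc n) f h =
  cong₂ ℤ._+_ (h 0 z≤n) (∑≤-zero n _ (λ i i≤n → h (suc i) (s≤s i≤n)))

*-low : ∀ f g m → (∀ k → k ℕ.< m → f k ≡ 0ℤ) → ∀ k → k ℕ.< m → (f * g) k ≡ 0ℤ
*-low f g m h k k<m = ∑≤-zero k _
  (λ i i≤k → cong (ℤ._* g (k ℕ.∸ i)) (h i (ℕₚ.≤-<-trans i≤k k<m)))

/-low : ∀ k f g → (∀ i → i ℕ.≤ k → f i ≡ 0ℤ) → (f / g) k ≡ 0ℤ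
/-low zero    f g h = h 0 z≤n
/-low (suc k) f g h = /-low k _ g
  (λ i i≤k → cong₂ (λ x y → x ℤ.- y ℤ.* g (suc i)) (h (suc i) (s≤s i≤k)) (h 0 z≤n))

q^-low : ∀ m k → k ℕ.< m → (q ^ m) k ≡ 0ℤ
q^-low (suc m) zero    _         = refl
q^-low (suc m) (suc k) (s≤s k<m) = trans (ℤₚ.+-identityˡ _) (∑≤-zero k _ term)
  where
  term : ∀ i → i ℕ.≤ k → 1# i ℤ.* (q ^ m) (k ℕ.∸ i) ≡ 0ℤ
  term zero    _ = trans (ℤₚ.*-identityˡ _) (q^-low m k k<m)
  term (suc i) _ = refl

n≤n*n : ∀ n → n ℕ.≤ n ℕ.* n
n≤n*n zero    = z≤n
n≤n*n (suc n) = ℕₚ.m≤m*n (suc n) (suc n)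

v₀-term-low : ∀ n k → k ℕ.< n → v₀-term n k ≡ 0ℤ
v₀-term-low n k k<n = /-low k _ _ (λ i i≤k →
  *-low (q ^ (n ℕ.* n)) (poch (- q) (q ^ 2) n) (n ℕ.* n) (q^-low (n ℕ.* n)) i
    (ℕₚ.<-≤-trans (ℕₚ.≤-<-trans i≤k k<n) (n≤n*n n)))

∑≤-stable : ∀ k N f → k ℕ.≤ N → (∀ n → k ℕ.< n → f n ≡ 0ℤ) → ∑≤ N f ≡ ∑≤ k f
∑≤-stable zero    zero    f _         h = refl
∑≤-stable zero    (suc N) f _         h =
  trans (cong (λ x → f 0 ℤ.+ x) (∑≤-zero N _ (λ i _ → h (suc i) (s≤s z≤n))))
        (ℤₚ.+-identityʳ (f 0))
∑≤-stable (suc k) (suc N) f (s≤s k≤N) h =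
  cong (λ x → f 0 ℤ.+ x) (∑≤-stable k N _ k≤N (λ n k<n → h (suc n) (s≤s k<n)))

v₀-converges : ∀ k N → k ℕ.≤ N → ∑≤ N (λ n → v₀-term n k) ≡ v₀ k
v₀-converges k N k≤N = ∑≤-stable k N _ k≤N (λ n → v₀-term-low n k)

-- Put F(q) = ∑ v₀(n) qⁿ, φ(q) = ∑_{n∈ℤ} q^{n²}, ψ(q) = ∑_{n≥0} q^{n(n+1)/2}.
-- A telescoping deformation of the summands (q^{2M} → 0) evaluates the even part of F:
--   G(q) := 2 ∑ v₀(2n) qⁿ − 1 = φ(q) (−q;q²)_∞ / (q;q²)_∞ = φ(q)² / φ(−q²).
-- Repeated 2-dissection with φ(q) φ(−q) = φ(−q²)², φ(q)² = φ(q²)² + 4q ψ(q⁴)² and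
-- ψ(q)² = φ(q) ψ(q²) then gives
--   ∑ v₀(32n+4) qⁿ = 3 ψ(q) + 512 q ψ(q)⁹ / φ(−q)⁸.
-- Since ψ(q)⁹ φ(−q)⁵ = (q;q)_∞ (q²;q²)_∞¹³, multiplication by φ(−q)¹³ makes the right-hand
-- side, modulo 13, a combination of ψ(q) and q (q;q)_∞ with coefficients in 𝔽₁₃[[q¹³]]. By
-- the Jacobi triple product the exponents k occurring in those two series make 8k + 1,
-- respectively 3(8k + 1), a square modulo 13, and 3 = 4² there, whereas 8k + 1 is a
-- non-residue for k ≡ 4, 5, 7, 9, 11, 12, the residues that 32k + 4 = 416n + r yields.

module Submission where

-- Even exponents are singled out because of the recurrence that links the deformed sums `A M` and
-- `A (suc M)`. Its inhomogeneous term is v - v² with v = q^(2M+1). Here v has an odd exponent and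
-- is discarded by `U`; the remaining -v² is absorbed by doubling the series and subtracting 1. What
-- is left is purely multiplicative, so it iterates to an infinite product.
--
-- The later dissections multiply the number of theta monomials. They collapse to two thanks to one
-- more identity, φ(q)⁴ - φ(-q)⁴ = 16 q ψ(q²)⁴.
--
-- The exponents 8 and 9 in the outcome fit the modulus. Five further factors φ(-q) complete φ(-q)⁸
-- to a 13th power, and they turn ψ⁹ into (q;q²)_∞ times 14 = 13 + 1 copies of (q²;q²)_∞. Thirteen
-- copies form a 13th power, and the last one completes (q;q²)_∞ to (q;q)_∞. Modulo 13 a 13th power
-- has only exponents divisible by 13, so multiplying by it, or cancelling it, respects the residue
-- class of an exponent.

-- The commutative ring of integer power series.

module PowerSeries where

  open import Defs public
  open import Algebra.Bundles using (CommutativeRing)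
  open import Algebra.Solver.Ring.AlmostCommutativeRing
    using (AlmostCommutativeRing; fromCommutativeRing; _-Raw-AlmostCommutative⟶_)
  open import Data.Integer as ℤ using (ℤ; 0ℤ; 1ℤ)
  import Data.Integer.Properties as ℤₚ
  open import Data.Integer.Tactic.RingSolver using (solve-∀)
  open import Data.Maybe using (just; nothing)
  open import Data.Nat as ℕ using (ℕ; zero; suc; z≤n; s≤s)
  import Data.Nat.Properties as ℕₚ
  open import Data.Product using (_,_)
  open import Level using (0ℓ)
  open import Relation.Binary.Definitions using (WeaklyDecidable)
  open import Relation.Binary.PropositionalEquality
  open import Relation.Nullary using (yes; no)

  infixl 6 _+_
  infix  4 _≋_

  _+_ : Series → Series → Series
  (f + g) k = f k ℤ.+ g k

  0# : Series
  0# _ = 0ℤ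

  const : ℤ → Series
  const c zero    = c
  const c (suc _) = 0ℤ

  tail : Series → Series
  tail f k = f (suc k)

  -- _≈_ as a record, so that the two series can be inferred from the type.
  record _≋_ (f g : Series) : Set where
    constructor mk
    field at : f ≈ g
  open _≋_ public

  ≋-refl : ∀ {f} → f ≋ f
  ≋-refl = mk λ _ → refl

  ≋-sym : ∀ {f g} → f ≋ g → g ≋ f
  ≋-sym p = mk λ k → sym (at p k)

  ≋-trans : ∀ {f g h} → f ≋ g → g ≋ h → f ≋ h
  ≋-trans p r = mk λ k → trans (at p k) (at r k)

  ∑≤-cong : ∀ n {f g : ℕ → ℤ} → (∀ i → i ℕ.≤ n → f i ≡ g i) → ∑≤ n f ≡ ∑≤ n g
  ∑≤-cong zero    h = h 0 z≤n
  ∑≤-cong (suc n) h =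
    cong₂ ℤ._+_ (h 0 z≤n) (∑≤-cong n (λ i i≤n → h (suc i) (s≤s i≤n)))

  *-congᵏ : ∀ {f f′ g g′} k → (∀ i → i ℕ.≤ k → f i ≡ f′ i) →
            (∀ i → i ℕ.≤ k → g i ≡ g′ i) → (f * g) k ≡ (f′ * g′) k
  *-congᵏ k p r = ∑≤-cong k λ i i≤k →
    cong₂ ℤ._*_ (p i i≤k) (r (k ℕ.∸ i) (ℕₚ.m∸n≤m k i))

  *-cong : ∀ {f f′ g g′} → f ≋ f′ → g ≋ g′ → f * g ≋ f′ * g′
  *-cong p r = mk λ k → *-congᵏ k (λ i _ → at p i) (λ i _ → at r i)

  *-congˡ : ∀ f {g g′} → g ≋ g′ → f * g ≋ f * g′
  *-congˡ f = *-cong (≋-refl {f})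

  *-congʳ : ∀ g {f f′} → f ≋ f′ → f * g ≋ f′ * g
  *-congʳ g p = *-cong p (≋-refl {g})

  scale-* : ∀ c f g k → ((λ i → c ℤ.* f i) * g) k ≡ c ℤ.* (f * g) k
  scale-* c f g zero    = ℤₚ.*-assoc c (f 0) (g 0)
  scale-* c f g (suc k) = trans
    (cong₂ ℤ._+_ (ℤₚ.*-assoc c (f 0) (g (suc k))) (scale-* c (tail f) g k))
    (sym (ℤₚ.*-distribˡ-+ c _ _))

  *-distribʳ-+ : ∀ h f g k → ((f + g) * h) k ≡ (f * h) k ℤ.+ (g * h) k
  *-distribʳ-+ h f g zero    = ℤₚ.*-distribʳ-+ (h 0) (f 0) (g 0)
  *-distribʳ-+ h f g (suc k) = trans
    (cong (λ x → (f 0 ℤ.+ g 0) ℤ.* h (suc k) ℤ.+ x) (*-distribʳ-+ h (tail f) (tail g) k))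
    (rearrange (f 0) (g 0) (h (suc k)) _ _)
    where
    rearrange : ∀ a b c x y →
      (a ℤ.+ b) ℤ.* c ℤ.+ (x ℤ.+ y) ≡ (a ℤ.* c ℤ.+ x) ℤ.+ (b ℤ.* c ℤ.+ y)
    rearrange = solve-∀

  -- The convolution is defined by unfolding from the left; unfolding it from the right as well is
  -- what makes `*-comm` a plain induction.
  *-last : ∀ f g k → (f * g) (suc k) ≡ f (suc k) ℤ.* g 0 ℤ.+ (f * tail g) k
  *-last f g zero    = ℤₚ.+-comm (f 0 ℤ.* g 1) (f 1 ℤ.* g 0)
  *-last f g (suc k) = trans
    (cong (λ x → f 0 ℤ.* g (2 ℕ.+ k) ℤ.+ x) (*-last (tail f) g k))
    (rearrange (f 0 ℤ.* g (2 ℕ.+ k)) (f (2 ℕ.+ k) ℤ.* g 0) _)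
    where
    rearrange : ∀ a b c → a ℤ.+ (b ℤ.+ c) ≡ b ℤ.+ (a ℤ.+ c)
    rearrange = solve-∀

  *-comm : ∀ f g k → (f * g) k ≡ (g * f) k
  *-comm f g zero    = ℤₚ.*-comm (f 0) (g 0)
  *-comm f g (suc k) = trans
    (cong₂ ℤ._+_ (ℤₚ.*-comm (f 0) (g (suc k))) (*-comm (tail f) g k))
    (sym (*-last g f k))

  *-assoc : ∀ f g h k → ((f * g) * h) k ≡ (f * (g * h)) k
  *-assoc f g h zero    = ℤₚ.*-assoc (f 0) (g 0) (h 0)
  *-assoc f g h (suc k) = trans
    (cong (λ x → f 0 ℤ.* g 0 ℤ.* h (suc k) ℤ.+ x) (trans
      (*-distribʳ-+ h (λ i → f 0 ℤ.* tail g i) (tail f * g) k)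
      (cong₂ ℤ._+_ (scale-* (f 0) (tail g) h k) (*-assoc (tail f) g h k))))
    (rearrange (f 0) (g 0) (h (suc k)) _ _)
    where
    rearrange : ∀ a b c x y →
      a ℤ.* b ℤ.* c ℤ.+ (a ℤ.* x ℤ.+ y) ≡ a ℤ.* (b ℤ.* c ℤ.+ x) ℤ.+ y
    rearrange = solve-∀

  0#-* : ∀ g k → (0# * g) k ≡ 0ℤ
  0#-* g k = ∑≤-zero k _ (λ _ _ → refl)

  const-* : ∀ c g k → (const c * g) k ≡ c ℤ.* g k
  const-* c g zero    = refl
  const-* c g (suc k) = trans (cong (λ x → c ℤ.* g (suc k) ℤ.+ x) (0#-* g k)) (ℤₚ.+-identityʳ _)

  1#≋const : 1# ≋ const 1ℤ
  1#≋const = mk λ where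
    zero    → refl
    (suc _) → refl

  *-identityˡ : ∀ g k → (1# * g) k ≡ g k
  *-identityˡ g k = trans (at (*-cong 1#≋const (≋-refl {g})) k)
    (trans (const-* 1ℤ g k) (ℤₚ.*-identityˡ (g k)))

  seriesRing : CommutativeRing 0ℓ 0ℓ
  seriesRing = record
    { Carrier = Series
    ; _≈_ = _≋_
    ; _+_ = _+_
    ; _*_ = _*_
    ; -_ = -_
    ; 0# = 0#
    ; 1# = 1#
    ; isCommutativeRing = record
      { isRing = record
        { +-isAbelianGroup = record
          { isGroup = record
            { isMonoid = record
              { isSemigroup = record
                { isMagma = record
                  { isEquivalence = record { refl = ≋-refl ; sym = ≋-sym ; trans = ≋-trans }
                  ; ∙-cong = λ p r → mk λ k → cong₂ ℤ._+_ (at p k) (at r k)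
                  }
                ; assoc = λ f g h → mk λ k → ℤₚ.+-assoc (f k) (g k) (h k)
                }
              ; identity = (λ f → mk λ k → ℤₚ.+-identityˡ (f k)) , (λ f → mk λ k → ℤₚ.+-identityʳ (f k))
              }
            ; inverse = (λ f → mk λ k → ℤₚ.+-inverseˡ (f k)) , (λ f → mk λ k → ℤₚ.+-inverseʳ (f k))
            ; ⁻¹-cong = λ p → mk λ k → cong (λ x → ℤ.- x) (at p k)
            }
          ; comm = λ f g → mk λ k → ℤₚ.+-comm (f k) (g k)
          }
        ; *-cong = *-cong
        ; *-assoc = λ f g h → mk (*-assoc f g h)
        ; *-identity = (λ f → mk (*-identityˡ f))
                     , (λ f → mk λ k → trans (*-comm f 1# k) (*-identityˡ f k))
        ; distrib = (λ f g h → mk λ k → trans (*-comm f (g + h) k)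
                      (trans (*-distribʳ-+ f g h k) (cong₂ ℤ._+_ (*-comm g f k) (*-comm h f k))))
                  , (λ f g h → mk (*-distribʳ-+ f g h))
        }
      ; *-comm = λ f g → mk (*-comm f g)
      }
    }

  private
    acr : AlmostCommutativeRing 0ℓ 0ℓ
    acr = fromCommutativeRing seriesRing

    -- Agrees with const, but sends 0 and 1 to the constants 0# and 1# on the nose,
    -- so that these may occur in the equations given to the solver.
    scalar : ℤ → Series
    scalar (ℤ.+ 0) = 0#
    scalar (ℤ.+ 1) = 1#
    scalar c       = const c

    scalar≋const : ∀ c → scalar c ≋ const c
    scalar≋const (ℤ.+ 0)             = mk λ where
      zero    → refl
      (suc _) → refl
    scalar≋const (ℤ.+ 1)             = 1#≋const
    scalar≋const (ℤ.+ suc (suc _))   = ≋-refl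
    scalar≋const (ℤ.-[1+ _ ])        = ≋-refl

    scalarMorphism : CommutativeRing.rawRing ℤₚ.+-*-commutativeRing -Raw-AlmostCommutative⟶ acr
    scalarMorphism = record
      { ⟦_⟧    = scalar
      ; +-homo = λ c d → ≋-trans (scalar≋const (c ℤ.+ d)) (≋-trans (+-homo c d)
          (≋-sym (mk λ k → cong₂ ℤ._+_ (at (scalar≋const c) k) (at (scalar≋const d) k))))
      ; *-homo = λ c d → ≋-trans (scalar≋const (c ℤ.* d)) (≋-trans (*-homo c d)
          (≋-sym (*-cong (scalar≋const c) (scalar≋const d))))
      ; -‿homo = λ c → ≋-trans (scalar≋const (ℤ.- c)) (≋-trans (-‿homo c)
          (≋-sym (mk λ k → cong (λ x → ℤ.- x) (at (scalar≋const c) k))))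
      ; 0-homo = ≋-refl
      ; 1-homo = ≋-refl
      }
      where
      +-homo : ∀ c d → const (c ℤ.+ d) ≋ const c + const d
      +-homo c d = mk λ where
        zero    → refl
        (suc _) → refl
      *-homo : ∀ c d → const (c ℤ.* d) ≋ const c * const d
      *-homo c d = mk λ where
        zero    → refl
        (suc k) → sym (trans (const-* c (const d) (suc k)) (ℤₚ.*-zeroʳ c))
      -‿homo : ∀ c → const (ℤ.- c) ≋ - const c
      -‿homo c = mk λ where
        zero    → refl
        (suc _) → refl

    scalar≟ : WeaklyDecidable (λ c d → scalar c ≋ scalar d)
    scalar≟ c d with c ℤ.≟ d
    ... | yes refl = just ≋-refl
    ... | no  _    = nothing

  import Algebra.Solver.Ring
  module Solver = Algebra.Solver.Ring (CommutativeRing.rawRing ℤₚ.+-*-commutativeRing) acr scalarMorphism scalar≟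

-- Dilation, sign change and 2-dissection of series.

module Operators where

  open PowerSeries
  open import Algebra.Bundles using (CommutativeRing)
  open import Data.Integer as ℤ using (ℤ; 0ℤ; 1ℤ; +_; -1ℤ)
  import Data.Integer.Properties as ℤₚ
  open import Data.Integer.Tactic.RingSolver using (solve-∀)
  open import Data.Nat as ℕ using (ℕ; zero; suc; z≤n; s≤s)
  import Data.Nat.Properties as ℕₚ
  open import Relation.Binary.PropositionalEquality

  open CommutativeRing seriesRing public using (+-cong; -‿cong)
    renaming (setoid to seriesSetoid)

  +-congˡ : ∀ f {g g′} → g ≋ g′ → f + g ≋ f + g′
  +-congˡ f = +-cong (≋-refl {f})

  +-congʳ : ∀ g {f f′} → f ≋ f′ → f + g ≋ f′ + g
  +-congʳ g p = +-cong p (≋-refl {g})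

  -- Dilation D f = f(q²), sign change σ f = f(-q), and the even and odd
  -- parts U f, U′ f, determined by f = D (U f) + q · D (U′ f).
  D : Series → Series
  D f zero          = f 0
  D f (suc zero)    = 0ℤ
  D f (suc (suc k)) = D (tail f) k

  σ : Series → Series
  σ f zero    = f 0
  σ f (suc k) = ℤ.- σ (tail f) k

  U : Series → Series
  U f zero    = f 0
  U f (suc k) = U (tail (tail f)) k

  U′ : Series → Series
  U′ f = U (tail f)

  infixr 8 _·_
  _·_ : ℤ → Series → Series
  (c · f) k = c ℤ.* f k

  Dᵏ-cong : ∀ k {f g} → (∀ i → i ℕ.≤ k → f i ≡ g i) → D f k ≡ D g k
  Dᵏ-cong zero          p = p 0 z≤n
  Dᵏ-cong (suc zero)    p = refl
  Dᵏ-cong (suc (suc k)) p =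
    Dᵏ-cong k (λ i i≤k → p (suc i) (s≤s (ℕₚ.m≤n⇒m≤1+n i≤k)))

  D-cong : ∀ {f g} → f ≋ g → D f ≋ D g
  D-cong p = mk λ k → Dᵏ-cong k (λ i _ → at p i)

  D-+ᵏ : ∀ k f g → D (f + g) k ≡ D f k ℤ.+ D g k
  D-+ᵏ zero          f g = refl
  D-+ᵏ (suc zero)    f g = refl
  D-+ᵏ (suc (suc k)) f g = D-+ᵏ k (tail f) (tail g)

  D-+ : ∀ f g → D (f + g) ≋ D f + D g
  D-+ f g = mk λ k → D-+ᵏ k f g

  D-·ᵏ : ∀ k c f → D (c · f) k ≡ c ℤ.* D f k
  D-·ᵏ zero          c f = refl
  D-·ᵏ (suc zero)    c f = sym (ℤₚ.*-zeroʳ c)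
  D-·ᵏ (suc (suc k)) c f = D-·ᵏ k c (tail f)

  D-*ᵏ : ∀ k f g → D (f * g) k ≡ (D f * D g) k
  D-*ᵏ zero          f g = refl
  D-*ᵏ (suc zero)    f g = sym (cong (ℤ._+ 0ℤ) (ℤₚ.*-zeroʳ (f 0)))
  D-*ᵏ (suc (suc k)) f g = trans (D-+ᵏ k (f 0 · tail g) (tail f * g))
    (cong₂ ℤ._+_ (D-·ᵏ k (f 0) (tail g))
      (trans (D-*ᵏ k (tail f) g) (sym (ℤₚ.+-identityˡ _))))

  D-* : ∀ f g → D (f * g) ≋ D f * D g
  D-* f g = mk λ k → D-*ᵏ k f g

  D-- : ∀ f → D (- f) ≋ - D f
  D-- f = mk λ k → go k f
    where
    go : ∀ k f → D (- f) k ≡ ℤ.- D f k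
    go zero          f = refl
    go (suc zero)    f = refl
    go (suc (suc k)) f = go k (tail f)

  D-const : ∀ c → D (const c) ≋ const c
  D-const c = mk λ where
      zero          → refl
      (suc zero)    → refl
      (suc (suc k)) → zeros k
    where
    zeros : ∀ k → D 0# k ≡ 0ℤ
    zeros zero          = refl
    zeros (suc zero)    = refl
    zeros (suc (suc k)) = zeros k

  D-1# : D 1# ≋ 1#
  D-1# = ≋-trans (D-cong 1#≋const) (≋-trans (D-const 1ℤ) (≋-sym 1#≋const))

  q-*-suc : ∀ f k → (q * f) (suc k) ≡ f k
  q-*-suc f k = trans (ℤₚ.+-identityˡ _) (*-identityˡ f k)

  D-q : D q ≋ q * q
  D-q = mk λ where
    zero                → refl
    (suc zero)          → refl
    (suc (suc k))       → trans (at D-1# k) (sym (q-*-suc q (suc k)))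

  D-^ : ∀ f n → D (f ^ n) ≋ D f ^ n
  D-^ f zero    = D-1#
  D-^ f (suc n) = ≋-trans (D-* f (f ^ n)) (*-congˡ (D f) (D-^ f n))

  U-cong : ∀ {f g} → f ≋ g → U f ≋ U g
  U-cong p = mk λ k → go k p
    where
    go : ∀ k {f g} → f ≋ g → U f k ≡ U g k
    go zero    p = at p 0
    go (suc k) p = go k (mk λ i → at p (suc (suc i)))

  U-at : ∀ f k → U f k ≡ f (k ℕ.+ k)
  U-at f zero    = refl
  U-at f (suc k) = trans (U-at (tail (tail f)) k) (cong (λ i → f (suc i)) (sym (ℕₚ.+-suc k k)))

  U-+ᵏ : ∀ k f g → U (f + g) k ≡ U f k ℤ.+ U g k
  U-+ᵏ zero    f g = refl
  U-+ᵏ (suc k) f g = U-+ᵏ k (tail (tail f)) (tail (tail g))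

  U-+ : ∀ f g → U (f + g) ≋ U f + U g
  U-+ f g = mk λ k → U-+ᵏ k f g

  U-·ᵏ : ∀ k c f → U (c · f) k ≡ c ℤ.* U f k
  U-·ᵏ zero    c f = refl
  U-·ᵏ (suc k) c f = U-·ᵏ k c (tail (tail f))

  U-D : ∀ f → U (D f) ≋ f
  U-D f = mk λ k → go k f
    where
    go : ∀ k f → U (D f) k ≡ f k
    go zero    f = refl
    go (suc k) f = go k (tail f)

  -- Multiplication by a series in q² preserves the parity of exponents, so such a factor can be
  -- pulled out. Each dissection below is this formula, or `U′-D-*`, applied to a suitable
  -- multiplier.
  U-D-* : ∀ f g → U (D f * g) ≋ f * U g
  U-D-* f g = mk λ k → go k f
    where
    go : ∀ k f → U (D f * g) k ≡ (f * U g) k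
    go zero    f = refl
    go (suc k) f = trans
      (U-+ᵏ k (f 0 · tail (tail g)) _)
      (cong₂ ℤ._+_ (U-·ᵏ k (f 0) (tail (tail g)))
        (trans (at (U-cong (mk λ i → ℤₚ.+-identityˡ _)) k) (go k (tail f))))

  U′-cong : ∀ {f g} → f ≋ g → U′ f ≋ U′ g
  U′-cong p = U-cong (mk λ k → at p (suc k))

  U′-D-* : ∀ f g → U′ (D f * g) ≋ f * U′ g
  U′-D-* f g = mk λ k → go k f
    where
    go : ∀ k f → U′ (D f * g) k ≡ (f * U′ g) k
    go zero    f = ℤₚ.+-identityʳ _
    go (suc k) f = trans
      (U-+ᵏ k (f 0 · tail (tail (tail g))) _)
      (cong₂ ℤ._+_ (U-·ᵏ k (f 0) (tail (tail (tail g))))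
        (trans (at (U-cong (mk λ i → ℤₚ.+-identityˡ _)) k) (go k (tail f))))

  U-tail-D : ∀ k g → U (tail (D g)) k ≡ 0ℤ
  U-tail-D zero    g = refl
  U-tail-D (suc k) g = U-tail-D k (tail g)

  U-odd : ∀ f g → U (D f + q * D g) ≋ f
  U-odd f g = ≋-trans (U-+ (D f) (q * D g)) (≋-trans (+-cong (U-D f) odd) (mk λ k → ℤₚ.+-identityʳ (f k)))
    where
    odd : U (q * D g) ≋ 0#
    odd = mk λ where
      zero    → refl
      (suc k) → trans (at (U-cong (mk λ i → q-*-suc (D g) (suc i))) k) (U-tail-D k g)

  U′-odd : ∀ f g → U′ (D f + q * D g) ≋ g
  U′-odd f g = ≋-trans (U-+ (tail (D f)) (tail (q * D g)))
    (mk λ k → trans (cong₂ ℤ._+_ (U-tail-D k f)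
                (trans (at (U-cong (mk λ i → q-*-suc (D g) i)) k) (at (U-D g) k)))
              (ℤₚ.+-identityˡ (g k)))

  D-injective : ∀ {f g} → D f ≋ D g → f ≋ g
  D-injective {f} {g} p = ≋-trans (≋-sym (U-D f)) (≋-trans (U-cong p) (U-D g))

  σ-cong : ∀ {f g} → f ≋ g → σ f ≋ σ g
  σ-cong p = mk λ k → go k p
    where
    go : ∀ k {f g} → f ≋ g → σ f k ≡ σ g k
    go zero    p = at p 0
    go (suc k) p = cong (λ x → ℤ.- x) (go k (mk λ i → at p (suc i)))

  σ-+ᵏ : ∀ k f g → σ (f + g) k ≡ σ f k ℤ.+ σ g k
  σ-+ᵏ zero    f g = refl
  σ-+ᵏ (suc k) f g = trans (cong (λ x → ℤ.- x) (σ-+ᵏ k (tail f) (tail g))) (ℤₚ.neg-distrib-+ (σ (tail f) k) _)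

  σ-+ : ∀ f g → σ (f + g) ≋ σ f + σ g
  σ-+ f g = mk λ k → σ-+ᵏ k f g

  σ-·ᵏ : ∀ k c f → σ (c · f) k ≡ c ℤ.* σ f k
  σ-·ᵏ zero    c f = refl
  σ-·ᵏ (suc k) c f = trans (cong (λ x → ℤ.- x) (σ-·ᵏ k c (tail f))) (ℤₚ.neg-distribʳ-* c _)

  σ-*ᵏ : ∀ k f g → σ (f * g) k ≡ (σ f * σ g) k
  σ-*ᵏ zero    f g = refl
  σ-*ᵏ (suc k) f g = trans
    (cong (λ x → ℤ.- x) (trans (σ-+ᵏ k (f 0 · tail g) (tail f * g))
      (cong₂ ℤ._+_ (σ-·ᵏ k (f 0) (tail g)) (σ-*ᵏ k (tail f) g))))
    (trans (rearrange (f 0) (σ (tail g) k) _)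
      (cong (λ x → f 0 ℤ.* (ℤ.- σ (tail g) k) ℤ.+ x)
        (sym (trans (*-congᵏ {g′ = σ g} k (λ i _ → sym (ℤₚ.-1*i≡-i (σ (tail f) i))) (λ i _ → refl))
          (scale-* -1ℤ (σ (tail f)) (σ g) k)))))
    where
    rearrange : ∀ a b c → ℤ.- (a ℤ.* b ℤ.+ c) ≡ a ℤ.* (ℤ.- b) ℤ.+ -1ℤ ℤ.* c
    rearrange = solve-∀

  σ-* : ∀ f g → σ (f * g) ≋ σ f * σ g
  σ-* f g = mk λ k → σ-*ᵏ k f g

  σ-D : ∀ f → σ (D f) ≋ D f
  σ-D f = mk λ k → go k f
    where
    go : ∀ k f → σ (D f) k ≡ D f k
    go zero          f = refl
    go (suc zero)    f = refl
    go (suc (suc k)) f = trans (ℤₚ.neg-involutive _) (go k (tail f))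

  σ-const : ∀ c → σ (const c) ≋ const c
  σ-const c = ≋-trans (σ-cong (≋-sym (D-const c))) (≋-trans (σ-D (const c)) (D-const c))

  σ-q : σ q ≋ - q
  σ-q = mk λ where
    zero    → refl
    (suc k) → cong (λ x → ℤ.- x) (trans (at (σ-cong 1#≋const) k)
                (trans (at (σ-const 1ℤ) k) (sym (at 1#≋const k))))

-- Congruence modulo powers of q, infinite sums and infinite products.

module Convergence where

  open PowerSeries
  open Operators
  open import Data.Integer as ℤ using (ℤ; 0ℤ; 1ℤ; +_)
  import Data.Integer.Properties as ℤₚ
  open import Data.Nat as ℕ using (ℕ; zero; suc; z≤n; s≤s)
  import Data.Nat.Properties as ℕₚ
  open import Function using (_∘_)
  open import Relation.Binary.PropositionalEquality
  open import Relation.Nullary using (yes; no)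
  open import Algebra.Bundles using (CommutativeRing)
  open PowerSeries.Solver using (solve; _:+_; _:*_; _:=_)
  private module R = CommutativeRing seriesRing

  infix 4 _≈[_]_

  -- This is congruence modulo q^N, so `f ≈[ m ] 0#` says that `f` has order at least `m`. Limits
  -- are expressed through it: series congruent modulo every q^N are equal (`≈[]⇒≋`).
  record _≈[_]_ (f : Series) (N : ℕ) (g : Series) : Set where
    constructor mk
    field below : ∀ k → k ℕ.< N → f k ≡ g k
  open _≈[_]_ public

  ≋⇒≈[] : ∀ {N f g} → f ≋ g → f ≈[ N ] g
  ≋⇒≈[] p = mk λ k _ → at p k

  ≈[]⇒≋ : ∀ {f g} → (∀ N → f ≈[ N ] g) → f ≋ g
  ≈[]⇒≋ p = mk λ k → below (p (suc k)) k ℕₚ.≤-refl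

  ≈[]-refl : ∀ {N f} → f ≈[ N ] f
  ≈[]-refl = mk λ _ _ → refl

  ≈[]-sym : ∀ {N f g} → f ≈[ N ] g → g ≈[ N ] f
  ≈[]-sym p = mk λ k k<N → sym (below p k k<N)

  ≈[]-trans : ∀ {N f g h} → f ≈[ N ] g → g ≈[ N ] h → f ≈[ N ] h
  ≈[]-trans p r = mk λ k k<N → trans (below p k k<N) (below r k k<N)

  infixr 2 _≈[]⟨_⟩_
  infix  3 _∎[]

  _≈[]⟨_⟩_ : ∀ {N} f {g h} → f ≈[ N ] g → g ≈[ N ] h → f ≈[ N ] h
  f ≈[]⟨ p ⟩ r = ≈[]-trans p r

  _∎[] : ∀ {N} f → f ≈[ N ] f
  f ∎[] = ≈[]-refl

  weaken : ∀ {M N f g} → M ℕ.≤ N → f ≈[ N ] g → f ≈[ M ] g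
  weaken M≤N p = mk λ k k<M → below p k (ℕₚ.<-≤-trans k<M M≤N)

  ≈[]-+ : ∀ {N f f′ g g′} → f ≈[ N ] f′ → g ≈[ N ] g′ → f + g ≈[ N ] f′ + g′
  ≈[]-+ p r = mk λ k k<N → cong₂ ℤ._+_ (below p k k<N) (below r k k<N)

  ≈[]-neg : ∀ {N f f′} → f ≈[ N ] f′ → - f ≈[ N ] - f′
  ≈[]-neg p = mk λ k k<N → cong (λ x → ℤ.- x) (below p k k<N)

  ≈[]-* : ∀ {N f f′ g g′} → f ≈[ N ] f′ → g ≈[ N ] g′ → f * g ≈[ N ] f′ * g′
  ≈[]-* p r = mk λ k k<N → *-congᵏ k
    (λ i i≤k → below p i (ℕₚ.≤-<-trans i≤k k<N))
    (λ i i≤k → below r i (ℕₚ.≤-<-trans i≤k k<N))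

  order-* : ∀ {m n f g} → f ≈[ m ] 0# → g ≈[ n ] 0# → f * g ≈[ m ℕ.+ n ] 0#
  order-* {m} {n} {f} {g} p r = mk λ k k<m+n → ∑≤-zero k _ (term k k<m+n)
    where
    term : ∀ k → k ℕ.< m ℕ.+ n → ∀ i → i ℕ.≤ k → f i ℤ.* g (k ℕ.∸ i) ≡ 0ℤ
    term k k<m+n i i≤k with i ℕ.<? m
    ... | yes i<m = cong (ℤ._* g (k ℕ.∸ i)) (below p i i<m)
    ... | no  i≮m = trans (cong (λ x → f i ℤ.* x) (below r (k ℕ.∸ i) k∸i<n)) (ℤₚ.*-zeroʳ (f i))
      where
      k∸i<n : k ℕ.∸ i ℕ.< n
      k∸i<n = ℕₚ.+-cancelˡ-< i _ _ (subst (ℕ._< i ℕ.+ n) (sym (ℕₚ.m+[n∸m]≡n i≤k))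
        (ℕₚ.<-≤-trans k<m+n (ℕₚ.+-monoˡ-≤ n (ℕₚ.≮⇒≥ i≮m))))

  order-*ʳ : ∀ {m f} g → f ≈[ m ] 0# → f * g ≈[ m ] 0#
  order-*ʳ {m} {f} g p = weaken (ℕₚ.m≤m+n m 0) (order-* {n = 0} {g = g} p (mk λ _ ()))

  order-*ˡ : ∀ {m f} g → f ≈[ m ] 0# → g * f ≈[ m ] 0#
  order-*ˡ {m} {f} g p = ≈[]-trans (≋⇒≈[] (R.*-comm g f)) (order-*ʳ g p)

  ^-+ : ∀ p a b → p ^ (a ℕ.+ b) ≋ p ^ a * p ^ b
  ^-+ p zero    b = ≋-sym (R.*-identityˡ (p ^ b))
  ^-+ p (suc a) b = ≋-trans (*-congˡ p (^-+ p a b)) (≋-sym (R.*-assoc p (p ^ a) (p ^ b)))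

  ^-cong : ∀ n {f g} → f ≋ g → f ^ n ≋ g ^ n
  ^-cong zero    p = ≋-refl
  ^-cong (suc n) p = *-cong p (^-cong n p)

  *-^ : ∀ n f g → (f * g) ^ n ≋ f ^ n * g ^ n
  *-^ zero    f g = ≋-sym (R.*-identityʳ 1#)
  *-^ (suc n) f g = ≋-trans (*-congˡ (f * g) (*-^ n f g))
    (solve 4 (λ f g x y → f :* g :* (x :* y) := f :* x :* (g :* y)) ≋-refl f g (f ^ n) (g ^ n))

  order-^ : ∀ {p} → p ≈[ 1 ] 0# → ∀ n → p ^ n ≈[ n ] 0#
  order-^ o zero    = mk λ _ ()
  order-^ o (suc n) = order-* o (order-^ o n)

  order-q^ : ∀ m → q ^ m ≈[ m ] 0#
  order-q^ m = mk (q^-low m)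

  inv : Series → Series
  inv g = 1# / g

  inv-* : ∀ {g} → g 0 ≡ 1ℤ → inv g * g ≋ 1#
  inv-* {g} g0 = mk (/-correct 1# g g0)

  *-cancelʳ : ∀ h f g → h 0 ≡ 1ℤ → f * h ≋ g * h → f ≋ g
  *-cancelʳ h f g h0 p = ≋-trans (expand f) (≋-trans (*-congʳ (inv h) p) (≋-sym (expand g)))
    where
    expand : ∀ f → f ≋ f * h * inv h
    expand f = ≋-trans (≋-sym (R.*-identityʳ f)) (≋-trans (*-congˡ f (≋-sym (inv-* h0)))
      (solve 3 (λ f h i → f :* (i :* h) := f :* h :* i) ≋-refl f h (inv h)))

  ≈[]-cancelʳ : ∀ {N} h f g → h 0 ≡ 1ℤ → f * h ≈[ N ] g * h → f ≈[ N ] g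
  ≈[]-cancelʳ {N} h f g h0 p = ≈[]-trans (expand f) (≈[]-trans (≈[]-* p (≈[]-refl {f = inv h})) (≈[]-sym (expand g)))
    where
    expand : ∀ f → f ≈[ N ] f * h * inv h
    expand f = ≋⇒≈[] (≋-trans (≋-sym (R.*-identityʳ f)) (≋-trans (*-congˡ f (≋-sym (inv-* h0)))
      (solve 3 (λ f h i → f :* (i :* h) := f :* h :* i) ≋-refl f h (inv h))))

  D-≈[] : ∀ {N f g} → f ≈[ N ] g → D f ≈[ N ] D g
  D-≈[] p = mk λ k k<N → Dᵏ-cong k (λ i i≤k → below p i (ℕₚ.≤-<-trans i≤k k<N))

  σ-≈[] : ∀ {N f g} → f ≈[ N ] g → σ f ≈[ N ] σ g
  σ-≈[] p = mk λ k k<N → go k λ i i≤k → below p i (ℕₚ.≤-<-trans i≤k k<N)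
    where
    go : ∀ k {f g} → (∀ i → i ℕ.≤ k → f i ≡ g i) → σ f k ≡ σ g k
    go zero    p = p 0 z≤n
    go (suc k) p = cong (λ x → ℤ.- x) (go k λ i i≤k → p (suc i) (s≤s i≤k))

  ∑ : ℕ → (ℕ → Series) → Series
  ∑ zero    F = 0#
  ∑ (suc n) F = ∑ n F + F n

  ∑-cong : ∀ n {F G} → (∀ i → F i ≋ G i) → ∑ n F ≋ ∑ n G
  ∑-cong zero    p = ≋-refl
  ∑-cong (suc n) p = +-cong (∑-cong n p) (p n)

  ∑-first : ∀ n F → ∑ (suc n) F ≋ F 0 + ∑ n (F ∘ suc)
  ∑-first zero    F = R.+-comm 0# (F 0)
  ∑-first (suc n) F = ≋-trans (+-cong (∑-first n F) (≋-refl {F (suc n)})) (R.+-assoc (F 0) _ (F (suc n)))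

  ∑-+ : ∀ n F G → ∑ n (λ i → F i + G i) ≋ ∑ n F + ∑ n G
  ∑-+ zero    F G = mk λ _ → refl
  ∑-+ (suc n) F G = ≋-trans (+-cong (∑-+ n F G) (≋-refl {F n + G n}))
    (solve 4 (λ a b c d → (a :+ b) :+ (c :+ d) := (a :+ c) :+ (b :+ d)) ≋-refl (∑ n F) (∑ n G) (F n) (G n))

  *-∑ : ∀ c n F → c * ∑ n F ≋ ∑ n (λ i → c * F i)
  *-∑ c zero    F = R.zeroʳ c
  *-∑ c (suc n) F = ≋-trans (R.distribˡ c (∑ n F) (F n)) (+-cong (*-∑ c n F) (≋-refl {c * F n}))

  ∑-≈[] : ∀ {N} n {F G} → (∀ i → i ℕ.< n → F i ≈[ N ] G i) → ∑ n F ≈[ N ] ∑ n G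
  ∑-≈[] zero    p = ≈[]-refl
  ∑-≈[] (suc n) p = ≈[]-+ (∑-≈[] n (λ i i<n → p i (ℕₚ.m≤n⇒m≤1+n i<n))) (p n ℕₚ.≤-refl)

  ∑-D : ∀ n F → D (∑ n F) ≋ ∑ n (D ∘ F)
  ∑-D zero    F = ≋-trans (D-cong 0#≋const) (≋-trans (D-const 0ℤ) (≋-sym 0#≋const))
    where
    0#≋const : 0# ≋ const 0ℤ
    0#≋const = mk λ where
      zero    → refl
      (suc _) → refl
  ∑-D (suc n) F = ≋-trans (D-+ (∑ n F) (F n)) (+-cong (∑-D n F) (≋-refl {D (F n)}))

  ∑-double : ∀ n F → ∑ (n ℕ.+ n) F ≋ ∑ n (λ i → F (i ℕ.+ i)) + ∑ n (λ i → F (suc (i ℕ.+ i)))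
  ∑-double zero    F = mk λ _ → refl
  ∑-double (suc n) F rewrite ℕₚ.+-suc n n = ≋-trans
    (+-cong (+-cong (∑-double n F) (≋-refl {F (n ℕ.+ n)})) (≋-refl {F (suc (n ℕ.+ n))}))
    (solve 4 (λ a b c d → a :+ b :+ c :+ d := (a :+ c) :+ (b :+ d)) ≋-refl
      (∑ n (λ i → F (i ℕ.+ i))) (∑ n (λ i → F (suc (i ℕ.+ i)))) (F (n ℕ.+ n)) (F (suc (n ℕ.+ n))))

  ∑≤-last : ∀ n f → ∑≤ (suc n) f ≡ ∑≤ n f ℤ.+ f (suc n)
  ∑≤-last zero    f = refl
  ∑≤-last (suc n) f = trans (cong (λ x → f 0 ℤ.+ x) (∑≤-last n (f ∘ suc))) (sym (ℤₚ.+-assoc (f 0) _ _))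

  ∑-at : ∀ n F k → ∑ (suc n) F k ≡ ∑≤ n (λ i → F i k)
  ∑-at zero    F k = ℤₚ.+-identityˡ (F 0 k)
  ∑-at (suc n) F k = trans (cong (ℤ._+ F (suc n) k) (∑-at n F k)) (sym (∑≤-last n _))

  -- `∑∞` adds only the terms of index at most k in coefficient k; this condition makes that
  -- truncation the true sum.
  Summable : (ℕ → Series) → Set
  Summable F = ∀ n → F n ≈[ n ] 0#

  ∑∞-trunc : ∀ {F} → Summable F → ∀ {N M} → N ℕ.≤ M → ∑∞ F ≈[ N ] ∑ M F
  ∑∞-trunc {F} s {N} {zero}  z≤n = mk λ _ ()
  ∑∞-trunc {F} s {N} {suc M} N≤M = mk λ k k<N → sym (trans (∑-at M F k)
    (∑≤-stable k M _ (ℕₚ.≤-pred (ℕₚ.≤-trans k<N N≤M)) (λ n k<n → below (s n) k k<n)))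

  ∑∞-unique : ∀ {F f} → Summable F → (∀ N → f ≈[ N ] ∑ N F) → f ≋ ∑∞ F
  ∑∞-unique s p = ≈[]⇒≋ λ N → ≈[]-trans (p N) (≈[]-sym (∑∞-trunc s ℕₚ.≤-refl))

  ∑∞-≈[] : ∀ {N F G} → (∀ i → F i ≈[ N ] G i) → ∑∞ F ≈[ N ] ∑∞ G
  ∑∞-≈[] p = mk λ k k<N → ∑≤-cong k (λ i _ → below (p i) k k<N)

  ∑∞-cong : ∀ {F G} → (∀ i → F i ≋ G i) → ∑∞ F ≋ ∑∞ G
  ∑∞-cong p = mk λ k → ∑≤-cong k (λ i _ → at (p i) k)

  ∑∞-first : ∀ {F} → Summable F → ∑∞ F ≋ F 0 + ∑∞ (F ∘ suc)
  ∑∞-first {F} s = ≋-sym (∑∞-unique s λ where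
    zero    → mk λ _ ()
    (suc N) → ≈[]-trans
      (≈[]-+ (≈[]-refl {f = F 0}) (mk λ k k≤N → trans
        (below (∑∞-trunc (λ n → weaken (ℕₚ.n≤1+n n) (s (suc n))) {N = suc N} {M = suc N} ℕₚ.≤-refl) k k≤N)
        (trans (cong (λ x → ∑ N (F ∘ suc) k ℤ.+ x) (below (s (suc N)) k k≤N)) (ℤₚ.+-identityʳ _))))
      (≋⇒≈[] (≋-sym (∑-first N F))))

  ∑∞-D : ∀ {F} → Summable F → D (∑∞ F) ≋ ∑∞ (D ∘ F)
  ∑∞-D {F} s = ∑∞-unique
    (λ n → ≈[]-trans (D-≈[] (s n)) (≋⇒≈[] (∑-D 0 F)))
    (λ N → ≈[]-trans (D-≈[] (∑∞-trunc s ℕₚ.≤-refl)) (≋⇒≈[] (∑-D N F)))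

  *-∑∞ : ∀ c {F} → Summable F → c * ∑∞ F ≋ ∑∞ (λ n → c * F n)
  *-∑∞ c {F} s = ∑∞-unique (λ n → order-*ˡ c (s n))
    (λ N → ≈[]-trans (≈[]-* (≈[]-refl {f = c}) (∑∞-trunc s ℕₚ.≤-refl)) (≋⇒≈[] (*-∑ c N F)))

  ∑∞-double : ∀ {F} → Summable F →
              ∑∞ F ≋ ∑∞ (λ i → F (i ℕ.+ i)) + ∑∞ (λ i → F (suc (i ℕ.+ i)))
  ∑∞-double {F} s = ≈[]⇒≋ λ N → ≈[]-trans (∑∞-trunc s (ℕₚ.m≤m+n N N)) (≈[]-trans (≋⇒≈[] (∑-double N F))
    (≈[]-sym (≈[]-+
      (∑∞-trunc (λ n → weaken (ℕₚ.m≤m+n n n) (s (n ℕ.+ n))) ℕₚ.≤-refl)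
      (∑∞-trunc (λ n → weaken (ℕₚ.m≤n⇒m≤1+n (ℕₚ.m≤m+n n n)) (s (suc (n ℕ.+ n)))) ℕₚ.≤-refl))))

  ∏ : ℕ → (ℕ → Series) → Series
  ∏ zero    F = 1#
  ∏ (suc n) F = ∏ n F * F n

  -- Under `Multipliable` the factor of index i is 1 modulo q^(i+1), so later factors do not reach
  -- coefficient k and the truncation is exact.
  ∏∞ : (ℕ → Series) → Series
  ∏∞ F k = ∏ (suc k) F k

  Multipliable : (ℕ → Series) → Set
  Multipliable F = ∀ i → F i ≈[ suc i ] 1#

  ∏-cong : ∀ n {F G} → (∀ i → F i ≋ G i) → ∏ n F ≋ ∏ n G
  ∏-cong zero    p = ≋-refl
  ∏-cong (suc n) p = *-cong (∏-cong n p) (p n)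

  ∏-first : ∀ n F → ∏ (suc n) F ≋ F 0 * ∏ n (F ∘ suc)
  ∏-first zero    F = R.*-comm 1# (F 0)
  ∏-first (suc n) F = ≋-trans (*-congʳ (F (suc n)) (∏-first n F)) (R.*-assoc (F 0) (∏ n (F ∘ suc)) (F (suc n)))

  ∏-* : ∀ n F G → ∏ n (λ i → F i * G i) ≋ ∏ n F * ∏ n G
  ∏-* zero    F G = ≋-sym (R.*-identityʳ 1#)
  ∏-* (suc n) F G = ≋-trans (*-congʳ (F n * G n) (∏-* n F G))
    (solve 4 (λ a b c d → (a :* b) :* (c :* d) := (a :* c) :* (b :* d)) ≋-refl (∏ n F) (∏ n G) (F n) (G n))

  ∏-D : ∀ n F → D (∏ n F) ≋ ∏ n (D ∘ F)
  ∏-D zero    F = D-1#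
  ∏-D (suc n) F = ≋-trans (D-* (∏ n F) (F n)) (*-congʳ (D (F n)) (∏-D n F))

  ∏-σ : ∀ n F → σ (∏ n F) ≋ ∏ n (σ ∘ F)
  ∏-σ zero    F = ≋-trans (σ-cong 1#≋const) (≋-trans (σ-const 1ℤ) (≋-sym 1#≋const))
  ∏-σ (suc n) F = ≋-trans (σ-* (∏ n F) (F n)) (*-congʳ (σ (F n)) (∏-σ n F))

  ∏-append : ∀ m n F → ∏ (n ℕ.+ m) F ≋ ∏ m F * ∏ n (λ j → F (j ℕ.+ m))
  ∏-append m zero    F = ≋-sym (R.*-identityʳ (∏ m F))
  ∏-append m (suc n) F = ≋-trans (*-congʳ (F (n ℕ.+ m)) (∏-append m n F))
    (R.*-assoc (∏ m F) (∏ n (λ j → F (j ℕ.+ m))) (F (n ℕ.+ m)))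

  ∏-blocks : ∀ m n F → ∏ (n ℕ.* m) F ≋ ∏ n (λ i → ∏ m (λ j → F (j ℕ.+ i ℕ.* m)))
  ∏-blocks m zero    F = ≋-refl
  ∏-blocks m (suc n) F = ≋-trans (∏-append (n ℕ.* m) m F)
    (*-congʳ (∏ m (λ j → F (j ℕ.+ n ℕ.* m))) (∏-blocks m n F))

  ∏-≈[]1 : ∀ {N} n {F} → (∀ i → F i ≈[ N ] 1#) → ∏ n F ≈[ N ] 1#
  ∏-≈[]1 zero    p = ≈[]-refl
  ∏-≈[]1 (suc n) p = ≈[]-trans (≈[]-* (∏-≈[]1 n p) (p n)) (≋⇒≈[] (R.*-identityʳ 1#))

  ∏-stable : ∀ {F} → Multipliable F → ∀ N d → ∏ (d ℕ.+ N) F ≈[ suc N ] ∏ N F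
  ∏-stable {F} c N d = ≈[]-trans (≋⇒≈[] (∏-append N d F)) (≈[]-trans
    (≈[]-* (≈[]-refl {f = ∏ N F}) (∏-≈[]1 d (λ j → weaken (s≤s (ℕₚ.m≤n+m N j)) (c (j ℕ.+ N)))))
    (≋⇒≈[] (R.*-identityʳ (∏ N F))))

  ∏∞-trunc : ∀ {F} → Multipliable F → ∀ {N M} → N ℕ.≤ M → ∏∞ F ≈[ suc N ] ∏ M F
  ∏∞-trunc {F} c {N} {M} N≤M = mk λ k k≤N →
    trans (below (∏-stable c k 1) k ℕₚ.≤-refl)
      (sym (subst (λ n → ∏ n F k ≡ ∏ k F k) (ℕₚ.m∸n+n≡m (ℕₚ.≤-trans (ℕₚ.≤-pred k≤N) N≤M))
        (below (∏-stable c k (M ℕ.∸ k)) k ℕₚ.≤-refl)))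

  ∏∞-trunc′ : ∀ {F} → Multipliable F → ∀ {N M} → N ℕ.≤ M → ∏∞ F ≈[ N ] ∏ M F
  ∏∞-trunc′ c {N} N≤M = weaken (ℕₚ.n≤1+n N) (∏∞-trunc c N≤M)

  ∏∞-unique : ∀ {F f} → Multipliable F → (∀ N → f ≈[ N ] ∏ N F) → f ≋ ∏∞ F
  ∏∞-unique c p = ≈[]⇒≋ λ N → ≈[]-trans (p N) (≈[]-sym (∏∞-trunc′ c ℕₚ.≤-refl))

  ∏∞-cong : ∀ {F G} → (∀ i → F i ≋ G i) → ∏∞ F ≋ ∏∞ G
  ∏∞-cong p = mk λ k → at (∏-cong (suc k) p) k

  ∏∞-0 : ∀ {F} → Multipliable F → ∏∞ F 0 ≡ 1ℤ
  ∏∞-0 c = below (∏∞-trunc c {M = 0} z≤n) 0 (s≤s z≤n)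

  multipliable-* : ∀ {F G} → Multipliable F → Multipliable G → Multipliable (λ i → F i * G i)
  multipliable-* c d i = ≈[]-trans (≈[]-* (c i) (d i)) (≋⇒≈[] (R.*-identityʳ 1#))

  ∏∞-* : ∀ {F G} → Multipliable F → Multipliable G → ∏∞ (λ i → F i * G i) ≋ ∏∞ F * ∏∞ G
  ∏∞-* {F} {G} c d = ≋-sym (∏∞-unique (multipliable-* c d) λ N → ≈[]-trans
    (≈[]-* (∏∞-trunc′ c ℕₚ.≤-refl) (∏∞-trunc′ d ℕₚ.≤-refl)) (≋⇒≈[] (≋-sym (∏-* N F G))))

  ∏∞-D : ∀ {F} → Multipliable F → D (∏∞ F) ≋ ∏∞ (D ∘ F)
  ∏∞-D {F} c = ∏∞-unique
    (λ n → ≈[]-trans (D-≈[] (c n)) (≋⇒≈[] D-1#))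
    (λ N → ≈[]-trans (D-≈[] (∏∞-trunc′ c ℕₚ.≤-refl)) (≋⇒≈[] (∏-D N F)))

  ∏∞-σ : ∀ {F} → Multipliable F → σ (∏∞ F) ≋ ∏∞ (σ ∘ F)
  ∏∞-σ {F} c = ∏∞-unique
    (λ n → ≈[]-trans (σ-≈[] (c n)) (≋⇒≈[] (∏-σ 0 F)))
    (λ N → ≈[]-trans (σ-≈[] (∏∞-trunc′ c ℕₚ.≤-refl)) (≋⇒≈[] (∏-σ N F)))

  -- Sorts factors by their index modulo `m`. It is applied with m = 2 and m = 3 to split products
  -- into arithmetic progressions of exponents.
  ∏∞-blocks : ∀ m .{{_ : ℕ.NonZero m}} {F} → Multipliable F →
              ∏∞ F ≋ ∏∞ (λ i → ∏ m (λ j → F (j ℕ.+ i ℕ.* m)))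
  ∏∞-blocks m {F} c = ∏∞-unique
    (λ i → ∏-≈[]1 m (λ j → weaken (s≤s (ℕₚ.≤-trans (ℕₚ.m≤m*n i m) (ℕₚ.m≤n+m (i ℕ.* m) j))) (c (j ℕ.+ i ℕ.* m))))
    (λ N → ≈[]-trans (∏∞-trunc′ c (ℕₚ.m≤m*n N m)) (≋⇒≈[] (∏-blocks m N F)))

-- The Jacobi triple product as the limit of its finite form.

module JacobiTripleProduct where

  open PowerSeries
  open Operators
  open Convergence
  open import Algebra.Bundles using (CommutativeRing)
  open import Data.Integer using (0ℤ; 1ℤ)
  open import Data.Nat as ℕ using (ℕ; zero; suc; s≤s)
  import Data.Integer.Properties as ℤₚ
  import Data.Nat.Properties as ℕₚ
  open import Function using (_∘_)
  open import Relation.Binary.PropositionalEquality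
  open import Relation.Nullary using (yes; no)
  open PowerSeries.Solver using (solve; _:+_; _:*_; _:=_; _:-_; con)
  open import Relation.Binary.Reasoning.Setoid seriesSetoid
  private module R = CommutativeRing seriesRing

  -- gauss p N k is the Gaussian binomial coefficient [N choose k] in base p.
  gauss : Series → ℕ → ℕ → Series
  gauss p N       zero    = 1#
  gauss p zero    (suc k) = 0#
  gauss p (suc N) (suc k) = gauss p N k + p ^ suc k * gauss p N (suc k)

  gauss-large : ∀ p N k → N ℕ.< k → gauss p N k ≋ 0#
  gauss-large p zero    (suc k) _         = ≋-refl
  gauss-large p (suc N) (suc k) (s≤s N<k) = begin
    gauss p N k + p ^ suc k * gauss p N (suc k)
      ≈⟨ +-cong (gauss-large p N k N<k) (*-congˡ (p ^ suc k) (gauss-large p N (suc k) (ℕₚ.m≤n⇒m≤1+n N<k))) ⟩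
    0# + p ^ suc k * 0#
      ≈⟨ ≋-trans (R.+-identityˡ (p ^ suc k * 0#)) (R.zeroʳ (p ^ suc k)) ⟩
    0# ∎

  gauss-diagonal : ∀ p k → gauss p k k ≋ 1#
  gauss-diagonal p zero    = ≋-refl
  gauss-diagonal p (suc k) = begin
    gauss p k k + p ^ suc k * gauss p k (suc k)
      ≈⟨ +-cong (gauss-diagonal p k) (*-congˡ (p ^ suc k) (gauss-large p k (suc k) ℕₚ.≤-refl)) ⟩
    1# + p ^ suc k * 0#
      ≈⟨ ≋-trans (+-congˡ 1# (R.zeroʳ (p ^ suc k))) (R.+-identityʳ 1#) ⟩
    1# ∎

  euler : Series → ℕ → Series
  euler p i = 1# - p ^ suc i

  -- The quotient formula for Gaussian binomials, cleared of denominators. With u = p^(k+1) and v =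
  -- p^(m+1), the Pascal recursion reduces it to (1 - u) + u (1 - v) = 1 - u v.
  gauss-factorial : ∀ p k m →
    gauss p (k ℕ.+ m) k * (∏ k (euler p) * ∏ m (euler p)) ≋ ∏ (k ℕ.+ m) (euler p)
  gauss-factorial p zero    m = ≋-trans (R.*-identityˡ (1# * ∏ m (euler p))) (R.*-identityˡ (∏ m (euler p)))
  gauss-factorial p (suc k) zero rewrite ℕₚ.+-identityʳ k = begin
    gauss p (suc k) (suc k) * (∏ (suc k) (euler p) * 1#)
      ≈⟨ *-cong (gauss-diagonal p (suc k)) (R.*-identityʳ (∏ (suc k) (euler p))) ⟩
    1# * ∏ (suc k) (euler p)
      ≈⟨ R.*-identityˡ (∏ (suc k) (euler p)) ⟩
    ∏ (suc k) (euler p) ∎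
  gauss-factorial p (suc k) (suc m) = begin
    (g₁ + p ^ suc k * g₂) * (e₁ * (1# - p ^ suc k) * (e₂ * (1# - p ^ suc m)))
      ≈⟨ solve 6 (λ g₁ g₂ e₁ e₂ u v → (g₁ :+ u :* g₂) :* (e₁ :* (con 1ℤ :- u) :* (e₂ :* (con 1ℤ :- v)))
           := (con 1ℤ :- u) :* (g₁ :* (e₁ :* (e₂ :* (con 1ℤ :- v)))) :+ u :* (con 1ℤ :- v) :* (g₂ :* (e₁ :* (con 1ℤ :- u) :* e₂)))
           ≋-refl g₁ g₂ e₁ e₂ (p ^ suc k) (p ^ suc m) ⟩
    (1# - p ^ suc k) * (g₁ * (e₁ * ∏ (suc m) (euler p))) + p ^ suc k * (1# - p ^ suc m) * (g₂ * (∏ (suc k) (euler p) * e₂))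
      ≈⟨ +-cong (*-congˡ (1# - p ^ suc k) (gauss-factorial p k (suc m))) (*-congˡ (p ^ suc k * (1# - p ^ suc m)) second) ⟩
    (1# - p ^ suc k) * e + p ^ suc k * (1# - p ^ suc m) * e
      ≈⟨ solve 3 (λ e u v → (con 1ℤ :- u) :* e :+ u :* (con 1ℤ :- v) :* e := e :* (con 1ℤ :- u :* v))
           ≋-refl e (p ^ suc k) (p ^ suc m) ⟩
    e * (1# - p ^ suc k * p ^ suc m)
      ≈⟨ *-congˡ e (+-congˡ 1# (-‿cong (≋-sym (^-+ p (suc k) (suc m))))) ⟩
    e * (1# - p ^ (suc k ℕ.+ suc m)) ∎
    where
    g₁ = gauss p (k ℕ.+ suc m) k
    g₂ = gauss p (k ℕ.+ suc m) (suc k)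
    e₁ = ∏ k (euler p)
    e₂ = ∏ m (euler p)
    e  = ∏ (k ℕ.+ suc m) (euler p)
    second : g₂ * (∏ (suc k) (euler p) * e₂) ≋ e
    second rewrite ℕₚ.+-suc k m = gauss-factorial p (suc k) m

  -- The Pascal recursion summed against weights. Its two halves stay separate because each is
  -- recognised separately in `q-binomial` and `finite-triple-product`; the second is one term
  -- shorter since [N choose N+1] = 0.
  gauss-split : ∀ p N (F : ℕ → Series) →
    ∑ (suc (suc N)) (λ k → gauss p (suc N) k * F k) ≋
    F 0 + (∑ (suc N) (λ k → gauss p N k * F (suc k)) + ∑ N (λ k → p ^ suc k * gauss p N (suc k) * F (suc k)))
  gauss-split p N F = begin
    ∑ (suc (suc N)) (λ k → gauss p (suc N) k * F k)
      ≈⟨ ∑-first (suc N) (λ k → gauss p (suc N) k * F k) ⟩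
    1# * F 0 + ∑ (suc N) (λ k → (gauss p N k + p ^ suc k * gauss p N (suc k)) * F (suc k))
      ≈⟨ +-cong (R.*-identityˡ (F 0)) (≋-trans
           (∑-cong (suc N) (λ k → R.distribʳ (F (suc k)) (gauss p N k) (p ^ suc k * gauss p N (suc k))))
           (∑-+ (suc N) (λ k → gauss p N k * F (suc k)) H)) ⟩
    F 0 + (∑ (suc N) (λ k → gauss p N k * F (suc k)) + (∑ N H + H N))
      ≈⟨ +-congˡ (F 0) (+-congˡ (∑ (suc N) (λ k → gauss p N k * F (suc k)))
           (≋-trans (+-congˡ (∑ N H) last≋0) (R.+-identityʳ (∑ N H)))) ⟩
    F 0 + (∑ (suc N) (λ k → gauss p N k * F (suc k)) + ∑ N H) ∎
    where
    H : ℕ → Series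
    H k = p ^ suc k * gauss p N (suc k) * F (suc k)
    last≋0 : H N ≋ 0#
    last≋0 = begin
      p ^ suc N * gauss p N (suc N) * F (suc N)
        ≈⟨ *-congʳ (F (suc N)) (*-congˡ (p ^ suc N) (gauss-large p N (suc N) ℕₚ.≤-refl)) ⟩
      p ^ suc N * 0# * F (suc N)
        ≈⟨ ≋-trans (*-congʳ (F (suc N)) (R.zeroʳ (p ^ suc N))) (R.zeroˡ (F (suc N))) ⟩
      0# ∎

  gauss-first : ∀ p N (F : ℕ → Series) →
    ∑ (suc N) (λ k → gauss p N k * F k) ≋ F 0 + ∑ N (λ k → gauss p N (suc k) * F (suc k))
  gauss-first p N F = ≋-trans (∑-first N (λ k → gauss p N k * F k)) (+-congʳ (∑ N (λ k → gauss p N (suc k) * F (suc k))) (R.*-identityˡ (F 0)))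

  -- The theta series of x and y with x y = p has the terms θ p x j for j ≥ 0
  -- and θ p y j for −j < 0.
  θ : Series → Series → ℕ → Series
  θ p z zero    = 1#
  θ p z (suc j) = θ p z j * (z * p ^ j)

  factor : Series → Series → ℕ → Series
  factor p z i = 1# + z * p ^ i

  -- Here `θ p x k` is x^k p^(k(k-1)/2). Splitting off the factor 1 + x leaves the product for x p,
  -- and θ p (x p) k = p^k θ p x k. With s the sum for x p, the parts x s and s of (1 + x) s are the
  -- two halves of the Pascal recursion.
  q-binomial : ∀ p a x → ∏ a (factor p x) ≋ ∑ (suc a) (λ k → gauss p a k * θ p x k)
  q-binomial p zero    x = solve 0 (con 1ℤ := con 0ℤ :+ con 1ℤ :* con 1ℤ) ≋-refl
  q-binomial p (suc a) x = begin
    ∏ (suc a) (factor p x)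
      ≈⟨ ∏-first a (factor p x) ⟩
    (1# + x * 1#) * ∏ a (λ i → 1# + x * (p * p ^ i))
      ≈⟨ *-congˡ (1# + x * 1#) (≋-trans (∏-cong a (λ i → +-congˡ 1# (≋-sym (R.*-assoc x p (p ^ i))))) (q-binomial p a (x * p))) ⟩
    (1# + x * 1#) * ∑ (suc a) (λ k → gauss p a k * θ p (x * p) k)
      ≈⟨ *-congˡ (1# + x * 1#) (∑-cong (suc a) (λ k → *-congˡ (gauss p a k) (θ-scale k))) ⟩
    (1# + x * 1#) * ∑ (suc a) (λ k → gauss p a k * (p ^ k * θ p x k))
      ≈⟨ solve 2 (λ x s → (con 1ℤ :+ x :* con 1ℤ) :* s := x :* s :+ s) ≋-refl x s ⟩
    x * s + s
      ≈⟨ +-cong (≋-trans (*-∑ x (suc a) (λ k → gauss p a k * (p ^ k * θ p x k))) (∑-cong (suc a) λ k →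
           solve 4 (λ x g p t → x :* (g :* (p :* t)) := g :* (t :* (x :* p))) ≋-refl x (gauss p a k) (p ^ k) (θ p x k)))
           (≋-trans (gauss-first p a (λ k → p ^ k * θ p x k)) (+-cong (R.*-identityˡ 1#) (∑-cong a λ k →
             solve 3 (λ g p t → g :* (p :* t) := p :* g :* t) ≋-refl (gauss p a (suc k)) (p ^ suc k) (θ p x (suc k))))) ⟩
    ∑ (suc a) (λ k → gauss p a k * θ p x (suc k)) + (1# + ∑ a (λ k → p ^ suc k * gauss p a (suc k) * θ p x (suc k)))
      ≈⟨ solve 2 (λ a b → a :+ (con 1ℤ :+ b) := con 1ℤ :+ (a :+ b)) ≋-refl
           (∑ (suc a) (λ k → gauss p a k * θ p x (suc k))) (∑ a (λ k → p ^ suc k * gauss p a (suc k) * θ p x (suc k))) ⟩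
    1# + (∑ (suc a) (λ k → gauss p a k * θ p x (suc k)) + ∑ a (λ k → p ^ suc k * gauss p a (suc k) * θ p x (suc k)))
      ≈⟨ ≋-sym (gauss-split p a (θ p x)) ⟩
    ∑ (suc (suc a)) (λ k → gauss p (suc a) k * θ p x k) ∎
    where
    s : Series
    s = ∑ (suc a) (λ k → gauss p a k * (p ^ k * θ p x k))
    θ-scale : ∀ k → θ p (x * p) k ≋ p ^ k * θ p x k
    θ-scale zero    = ≋-sym (R.*-identityˡ 1#)
    θ-scale (suc k) = ≋-trans (*-congʳ (x * p * p ^ k) (θ-scale k))
      (solve 4 (λ x p r t → r :* t :* (x :* p :* r) := p :* r :* (t :* (x :* r))) ≋-refl x p (p ^ k) (θ p x k))

  module _ (x y p : Series) (xy≋p : x * y ≋ p) where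

    -- The sequence θ p y b, …, θ p y 1, 1, θ p x 1, θ p x 2, …: the term of index
    -- j ∈ ℤ of the theta series sits at position j + b.
    shifted : ℕ → ℕ → Series
    shifted zero    k       = θ p x k
    shifted (suc b) zero    = θ p y (suc b)
    shifted (suc b) (suc k) = shifted b k

    shifted-zero : ∀ b → shifted b 0 ≡ θ p y b
    shifted-zero zero    = refl
    shifted-zero (suc b) = refl

    -- Since y plays the role of p/x, both branches of `shifted` are t_j = x^j p^(j(j-1)/2) with j =
    -- k - b in ℤ. The ratio of consecutive terms is x p^j, and x p^(k-b) times y p^b is p^(k+1).
    shifted-step : ∀ b k → shifted b (suc k) * (y * p ^ b) ≋ p ^ suc k * shifted b k
    shifted-step zero k = begin
      θ p x k * (x * p ^ k) * (y * 1#)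
        ≈⟨ solve 5 (λ t x p y o → t :* (x :* p) :* (y :* o) := (x :* y) :* p :* (t :* o)) ≋-refl (θ p x k) x (p ^ k) y 1# ⟩
      (x * y) * p ^ k * (θ p x k * 1#)
        ≈⟨ *-cong (*-congʳ (p ^ k) xy≋p) (R.*-identityʳ (θ p x k)) ⟩
      p * p ^ k * θ p x k ∎
    shifted-step (suc b) zero rewrite shifted-zero b =
      solve 4 (λ t y p b → t :* (y :* (p :* b)) := p :* con 1ℤ :* (t :* (y :* b))) ≋-refl (θ p y b) y p (p ^ b)
    shifted-step (suc b) (suc k) = begin
      shifted b (suc k) * (y * (p * p ^ b))
        ≈⟨ solve 4 (λ t y p b → t :* (y :* (p :* b)) := p :* (t :* (y :* b))) ≋-refl (shifted b (suc k)) y p (p ^ b) ⟩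
      p * (shifted b (suc k) * (y * p ^ b))
        ≈⟨ *-congˡ p (shifted-step b k) ⟩
      p * (p ^ suc k * shifted b k)
        ≈⟨ ≋-sym (R.*-assoc p (p ^ suc k) (shifted b k)) ⟩
      p * p ^ suc k * shifted b k ∎

    -- Induction on `b`, starting from the q-binomial theorem. Of the two parts of the new factor 1
    -- + y p^b, the 1 gives the first half of the Pascal recursion. The y p^b moves the terms by one
    -- place through `shifted-step` and gives the second half and the new leading term.
    finite-triple-product : ∀ a b →
      ∏ a (factor p x) * ∏ b (factor p y) ≋ ∑ (suc (b ℕ.+ a)) (λ k → gauss p (b ℕ.+ a) k * shifted b k)
    finite-triple-product a zero    = ≋-trans (R.*-identityʳ (∏ a (factor p x))) (q-binomial p a x)
    finite-triple-product a (suc b) = begin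
      ∏ a (factor p x) * (∏ b (factor p y) * (1# + c))
        ≈⟨ solve 3 (λ u v c → u :* (v :* (con 1ℤ :+ c)) := u :* v :+ c :* (u :* v)) ≋-refl (∏ a (factor p x)) (∏ b (factor p y)) c ⟩
      ∏ a (factor p x) * ∏ b (factor p y) + c * (∏ a (factor p x) * ∏ b (factor p y))
        ≈⟨ +-cong (finite-triple-product a b) (*-congˡ c (≋-trans (finite-triple-product a b) (gauss-first p N (shifted b)))) ⟩
      s + c * (shifted b 0 + ∑ N (λ k → gauss p N (suc k) * shifted b (suc k)))
        ≈⟨ +-congˡ s (≋-trans (R.distribˡ c (shifted b 0) (∑ N (λ k → gauss p N (suc k) * shifted b (suc k))))
             (+-cong first (≋-trans (*-∑ c N (λ k → gauss p N (suc k) * shifted b (suc k))) (∑-cong N step)))) ⟩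
      s + (θ p y (suc b) + r)
        ≈⟨ solve 3 (λ s t r → s :+ (t :+ r) := t :+ (s :+ r)) ≋-refl s (θ p y (suc b)) r ⟩
      θ p y (suc b) + (s + r)
        ≈⟨ ≋-sym (gauss-split p N (shifted (suc b))) ⟩
      ∑ (suc (suc N)) (λ k → gauss p (suc N) k * shifted (suc b) k) ∎
      where
      N = b ℕ.+ a
      c = y * p ^ b
      s = ∑ (suc N) (λ k → gauss p N k * shifted b k)
      r = ∑ N (λ k → p ^ suc k * gauss p N (suc k) * shifted b k)
      first : c * shifted b 0 ≋ θ p y (suc b)
      first rewrite shifted-zero b = R.*-comm c (θ p y b)
      step : ∀ k → c * (gauss p N (suc k) * shifted b (suc k)) ≋ p ^ suc k * gauss p N (suc k) * shifted b k
      step k = begin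
        c * (gauss p N (suc k) * shifted b (suc k))
          ≈⟨ solve 3 (λ c g t → c :* (g :* t) := g :* (t :* c)) ≋-refl c (gauss p N (suc k)) (shifted b (suc k)) ⟩
        gauss p N (suc k) * (shifted b (suc k) * c)
          ≈⟨ *-congˡ (gauss p N (suc k)) (shifted-step b k) ⟩
        gauss p N (suc k) * (p ^ suc k * shifted b k)
          ≈⟨ solve 3 (λ g p t → g :* (p :* t) := p :* g :* t) ≋-refl (gauss p N (suc k)) (p ^ suc k) (shifted b k) ⟩
        p ^ suc k * gauss p N (suc k) * shifted b k ∎

    ∑-shifted : ∀ b n → ∑ (b ℕ.+ n) (shifted b) ≋ ∑ b (θ p y ∘ suc) + ∑ n (θ p x)
    ∑-shifted zero    n = ≋-sym (R.+-identityˡ (∑ n (θ p x)))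
    ∑-shifted (suc b) n = begin
      ∑ (suc (b ℕ.+ n)) (shifted (suc b))
        ≈⟨ ∑-first (b ℕ.+ n) (shifted (suc b)) ⟩
      θ p y (suc b) + ∑ (b ℕ.+ n) (shifted b)
        ≈⟨ +-congˡ (θ p y (suc b)) (∑-shifted b n) ⟩
      θ p y (suc b) + (∑ b (θ p y ∘ suc) + ∑ n (θ p x))
        ≈⟨ solve 3 (λ t u v → t :+ (u :+ v) := u :+ t :+ v) ≋-refl (θ p y (suc b)) (∑ b (θ p y ∘ suc)) (∑ n (θ p x)) ⟩
      ∑ b (θ p y ∘ suc) + θ p y (suc b) + ∑ n (θ p x) ∎

    module _ (x-order : x ≈[ 1 ] 0#) (y-order : y ≈[ 1 ] 0#) where

      p-order : p ≈[ 1 ] 0#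
      p-order = ≈[]-trans (≋⇒≈[] (≋-sym xy≋p)) (order-*ʳ y x-order)

      θ-order : ∀ {z} → z ≈[ 1 ] 0# → ∀ j → θ p z j ≈[ j ] 0#
      θ-order o zero    = mk λ _ ()
      θ-order {z} o (suc j) = subst (λ n → θ p z (suc j) ≈[ n ] 0#) (ℕₚ.+-comm j 1)
        (order-* (θ-order o j) (order-*ʳ (p ^ j) o))

      factor-multipliable : ∀ {z} → z ≈[ 1 ] 0# → Multipliable (factor p z)
      factor-multipliable {z} o i = ≈[]-trans
        (≈[]-+ (≈[]-refl {f = 1#}) (order-* o (order-^ p-order i))) (≋⇒≈[] (R.+-identityʳ 1#))

      euler-multipliable : Multipliable (euler p)
      euler-multipliable i = ≈[]-trans
        (≈[]-+ (≈[]-refl {f = 1#}) (≈[]-neg (order-^ p-order (suc i)))) (mk λ k _ → ℤₚ.+-identityʳ (1# k))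

      shifted-orderˡ : ∀ b k → shifted b k ≈[ b ℕ.∸ k ] 0#
      shifted-orderˡ zero    zero    = mk λ _ ()
      shifted-orderˡ zero    (suc k) = mk λ _ ()
      shifted-orderˡ (suc b) zero    = θ-order y-order (suc b)
      shifted-orderˡ (suc b) (suc k) = shifted-orderˡ b k

      shifted-orderʳ : ∀ b k → shifted b k ≈[ k ℕ.∸ b ] 0#
      shifted-orderʳ zero    k       = θ-order x-order k
      shifted-orderʳ (suc b) zero    = mk λ _ ()
      shifted-orderʳ (suc b) (suc k) = shifted-orderʳ b k

      -- Modulo q^N all three factorials of `gauss-factorial` agree with (p;p)_∞, and one copy of it
      -- cancels.
      gauss-limit : ∀ {N} k m → N ℕ.≤ k → N ℕ.≤ m → gauss p (k ℕ.+ m) k * ∏∞ (euler p) ≈[ N ] 1#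
      gauss-limit {N} k m N≤k N≤m = ≈[]-cancelʳ e (g * e) 1# (∏∞-0 euler-multipliable) (
        g * e * e                                       ≈[]⟨ ≋⇒≈[] (R.*-assoc g e e) ⟩
        g * (e * e)                                     ≈[]⟨ ≈[]-* (≈[]-refl {f = g}) (≈[]-* (lim N≤k) (lim N≤m)) ⟩
        g * (∏ k (euler p) * ∏ m (euler p))             ≈[]⟨ ≋⇒≈[] (gauss-factorial p k m) ⟩
        ∏ (k ℕ.+ m) (euler p)                           ≈[]⟨ ≈[]-sym (lim (ℕₚ.≤-trans N≤k (ℕₚ.m≤m+n k m))) ⟩
        e                                               ≈[]⟨ ≋⇒≈[] (≋-sym (R.*-identityˡ e)) ⟩
        1# * e                                          ∎[])
        where
        g = gauss p (k ℕ.+ m) k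
        e = ∏∞ (euler p)
        lim : ∀ {n} → N ℕ.≤ n → e ≈[ N ] ∏ n (euler p)
        lim = ∏∞-trunc′ euler-multipliable

      negligible : ∀ {N t} g e → t ≈[ N ] 0# → g * t * e ≈[ N ] t
      negligible g e o = ≈[]-trans (order-*ʳ e (order-*ˡ g o)) (≈[]-sym o)

      -- The coefficients of the terms far from the middle do not converge, but
      -- those terms have high order.
      term-limit : ∀ N k → k ℕ.≤ (N ℕ.+ N) ℕ.+ (N ℕ.+ N) →
        gauss p ((N ℕ.+ N) ℕ.+ (N ℕ.+ N)) k * shifted (N ℕ.+ N) k * ∏∞ (euler p) ≈[ N ] shifted (N ℕ.+ N) k
      term-limit N k k≤2M with k ℕ.<? N
      ... | yes k<N = negligible (gauss p ((N ℕ.+ N) ℕ.+ (N ℕ.+ N)) k) (∏∞ (euler p)) (weaken bound (shifted-orderˡ (N ℕ.+ N) k))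
        where
        bound : N ℕ.≤ N ℕ.+ N ℕ.∸ k
        bound = subst (ℕ._≤ N ℕ.+ N ℕ.∸ k) (ℕₚ.m+n∸n≡m N N) (ℕₚ.∸-monoʳ-≤ (N ℕ.+ N) (ℕₚ.<⇒≤ k<N))
      ... | no  k≮N with ((N ℕ.+ N) ℕ.+ (N ℕ.+ N)) ℕ.∸ k ℕ.<? N
      ...   | yes far = negligible (gauss p ((N ℕ.+ N) ℕ.+ (N ℕ.+ N)) k) (∏∞ (euler p)) (weaken bound (shifted-orderʳ (N ℕ.+ N) k))
        where
        bound : N ℕ.≤ k ℕ.∸ (N ℕ.+ N)
        bound = ℕₚ.m+n≤o⇒m≤o∸n N (ℕₚ.+-cancelˡ-≤ N (N ℕ.+ (N ℕ.+ N)) k (subst (ℕ._≤ N ℕ.+ k)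
          (trans (ℕₚ.m∸n+n≡m k≤2M) (ℕₚ.+-assoc N N (N ℕ.+ N))) (ℕₚ.+-monoˡ-≤ k (ℕₚ.<⇒≤ far))))
      ...   | no  near =
        g * t * e    ≈[]⟨ ≋⇒≈[] (solve 3 (λ g t e → g :* t :* e := g :* e :* t) ≋-refl g t e) ⟩
        g * e * t    ≈[]⟨ ≈[]-* (subst (λ n → gauss p n k * e ≈[ N ] 1#) (ℕₚ.m+[n∸m]≡n k≤2M)
                          (gauss-limit k _ (ℕₚ.≮⇒≥ k≮N) (ℕₚ.≮⇒≥ near))) (≈[]-refl {f = t}) ⟩
        1# * t       ≈[]⟨ ≋⇒≈[] (R.*-identityˡ t) ⟩
        t            ∎[]
        where
        M = N ℕ.+ N
        g = gauss p (M ℕ.+ M) k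
        t = shifted M k
        e = ∏∞ (euler p)

      triple-product : ∏∞ (factor p x) * ∏∞ (factor p y) * ∏∞ (euler p) ≋ ∑∞ (θ p y ∘ suc) + ∑∞ (θ p x)
      triple-product = ≈[]⇒≋ truncated
        where
        truncated : ∀ N → ∏∞ (factor p x) * ∏∞ (factor p y) * ∏∞ (euler p) ≈[ N ] ∑∞ (θ p y ∘ suc) + ∑∞ (θ p x)
        truncated N =
          ∏∞ (factor p x) * ∏∞ (factor p y) * e
            ≈[]⟨ ≈[]-* (≈[]-* (∏∞-trunc′ (factor-multipliable x-order) N≤M) (∏∞-trunc′ (factor-multipliable y-order) N≤M)) (≈[]-refl {f = e}) ⟩
          ∏ M (factor p x) * ∏ M (factor p y) * e
            ≈[]⟨ ≋⇒≈[] (*-congʳ e (finite-triple-product M M)) ⟩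
          ∑ (suc (M ℕ.+ M)) (λ k → gauss p (M ℕ.+ M) k * shifted M k) * e
            ≈[]⟨ ≋⇒≈[] (≋-trans (R.*-comm (∑ (suc (M ℕ.+ M)) (λ k → gauss p (M ℕ.+ M) k * shifted M k)) e)
                 (≋-trans (*-∑ e (suc (M ℕ.+ M)) (λ k → gauss p (M ℕ.+ M) k * shifted M k))
                   (∑-cong (suc (M ℕ.+ M)) (λ k → R.*-comm e (gauss p (M ℕ.+ M) k * shifted M k))))) ⟩
          ∑ (suc (M ℕ.+ M)) (λ k → gauss p (M ℕ.+ M) k * shifted M k * e)
            ≈[]⟨ ∑-≈[] (suc (M ℕ.+ M)) (λ k k≤2M → term-limit N k (ℕₚ.≤-pred k≤2M)) ⟩
          ∑ (suc (M ℕ.+ M)) (shifted M)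
            ≈[]⟨ ≋⇒≈[] (subst (λ n → ∑ n (shifted M) ≋ ∑ M (θ p y ∘ suc) + ∑ (suc M) (θ p x)) (ℕₚ.+-suc M M) (∑-shifted M (suc M))) ⟩
          ∑ M (θ p y ∘ suc) + ∑ (suc M) (θ p x)
            ≈[]⟨ ≈[]-sym (≈[]-+ (∑∞-trunc (λ n → weaken (ℕₚ.n≤1+n n) (θ-order y-order (suc n))) N≤M)
                 (∑∞-trunc (θ-order x-order) (ℕₚ.m≤n⇒m≤1+n N≤M))) ⟩
          ∑∞ (θ p y ∘ suc) + ∑∞ (θ p x) ∎[]
          where
          -- With 2N factors on each side, an index closer than N to the middle M is at least N away
          -- from both ends 0 and 2M. So each term either has order at least N or is covered by
          -- `gauss-limit`.
          M = N ℕ.+ N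
          N≤M : N ℕ.≤ M
          N≤M = ℕₚ.m≤m+n N N
          e = ∏∞ (euler p)

-- A product formula for the even part of the generating function.

module EvenPart where

  open PowerSeries
  open Operators
  open Convergence
  open JacobiTripleProduct using (θ)
  open import Algebra.Bundles using (CommutativeRing)
  open import Data.Integer as ℤ using (0ℤ; 1ℤ; +_)
  import Data.Integer.Properties as ℤₚ
  open import Data.Nat as ℕ using (ℕ; zero; suc; s≤s)
  import Data.Nat.Properties as ℕₚ
  import Data.Nat.Tactic.RingSolver as ℕ-Solver
  open import Function using (_∘_)
  open import Relation.Binary.PropositionalEquality
  open PowerSeries.Solver using (solve; _:+_; _:*_; _:=_; _:-_; :-_; con)
  open import Relation.Binary.Reasoning.Setoid seriesSetoid
  private module R = CommutativeRing seriesRing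

  even odd : ℕ → Series
  even n = (q * q) ^ n
  odd  n = q * even n

  q^-even : ∀ n → q ^ (n ℕ.+ n) ≋ even n
  q^-even zero    = ≋-refl
  q^-even (suc n) rewrite ℕₚ.+-suc n n =
    ≋-trans (≋-sym (R.*-assoc q q (q ^ (n ℕ.+ n)))) (*-congˡ (q * q) (q^-even n))

  D-q^ : ∀ n → D (q ^ n) ≋ even n
  D-q^ n = ≋-trans (D-^ q n) (^-cong n D-q)

  D-even : ∀ n → D (even n) ≋ even n * even n
  D-even n = ≋-trans (D-^ (q * q) n) (≋-trans (^-cong n (≋-trans (D-* q q) (*-cong D-q D-q))) (square n))
    where
    square : ∀ n → (q * q * (q * q)) ^ n ≋ even n * even n
    square zero    = ≋-sym (R.*-identityʳ 1#)
    square (suc n) = ≋-trans (*-congˡ (q * q * (q * q)) (square n))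
      (solve 2 (λ q e → q :* q :* (q :* q) :* (e :* e) := q :* q :* e :* (q :* q :* e)) ≋-refl q (even n))

  D-odd : ∀ n → D (odd n) ≋ odd n * odd n
  D-odd n = ≋-trans (D-* q (even n)) (≋-trans (*-cong D-q (D-even n))
    (solve 2 (λ q e → q :* q :* (e :* e) := q :* e :* (q :* e)) ≋-refl q (even n)))

  order-q : q ≈[ 1 ] 0#
  order-q = mk λ where
    zero    _         → refl
    (suc _) (s≤s ())

  order-even : ∀ n → even n ≈[ n ] 0#
  order-even = order-^ (order-*ʳ q order-q)

  order-odd : ∀ n → odd n ≈[ suc n ] 0#
  order-odd n = order-* order-q (order-even n)

  ι : ℕ → Series
  ι m = inv (1# - odd m)

  ι-* : ∀ m → ι m * (1# - odd m) ≋ 1#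
  ι-* m = inv-* refl

  -- With w = q^{2M}, deform M n = ∏_{i<n} (w + q^{2i+1}) q^{2i+1} / (1 − q^{2i+1} w)
  -- interpolates between the summand of v₀ (M = 0) and q^{2n²} (M → ∞).
  deform : ℕ → ℕ → Series
  deform M zero    = 1#
  deform M (suc n) = deform M n * ((even M + odd n) * odd n * ι (M ℕ.+ n))

  deform-order : ∀ M n → deform M n ≈[ n ] 0#
  deform-order M zero    = mk λ _ ()
  deform-order M (suc n) = weaken (ℕₚ.m≤n+m (suc n) n) (order-* (deform-order M n)
    (order-*ʳ (ι (M ℕ.+ n)) (order-*ˡ (even M + odd n) (order-odd n))))

  ι-relation : ∀ M n → ι (M ℕ.+ n) * (1# - odd M * even n) ≋ 1#
  ι-relation M n = ≋-trans (*-congˡ (ι (M ℕ.+ n)) (+-congˡ 1# (-‿cong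
    (≋-trans (R.*-assoc q (even M) (even n)) (*-congˡ q (≋-sym (^-+ (q * q) M n))))))) (ι-* (M ℕ.+ n))

  -- The telescoping remainder. The next terms of `deform M` and of `deform (suc M)` are both
  -- explicit multiples of it, by `deform-suc` and `deform-shift`.
  boundary : ℕ → ℕ → Series
  boundary M n = even n * deform M n * ι (M ℕ.+ n)

  deform-suc : ∀ M n → deform M (suc n) ≋ (odd M + even (suc n)) * boundary M n
  deform-suc M n = solve 5 (λ q w y k i →
    k :* ((w :+ q :* y) :* (q :* y) :* i) := (q :* w :+ q :* q :* y) :* (y :* k :* i))
    ≋-refl q (even M) (even n) (deform M n) (ι (M ℕ.+ n))

  -- Replacing w by q²w moves the product by one index: q²w + q^(2i+1) = q² (w + q^(2i-1)), and the
  -- denominators move likewise. Only the ends differ. With v = q^(2M+1), the numerator at i = 0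
  -- supplies 1 + v and the lost denominator supplies 1 - v.
  deform-shift : ∀ M n → deform (suc M) (suc n) ≋
    even (suc n) * (1# - odd M * odd M) * boundary M n * ι (suc (M ℕ.+ n))
  deform-shift M zero rewrite ℕₚ.+-identityʳ M = begin
    1# * ((q * q * w + q * 1#) * (q * 1#) * ι′)
      ≈⟨ solve 3 (λ q w i → con 1ℤ :* ((q :* q :* w :+ q :* con 1ℤ) :* (q :* con 1ℤ) :* i)
           := q :* q :* (con 1ℤ :+ q :* w) :* i :* con 1ℤ) ≋-refl q w ι′ ⟩
    q * q * (1# + q * w) * ι′ * 1#
      ≈⟨ *-congˡ (q * q * (1# + q * w) * ι′) (≋-sym (ι-* M)) ⟩
    q * q * (1# + q * w) * ι′ * (ι₀ * (1# - q * w))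
      ≈⟨ solve 4 (λ q v i j → q :* q :* (con 1ℤ :+ v) :* i :* (j :* (con 1ℤ :- v))
           := q :* q :* con 1ℤ :* (con 1ℤ :- v :* v) :* (con 1ℤ :* con 1ℤ :* j) :* i) ≋-refl q (q * w) ι′ ι₀ ⟩
    q * q * 1# * (1# - q * w * (q * w)) * (1# * 1# * ι₀) * ι′ ∎
    where
    w  = even M
    ι₀ = ι M
    ι′ = ι (suc M)
  deform-shift M (suc n) = begin
    deform (suc M) (suc n) * ((q * q * w + q * Y) * (q * Y) * i₂)
      ≈⟨ *-cong (deform-shift M n) (*-congʳ i₂ (*-congʳ (q * Y)
           (solve 3 (λ q w Y → q :* q :* w :+ q :* Y := q :* (q :* w :+ Y)) ≋-refl q w Y))) ⟩
    Y * P * boundary M n * i₁ * (q * (v + Y) * (q * Y) * i₂)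
      ≈⟨ solve 7 (λ q Y P x F i j → Y :* P :* x :* i :* (q :* F :* (q :* Y) :* j)
           := q :* q :* Y :* P :* (Y :* (F :* x) :* i) :* j) ≋-refl q Y P (boundary M n) (v + Y) i₁ i₂ ⟩
    q * q * Y * P * (Y * ((v + Y) * boundary M n) * i₁) * i₂
      ≈⟨ *-congʳ i₂ (*-congˡ (q * q * Y * P) (*-cong (*-congˡ Y (≋-sym (deform-suc M n))) i₁≋)) ⟩
    q * q * Y * P * boundary M (suc n) * i₂ ∎
    where
    v  = odd M
    w  = even M
    Y  = even (suc n)
    P  = 1# - v * v
    i₁ = ι (suc (M ℕ.+ n))
    i₂ = ι (suc (M ℕ.+ suc n))
    i₁≋ : i₁ ≋ ι (M ℕ.+ suc n)
    i₁≋ rewrite ℕₚ.+-suc M n = ≋-refl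

  -- From n to n + 1 the left side grows by Y P x (1 + i v (v + Y)), in the notation of the `where`
  -- clause. Writing 1 as i (1 - v Y) cancels the mixed terms and leaves i (1 + v²). The factor 1 +
  -- v² is free of n, so it comes out of the sum.
  telescope : ∀ M n →
    (1# - odd M * odd M) * ∑ (suc n) (deform M) + odd M * (1# - odd M * odd M) * boundary M n
    ≋ (1# + odd M * odd M) * ∑ (suc n) (deform (suc M)) + (odd M - odd M * odd M)
  telescope M zero rewrite ℕₚ.+-identityʳ M = begin
    (1# - v * v) * (0# + 1#) + v * (1# - v * v) * (1# * 1# * ι M)
      ≈⟨ solve 2 (λ v i → (con 1ℤ :- v :* v) :* (con 0ℤ :+ con 1ℤ) :+ v :* (con 1ℤ :- v :* v) :* (con 1ℤ :* con 1ℤ :* i)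
           := (con 1ℤ :- v :* v) :+ v :* (con 1ℤ :+ v) :* (i :* (con 1ℤ :- v))) ≋-refl v (ι M) ⟩
    (1# - v * v) + v * (1# + v) * (ι M * (1# - v))
      ≈⟨ +-congˡ (1# - v * v) (*-congˡ (v * (1# + v)) (ι-* M)) ⟩
    (1# - v * v) + v * (1# + v) * 1#
      ≈⟨ solve 1 (λ v → (con 1ℤ :- v :* v) :+ v :* (con 1ℤ :+ v) :* con 1ℤ
           := (con 1ℤ :+ v :* v) :* (con 0ℤ :+ con 1ℤ) :+ (v :- v :* v)) ≋-refl v ⟩
    (1# + v * v) * (0# + 1#) + (v - v * v) ∎
    where
    v = odd M
  telescope M (suc n) = begin
    P * (s + deform M (suc n)) + v * P * (Y * deform M (suc n) * ι (M ℕ.+ suc n))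
      ≈⟨ +-cong (*-congˡ P (+-congˡ s (deform-suc M n))) (*-congˡ (v * P) (*-cong (*-congˡ Y (deform-suc M n)) i≋)) ⟩
    P * (s + (v + Y) * x) + v * P * (Y * ((v + Y) * x) * i)
      ≈⟨ solve 6 (λ P s v Y x i → P :* (s :+ (v :+ Y) :* x) :+ v :* P :* (Y :* ((v :+ Y) :* x) :* i)
           := (P :* s :+ v :* P :* x) :+ Y :* P :* x :* (con 1ℤ :+ i :* (v :* (v :+ Y)))) ≋-refl P s v Y x i ⟩
    (P * s + v * P * x) + Y * P * x * (1# + i * (v * (v + Y)))
      ≈⟨ +-cong (telescope M n) (*-congˡ (Y * P * x) (+-congʳ (i * (v * (v + Y))) (≋-sym i-relation))) ⟩
    ((1# + v * v) * s′ + (v - v * v)) + Y * P * x * (i * (1# - v * Y) + i * (v * (v + Y)))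
      ≈⟨ solve 6 (λ P s v Y x i → ((con 1ℤ :+ v :* v) :* s :+ (v :- v :* v)) :+ Y :* P :* x :* (i :* (con 1ℤ :- v :* Y) :+ i :* (v :* (v :+ Y)))
           := (con 1ℤ :+ v :* v) :* (s :+ Y :* P :* x :* i) :+ (v :- v :* v)) ≋-refl P s′ v Y x i ⟩
    (1# + v * v) * (s′ + Y * P * x * i) + (v - v * v)
      ≈⟨ +-congʳ (v - v * v) (*-congˡ (1# + v * v) (+-congˡ s′ (≋-sym (deform-shift M n)))) ⟩
    (1# + v * v) * (s′ + deform (suc M) (suc n)) + (v - v * v) ∎
    where
    v  = odd M
    Y  = even (suc n)
    P  = 1# - v * v
    x  = boundary M n
    s  = ∑ (suc n) (deform M)
    s′ = ∑ (suc n) (deform (suc M))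
    i  = ι (suc (M ℕ.+ n))
    i≋ : ι (M ℕ.+ suc n) ≋ i
    i≋ rewrite ℕₚ.+-suc M n = ≋-refl
    i-relation : i * (1# - v * Y) ≋ 1#
    i-relation = ≋-trans (*-congʳ (1# - v * Y) (≋-sym i≋)) (ι-relation M (suc n))

  A : ℕ → Series
  A M = ∑∞ (deform M)

  A-step : ∀ M → (1# - odd M * odd M) * A M ≋ (1# + odd M * odd M) * A (suc M) + (odd M - odd M * odd M)
  A-step M = ≈[]⇒≋ λ N →
    (1# - v * v) * A M
      ≈[]⟨ ≈[]-* (≈[]-refl {f = 1# - v * v}) (∑∞-trunc (deform-order M) (ℕₚ.n≤1+n N)) ⟩
    (1# - v * v) * ∑ (suc N) (deform M)
      ≈[]⟨ ≋⇒≈[] (≋-sym (R.+-identityʳ ((1# - v * v) * ∑ (suc N) (deform M)))) ⟩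
    (1# - v * v) * ∑ (suc N) (deform M) + 0#
      ≈[]⟨ ≈[]-+ (≈[]-refl {f = (1# - v * v) * ∑ (suc N) (deform M)}) (≈[]-sym (order-*ˡ (v * (1# - v * v))
             (order-*ʳ (ι (M ℕ.+ N)) (order-*ʳ (deform M N) (order-even N))))) ⟩
    (1# - v * v) * ∑ (suc N) (deform M) + v * (1# - v * v) * (even N * deform M N * ι (M ℕ.+ N))
      ≈[]⟨ ≋⇒≈[] (telescope M N) ⟩
    (1# + v * v) * ∑ (suc N) (deform (suc M)) + (v - v * v)
      ≈[]⟨ ≈[]-+ (≈[]-* (≈[]-refl {f = 1# + v * v}) (≈[]-sym (∑∞-trunc (deform-order (suc M)) (ℕₚ.n≤1+n N)))) (≈[]-refl {f = v - v * v}) ⟩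
    (1# + v * v) * A (suc M) + (v - v * v) ∎[]
    where
    v = odd M

  -- The constant 1/2 solves the recurrence of `UA-step`, so twice the series minus 1 satisfies the
  -- homogeneous recurrence.
  G : ℕ → Series
  G M = U (A M) + U (A M) - 1#

  -- With v = q^(2M+1), v² is `D v` while v is q · D (q^M). Hence `U` turns v² into v in both
  -- coefficients and drops the lone odd power v.
  UA-step : ∀ M → (1# - odd M) * U (A M) ≋ (1# + odd M) * U (A (suc M)) - odd M
  UA-step M = begin
    (1# - v) * U (A M)
      ≈⟨ ≋-sym (U-D-* (1# - v) (A M)) ⟩
    U (D (1# - v) * A M)
      ≈⟨ U-cong (≋-trans (*-congʳ (A M) D-1-v) (≋-trans (A-step M) (+-cong (*-congʳ (A (suc M)) (≋-sym D-1+v)) rest))) ⟩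
    U (D (1# + v) * A (suc M) + (D (- v) + q * D (q ^ M)))
      ≈⟨ ≋-trans (U-+ (D (1# + v) * A (suc M)) (D (- v) + q * D (q ^ M))) (+-cong (U-D-* (1# + v) (A (suc M))) (U-odd (- v) (q ^ M))) ⟩
    (1# + v) * U (A (suc M)) - v ∎
    where
    v = odd M
    D-v : D (- v) ≋ - (v * v)
    D-v = ≋-trans (D-- v) (-‿cong (D-odd M))
    D-1-v : D (1# - v) ≋ 1# - v * v
    D-1-v = ≋-trans (D-+ 1# (- v)) (+-cong D-1# D-v)
    D-1+v : D (1# + v) ≋ 1# + v * v
    D-1+v = ≋-trans (D-+ 1# v) (+-cong D-1# (D-odd M))
    rest : v - v * v ≋ D (- v) + q * D (q ^ M)
    rest = ≋-trans (R.+-comm v (- (v * v))) (+-cong (≋-sym D-v) (*-congˡ q (≋-sym (D-q^ M))))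

  G-step : ∀ M → (1# - odd M) * G M ≋ (1# + odd M) * G (suc M)
  G-step M = begin
    (1# - v) * (a + a - 1#)
      ≈⟨ solve 2 (λ v a → (con 1ℤ :- v) :* (a :+ a :- con 1ℤ) := (con 1ℤ :- v) :* a :+ (con 1ℤ :- v) :* a :- (con 1ℤ :- v)) ≋-refl v a ⟩
    (1# - v) * a + (1# - v) * a - (1# - v)
      ≈⟨ +-congʳ (- (1# - v)) (+-cong (UA-step M) (UA-step M)) ⟩
    ((1# + v) * b - v) + ((1# + v) * b - v) - (1# - v)
      ≈⟨ solve 2 (λ v b → ((con 1ℤ :+ v) :* b :- v) :+ ((con 1ℤ :+ v) :* b :- v) :- (con 1ℤ :- v) := (con 1ℤ :+ v) :* (b :+ b :- con 1ℤ)) ≋-refl v b ⟩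
    (1# + v) * (b + b - 1#) ∎
    where
    v = odd M
    a = U (A M)
    b = U (A (suc M))

  G-product : ∀ M → ∏ M (λ i → 1# - odd i) * G 0 ≋ ∏ M (λ i → 1# + odd i) * G M
  G-product zero    = ≋-refl
  G-product (suc M) = begin
    a * (1# - odd M) * G 0
      ≈⟨ solve 3 (λ a v g → a :* (con 1ℤ :- v) :* g := (con 1ℤ :- v) :* (a :* g)) ≋-refl a (odd M) (G 0) ⟩
    (1# - odd M) * (a * G 0)
      ≈⟨ *-congˡ (1# - odd M) (G-product M) ⟩
    (1# - odd M) * (b * G M)
      ≈⟨ solve 3 (λ b v g → (con 1ℤ :- v) :* (b :* g) := b :* ((con 1ℤ :- v) :* g)) ≋-refl b (odd M) (G M) ⟩
    b * ((1# - odd M) * G M)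
      ≈⟨ *-congˡ b (G-step M) ⟩
    b * ((1# + odd M) * G (suc M))
      ≈⟨ ≋-sym (R.*-assoc b (1# + odd M) (G (suc M))) ⟩
    b * (1# + odd M) * G (suc M) ∎
    where
    a = ∏ M (λ i → 1# - odd i)
    b = ∏ M (λ i → 1# + odd i)

  squares : ℕ → Series
  squares = θ (q * q) q

  squares-order : ∀ n → squares n ≈[ n ] 0#
  squares-order zero    = mk λ _ ()
  squares-order (suc n) = weaken (ℕₚ.m≤n+m (suc n) n) (order-* (squares-order n) (order-odd n))

  φ : Series
  φ = ∑∞ squares + ∑∞ squares - 1#

  ι-limit : ∀ M n → ι (M ℕ.+ n) ≈[ M ] 1#
  ι-limit M n =
    ι m             ≈[]⟨ ≋⇒≈[] (≋-sym (R.*-identityʳ (ι m))) ⟩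
    ι m * 1#        ≈[]⟨ ≈[]-* (≈[]-refl {f = ι m}) (mk λ k k<M → sym (trans
                          (cong (λ x → 1# k ℤ.- x) (below (weaken (ℕₚ.m≤n⇒m≤1+n (ℕₚ.m≤m+n M n)) (order-odd m)) k k<M))
                          (ℤₚ.+-identityʳ (1# k)))) ⟩
    ι m * (1# - odd m) ≈[]⟨ ≋⇒≈[] (ι-* m) ⟩
    1# ∎[]
    where
    m = M ℕ.+ n

  deform-limit : ∀ M n → deform M n ≈[ M ] D (squares n)
  deform-limit M zero    = ≋⇒≈[] (≋-sym D-1#)
  deform-limit M (suc n) =
    deform M n * ((even M + odd n) * odd n * ι (M ℕ.+ n))
      ≈[]⟨ ≈[]-* (deform-limit M n) (≈[]-* (≈[]-* (≈[]-+ (order-even M) (≈[]-refl {f = odd n})) (≈[]-refl {f = odd n})) (ι-limit M n)) ⟩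
    D (squares n) * ((0# + odd n) * odd n * 1#)
      ≈[]⟨ ≋⇒≈[] (solve 2 (λ s v → s :* ((con 0ℤ :+ v) :* v :* con 1ℤ) := s :* (v :* v)) ≋-refl (D (squares n)) (odd n)) ⟩
    D (squares n) * (odd n * odd n)
      ≈[]⟨ ≋⇒≈[] (≋-sym (≋-trans (D-* (squares n) (odd n)) (*-congˡ (D (squares n)) (D-odd n)))) ⟩
    D (squares n * odd n) ∎[]

  U-≈[] : ∀ {N f g} → f ≈[ N ℕ.+ N ] g → U f ≈[ N ] U g
  U-≈[] {N} {f} {g} p = mk λ k k<N →
    trans (U-at f k) (trans (below p (k ℕ.+ k) (ℕₚ.+-mono-< k<N k<N)) (sym (U-at g k)))

  -- `deform M n` is known to be q^(2n²) only modulo q^M, and `U` halves exponents; hence the index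
  -- 2N for precision N.
  UA-limit : ∀ N → U (A (N ℕ.+ N)) ≈[ N ] ∑∞ squares
  UA-limit N =
    U (A (N ℕ.+ N))               ≈[]⟨ U-≈[] (∑∞-≈[] (deform-limit (N ℕ.+ N))) ⟩
    U (∑∞ (D ∘ squares))          ≈[]⟨ ≋⇒≈[] (U-cong (≋-sym (∑∞-D squares-order))) ⟩
    U (D (∑∞ squares))            ≈[]⟨ ≋⇒≈[] (U-D (∑∞ squares)) ⟩
    ∑∞ squares                    ∎[]

  a b : Series
  a = ∏∞ (λ i → 1# - odd i)
  b = ∏∞ (λ i → 1# + odd i)

  a-multipliable : Multipliable (λ i → 1# - odd i)
  a-multipliable i = mk λ k k≤i → trans (cong (λ x → 1# k ℤ.- x) (below (order-odd i) k k≤i)) (ℤₚ.+-identityʳ (1# k))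

  b-multipliable : Multipliable (λ i → 1# + odd i)
  b-multipliable i = mk λ k k≤i → trans (cong (λ x → 1# k ℤ.+ x) (below (order-odd i) k k≤i)) (ℤₚ.+-identityʳ (1# k))

  even-part-product : a * G 0 ≋ b * φ
  even-part-product = ≈[]⇒≋ λ N →
    a * G 0
      ≈[]⟨ ≈[]-* (∏∞-trunc′ a-multipliable (ℕₚ.m≤m+n N N)) (≈[]-refl {f = G 0}) ⟩
    ∏ (N ℕ.+ N) (λ i → 1# - odd i) * G 0
      ≈[]⟨ ≋⇒≈[] (G-product (N ℕ.+ N)) ⟩
    ∏ (N ℕ.+ N) (λ i → 1# + odd i) * G (N ℕ.+ N)
      ≈[]⟨ ≈[]-* (≈[]-sym (∏∞-trunc′ b-multipliable (ℕₚ.m≤m+n N N))) (≈[]-+ (≈[]-+ (UA-limit N) (UA-limit N)) (≈[]-refl {f = - 1#})) ⟩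
    b * φ ∎[]

  -- For M = 0 the parameter w is 1, and the factors q^(2i+1) multiply to q^(n²) because 1 + 3 + ⋯ +
  -- (2n - 1) = n².
  v₀-term≋deform : ∀ n → v₀-term n ≋ deform 0 n
  v₀-term≋deform n = *-cancelʳ (poch q (q ^ 2) n) (v₀-term n) (deform 0 n) (denominator-unit n)
    (≋-trans (mk (v₀-term-correct n)) (≋-sym (numerator n)))
    where
    q²≋ : ∀ n → (q ^ 2) ^ n ≋ even n
    q²≋ n = ^-cong n (*-congˡ q (R.*-identityʳ q))
    square : ∀ n → suc n ℕ.* suc n ≡ n ℕ.* n ℕ.+ suc (n ℕ.+ n)
    square = ℕ-Solver.solve-∀
    numerator : ∀ n → deform 0 n * poch q (q ^ 2) n ≋ q ^ (n ℕ.* n) * poch (- q) (q ^ 2) n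
    numerator zero    = ≋-refl
    numerator (suc n) = begin
      k * ((1# + v) * v * ι n) * (d * (1# - q * (q ^ 2) ^ n))
        ≈⟨ *-congˡ (k * ((1# + v) * v * ι n)) (*-congˡ d (+-congˡ 1# (-‿cong (*-congˡ q (q²≋ n))))) ⟩
      k * ((1# + v) * v * ι n) * (d * (1# - v))
        ≈⟨ solve 4 (λ k v i d → k :* ((con 1ℤ :+ v) :* v :* i) :* (d :* (con 1ℤ :- v)) := (k :* d) :* (con 1ℤ :+ v) :* v :* (i :* (con 1ℤ :- v)))
             ≋-refl k v (ι n) d ⟩
      (k * d) * (1# + v) * v * (ι n * (1# - v))
        ≈⟨ *-cong (*-congʳ v (*-congʳ (1# + v) (numerator n))) (ι-* n) ⟩
      (q ^ (n ℕ.* n) * c) * (1# + v) * v * 1#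
        ≈⟨ solve 4 (λ s c q e → (s :* c) :* (con 1ℤ :+ q :* e) :* (q :* e) :* con 1ℤ := s :* (q :* e) :* (c :* (con 1ℤ :- (:- q) :* e)))
             ≋-refl (q ^ (n ℕ.* n)) c q (even n) ⟩
      q ^ (n ℕ.* n) * v * (c * (1# - (- q) * even n))
        ≈⟨ *-cong (≋-trans (*-congˡ (q ^ (n ℕ.* n)) (*-congˡ q (≋-sym (q^-even n)))) (≋-sym (^-+ q (n ℕ.* n) (suc (n ℕ.+ n)))))
             (*-congˡ c (+-congˡ 1# (-‿cong (*-congˡ (- q) (≋-sym (q²≋ n)))))) ⟩
      q ^ (n ℕ.* n ℕ.+ suc (n ℕ.+ n)) * (c * (1# - (- q) * (q ^ 2) ^ n))
        ≡⟨ cong (λ m → q ^ m * (c * (1# - (- q) * (q ^ 2) ^ n))) (sym (square n)) ⟩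
      q ^ (suc n ℕ.* suc n) * (c * (1# - (- q) * (q ^ 2) ^ n)) ∎
      where
      k = deform 0 n
      v = odd n
      d = poch q (q ^ 2) n
      c = poch (- q) (q ^ 2) n

  v₀≋A : v₀ ≋ A 0
  v₀≋A = ∑∞-cong v₀-term≋deform

-- Product forms of φ and ψ and the quadratic identities between them.

module ThetaProducts where

  open PowerSeries
  open Operators
  open Convergence
  open JacobiTripleProduct
  open EvenPart
  open import Algebra.Bundles using (CommutativeRing)
  open import Data.Integer as ℤ using (1ℤ; +_)
  import Data.Integer.Properties as ℤₚ
  open import Data.Nat as ℕ using (ℕ; zero; suc; z≤n)
  import Data.Nat.Properties as ℕₚ
  import Data.Nat.Tactic.RingSolver as ℕ-Solver
  open import Function using (_∘_)
  open import Relation.Binary.PropositionalEquality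
  open PowerSeries.Solver using (solve; _:+_; _:*_; _:=_; _:-_; :-_; con)
  open import Relation.Binary.Reasoning.Setoid seriesSetoid
  private module R = CommutativeRing seriesRing

  E : Series
  E = ∏∞ (euler q)

  q^-double : ∀ n → D (q ^ n) ≋ q ^ (n ℕ.+ n)
  q^-double n = ≋-trans (D-q^ n) (≋-sym (q^-even n))

  ^-^ : ∀ p m n → p ^ (n ℕ.* m) ≋ (p ^ m) ^ n
  ^-^ p m zero    = ≋-refl
  ^-^ p m (suc n) = ≋-trans (^-+ p m (n ℕ.* m)) (*-congˡ (p ^ m) (^-^ p m n))

  euler-order : Multipliable (euler q)
  euler-order i = mk λ k k≤i → trans (cong (λ x → 1# k ℤ.- x) (below (order-q^ (suc i)) k k≤i)) (ℤₚ.+-identityʳ (1# k))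

  D-1- : ∀ {f g} → D f ≋ g → D (1# - f) ≋ 1# - g
  D-1- {f} p = ≋-trans (D-+ 1# (- f)) (+-cong D-1# (≋-trans (D-- f) (-‿cong p)))

  D-multipliable : ∀ {F} → Multipliable F → Multipliable (D ∘ F)
  D-multipliable m i = ≈[]-trans (D-≈[] (m i)) (≋⇒≈[] D-1#)

  D-E : D E ≋ ∏∞ (euler (q * q))
  D-E = ≋-trans (∏∞-D euler-order) (∏∞-cong (λ i → D-1- (D-q^ (suc i))))

  DD-E : D (D E) ≋ ∏∞ (euler (q * q * (q * q)))
  DD-E = ≋-trans (D-cong (∏∞-D euler-order)) (≋-trans (∏∞-D (D-multipliable euler-order)) (∏∞-cong (λ i →
    ≋-trans (D-cong (D-1- (D-q^ (suc i)))) (D-1- (≋-trans (D-^ (q * q) (suc i)) (^-cong (suc i) (≋-trans (D-* q q) (*-cong D-q D-q))))))))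

  E-split : E ≋ a * D E
  E-split = begin
    E
      ≈⟨ ∏∞-blocks 2 euler-order ⟩
    ∏∞ (λ i → ∏ 2 (λ j → euler q (j ℕ.+ i ℕ.* 2)))
      ≈⟨ ∏∞-cong (λ i → *-cong (≋-trans (R.*-identityˡ (euler q (i ℕ.* 2)))
           (+-congˡ 1# (-‿cong (*-congˡ q (q^-2 i))))) (≋-sym (D-1- (≋-trans (D-q^ (suc i)) (≋-trans (*-congˡ (q * q) (≋-sym (q^-2 i)))
             (R.*-assoc q q (q ^ (i ℕ.* 2)))))))) ⟩
    ∏∞ (λ i → (1# - odd i) * D (euler q i))
      ≈⟨ ≋-trans (∏∞-* a-multipliable (D-multipliable euler-order)) (*-congˡ a (≋-sym (∏∞-D euler-order))) ⟩
    a * D E ∎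
    where
    q^-2 : ∀ i → q ^ (i ℕ.* 2) ≋ even i
    q^-2 i = ≋-trans (^-^ q 2 i) (^-cong i (*-congˡ q (R.*-identityʳ q)))

  a*b : a * b ≋ D a
  a*b = ≋-trans (≋-sym (∏∞-* a-multipliable b-multipliable)) (≋-trans
    (∏∞-cong (λ i → ≋-trans (solve 1 (λ v → (con 1ℤ :- v) :* (con 1ℤ :+ v) := con 1ℤ :- v :* v) ≋-refl (odd i)) (≋-sym (D-1- (D-odd i)))))
    (≋-sym (∏∞-D a-multipliable)))

  -- The triple product at x = y = q, p = q². The 1 subtracted in `φ` compensates for counting n = 0
  -- in both sums.
  φ-product : φ ≋ b * b * D E
  φ-product = ≋-sym (begin
    b * b * D E
      ≈⟨ *-congˡ (b * b) D-E ⟩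
    b * b * ∏∞ (euler (q * q))
      ≈⟨ triple-product q q (q * q) ≋-refl order-q order-q ⟩
    s + ∑∞ squares
      ≈⟨ solve 2 (λ s t → s :+ t := (con 1ℤ :+ s) :+ t :- con 1ℤ) ≋-refl s (∑∞ squares) ⟩
    (1# + s) + ∑∞ squares - 1#
      ≈⟨ +-congʳ (- 1#) (+-congʳ (∑∞ squares) (≋-sym (∑∞-first squares-order))) ⟩
    ∑∞ squares + ∑∞ squares - 1# ∎)
    where
    s = ∑∞ (squares ∘ suc)

  φ⁻ : Series
  φ⁻ = σ φ

  σ-b : σ b ≋ a
  σ-b = ≋-trans (∏∞-σ b-multipliable) (∏∞-cong λ i → ≋-trans (σ-+ 1# (odd i)) (+-cong
    (≋-trans (σ-cong 1#≋const) (≋-trans (σ-const 1ℤ) (≋-sym 1#≋const))) (σ-odd i)))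
    where
    σ-odd : ∀ i → σ (odd i) ≋ - odd i
    σ-odd i = begin
      σ (q * even i)      ≈⟨ σ-* q (even i) ⟩
      σ q * σ (even i)    ≈⟨ *-cong σ-q (≋-trans (σ-cong (≋-sym (D-q^ i))) (≋-trans (σ-D (q ^ i)) (D-q^ i))) ⟩
      - q * even i        ≈⟨ solve 2 (λ q e → :- q :* e := :- (q :* e)) ≋-refl q (even i) ⟩
      - odd i             ∎

  φ⁻-product : φ⁻ ≋ a * a * D E
  φ⁻-product = ≋-trans (σ-cong φ-product) (≋-trans (σ-* (b * b) (D E))
    (*-cong (≋-trans (σ-* b b) (*-cong σ-b σ-b)) (σ-D E)))

  T : ℕ → ℕ
  T zero    = 0
  T (suc i) = suc i ℕ.+ T i

  ψ : Series
  ψ = ∑∞ (λ i → q ^ T i)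

  n≤T : ∀ n → n ℕ.≤ T n
  n≤T zero    = z≤n
  n≤T (suc n) = ℕₚ.m≤m+n (suc n) (T n)

  ψ-summable : Summable (λ i → q ^ T i)
  ψ-summable i = weaken (n≤T i) (order-q^ (T i))

  b-split : b ≋ ∏∞ (factor (q * q * (q * q)) q) * ∏∞ (factor (q * q * (q * q)) (q * (q * q)))
  b-split = begin
    b
      ≈⟨ ∏∞-blocks 2 b-multipliable ⟩
    ∏∞ (λ i → ∏ 2 (λ j → 1# + odd (j ℕ.+ i ℕ.* 2)))
      ≈⟨ ∏∞-cong (λ i → *-cong (≋-trans (R.*-identityˡ (1# + odd (i ℕ.* 2))) (+-congˡ 1# (*-congˡ q (even-2 i))))
           (+-congˡ 1# (≋-trans (*-congˡ q (*-congˡ (q * q) (even-2 i))) (≋-sym (R.*-assoc q (q * q) (p ^ i)))))) ⟩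
    ∏∞ (λ i → factor p q i * factor p (q * (q * q)) i)
      ≈⟨ ∏∞-* (factor-multipliable q (q * (q * q)) p xy order-q (order-*ʳ (q * q) order-q) order-q)
              (factor-multipliable q (q * (q * q)) p xy order-q (order-*ʳ (q * q) order-q) (order-*ʳ (q * q) order-q)) ⟩
    ∏∞ (factor p q) * ∏∞ (factor p (q * (q * q))) ∎
    where
    p = q * q * (q * q)
    xy : q * (q * (q * q)) ≋ p
    xy = ≋-sym (R.*-assoc q q (q * q))
    even-2 : ∀ i → even (i ℕ.* 2) ≋ p ^ i
    even-2 i = ≋-trans (^-^ (q * q) 2 i) (^-cong i (*-congˡ (q * q) (R.*-identityʳ (q * q))))

  -- The triple product at x = q, y = q³, p = q⁴. The y side has exponents 2i² + i = T(2i) and the x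
  -- side 2i² - i = T(2i - 1), so every triangular number is met once.
  ψ-product : ψ ≋ b * D (D E)
  ψ-product = ≋-sym (begin
    b * D (D E)
      ≈⟨ *-cong b-split DD-E ⟩
    ∏∞ (factor p q) * ∏∞ (factor p y) * ∏∞ (euler p)
      ≈⟨ triple-product q y p xy order-q y-order ⟩
    ∑∞ (θ p y ∘ suc) + ∑∞ (θ p q)
      ≈⟨ +-congˡ (∑∞ (θ p y ∘ suc)) (∑∞-first (θ-order q y p xy order-q y-order order-q)) ⟩
    ∑∞ (θ p y ∘ suc) + (1# + ∑∞ (θ p q ∘ suc))
      ≈⟨ solve 3 (λ u o v → u :+ (o :+ v) := (o :+ u) :+ v) ≋-refl (∑∞ (θ p y ∘ suc)) 1# (∑∞ (θ p q ∘ suc)) ⟩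
    1# + ∑∞ (θ p y ∘ suc) + ∑∞ (θ p q ∘ suc)
      ≈⟨ +-congʳ (∑∞ (θ p q ∘ suc)) (≋-sym (∑∞-first (θ-order q y p xy order-q y-order y-order))) ⟩
    ∑∞ (θ p y) + ∑∞ (θ p q ∘ suc)
      ≈⟨ +-cong (∑∞-cong θ-even) (∑∞-cong θ-odd) ⟩
    ∑∞ (λ i → q ^ T (i ℕ.+ i)) + ∑∞ (λ i → q ^ T (suc (i ℕ.+ i)))
      ≈⟨ ≋-sym (∑∞-double ψ-summable) ⟩
    ψ ∎)
    where
    p = q * q * (q * q)
    y = q * (q * q)
    xy : q * y ≋ p
    xy = ≋-sym (R.*-assoc q q (q * q))
    y-order = order-*ʳ {1} (q * q) order-q
    p^ : ∀ i → p ^ i ≋ q ^ (i ℕ.* 4)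
    p^ i = ≋-trans (^-cong i (solve 1 (λ q → q :* q :* (q :* q) := q :* (q :* (q :* (q :* con 1ℤ)))) ≋-refl q)) (≋-sym (^-^ q 4 i))
    T-even : ∀ i → T (suc i ℕ.+ suc i) ≡ T (i ℕ.+ i) ℕ.+ (3 ℕ.+ i ℕ.* 4)
    T-even i rewrite ℕₚ.+-suc i i = rearrange i (T (i ℕ.+ i))
      where
      rearrange : ∀ i t → suc (suc (i ℕ.+ i)) ℕ.+ (suc (i ℕ.+ i) ℕ.+ t) ≡ t ℕ.+ (3 ℕ.+ i ℕ.* 4)
      rearrange = ℕ-Solver.solve-∀
    T-odd : ∀ i → T (suc (suc i ℕ.+ suc i)) ≡ T (suc (i ℕ.+ i)) ℕ.+ (1 ℕ.+ suc i ℕ.* 4)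
    T-odd i rewrite ℕₚ.+-suc i i = rearrange i (T (i ℕ.+ i))
      where
      rearrange : ∀ i t → suc (suc (suc (i ℕ.+ i))) ℕ.+ (suc (suc (i ℕ.+ i)) ℕ.+ (suc (i ℕ.+ i) ℕ.+ t))
                ≡ suc (i ℕ.+ i) ℕ.+ t ℕ.+ (1 ℕ.+ suc i ℕ.* 4)
      rearrange = ℕ-Solver.solve-∀
    θ-even : ∀ i → θ p y i ≋ q ^ T (i ℕ.+ i)
    θ-even zero    = ≋-refl
    θ-even (suc i) = begin
      θ p y i * (y * p ^ i)
        ≈⟨ *-cong (θ-even i) (≋-trans (*-congˡ y (p^ i)) (solve 2 (λ q e → q :* (q :* q) :* e := q :* (q :* (q :* e))) ≋-refl q (q ^ (i ℕ.* 4)))) ⟩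
      q ^ T (i ℕ.+ i) * q ^ (3 ℕ.+ i ℕ.* 4)
        ≈⟨ ≋-sym (^-+ q (T (i ℕ.+ i)) (3 ℕ.+ i ℕ.* 4)) ⟩
      q ^ (T (i ℕ.+ i) ℕ.+ (3 ℕ.+ i ℕ.* 4))
        ≡⟨ cong (λ n → q ^ n) (sym (T-even i)) ⟩
      q ^ T (suc i ℕ.+ suc i) ∎
    θ-odd : ∀ i → θ p q (suc i) ≋ q ^ T (suc (i ℕ.+ i))
    θ-odd zero    = R.*-identityˡ (q * 1#)
    θ-odd (suc i) = begin
      θ p q (suc i) * (q * p ^ suc i)
        ≈⟨ *-cong (θ-odd i) (*-congˡ q (p^ (suc i))) ⟩
      q ^ T (suc (i ℕ.+ i)) * q ^ (1 ℕ.+ suc i ℕ.* 4)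
        ≈⟨ ≋-sym (^-+ q (T (suc (i ℕ.+ i))) (1 ℕ.+ suc i ℕ.* 4)) ⟩
      q ^ (T (suc (i ℕ.+ i)) ℕ.+ (1 ℕ.+ suc i ℕ.* 4))
        ≡⟨ cong (λ n → q ^ n) (sym (T-odd i)) ⟩
      q ^ T (suc (suc i ℕ.+ suc i)) ∎

  squares≋q^ : ∀ n → squares n ≋ q ^ (n ℕ.* n)
  squares≋q^ zero    = ≋-refl
  squares≋q^ (suc n) = begin
    squares n * odd n
      ≈⟨ *-cong (squares≋q^ n) (*-congˡ q (≋-sym (q^-even n))) ⟩
    q ^ (n ℕ.* n) * q ^ (suc (n ℕ.+ n))
      ≈⟨ ≋-sym (^-+ q (n ℕ.* n) (suc (n ℕ.+ n))) ⟩
    q ^ (n ℕ.* n ℕ.+ suc (n ℕ.+ n))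
      ≡⟨ cong (λ m → q ^ m) (square n) ⟩
    q ^ (suc n ℕ.* suc n) ∎
    where
    square : ∀ n → n ℕ.* n ℕ.+ suc (n ℕ.+ n) ≡ suc n ℕ.* suc n
    square = ℕ-Solver.solve-∀

  -- By parity of the root: (2i)² = 4i² and (2i + 1)² = 1 + 8 T(i).
  ∑squares-dissection : ∑∞ squares ≋ D (D (∑∞ squares)) + q * D (D (D ψ))
  ∑squares-dissection = begin
    ∑∞ squares
      ≈⟨ ∑∞-double squares-order ⟩
    ∑∞ (λ i → squares (i ℕ.+ i)) + ∑∞ (λ i → squares (suc (i ℕ.+ i)))
      ≈⟨ +-cong (∑∞-cong even-term) (∑∞-cong odd-term) ⟩
    ∑∞ (D ∘ D ∘ squares) + ∑∞ (λ i → q * D (D (D (q ^ T i))))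
      ≈⟨ +-cong (≋-sym (≋-trans (D-cong (∑∞-D squares-order)) (∑∞-D (D-summable squares-order))))
           (≋-sym (≋-trans (*-congˡ q (≋-trans (D-cong (D-cong (∑∞-D ψ-summable))) (≋-trans (D-cong (∑∞-D (D-summable ψ-summable)))
             (∑∞-D (D-summable (D-summable ψ-summable)))))) (*-∑∞ q (D-summable (D-summable (D-summable ψ-summable)))))) ⟩
    D (D (∑∞ squares)) + q * D (D (D ψ)) ∎
    where
    D-summable : ∀ {F} → Summable F → Summable (D ∘ F)
    D-summable s n = ≈[]-trans (D-≈[] (s n)) (≋⇒≈[] (∑-D 0 (λ _ → 0#)))
    even-term : ∀ i → squares (i ℕ.+ i) ≋ D (D (squares i))
    even-term i = begin
      squares (i ℕ.+ i)             ≈⟨ squares≋q^ (i ℕ.+ i) ⟩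
      q ^ ((i ℕ.+ i) ℕ.* (i ℕ.+ i)) ≡⟨ cong (λ m → q ^ m) (rearrange i) ⟩
      q ^ ((i ℕ.* i ℕ.+ i ℕ.* i) ℕ.+ (i ℕ.* i ℕ.+ i ℕ.* i))
        ≈⟨ ≋-sym (≋-trans (D-cong (≋-trans (D-cong (squares≋q^ i)) (q^-double (i ℕ.* i)))) (q^-double (i ℕ.* i ℕ.+ i ℕ.* i))) ⟩
      D (D (squares i)) ∎
      where
      rearrange : ∀ i → (i ℕ.+ i) ℕ.* (i ℕ.+ i) ≡ (i ℕ.* i ℕ.+ i ℕ.* i) ℕ.+ (i ℕ.* i ℕ.+ i ℕ.* i)
      rearrange = ℕ-Solver.solve-∀
    T-double : ∀ i → T i ℕ.+ T i ≡ i ℕ.* suc i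
    T-double zero    = refl
    T-double (suc i) = trans (rearrange (suc i) (T i)) (trans (cong (λ t → suc i ℕ.+ suc i ℕ.+ t) (T-double i)) (expand i))
      where
      rearrange : ∀ m t → m ℕ.+ t ℕ.+ (m ℕ.+ t) ≡ m ℕ.+ m ℕ.+ (t ℕ.+ t)
      rearrange = ℕ-Solver.solve-∀
      expand : ∀ i → suc i ℕ.+ suc i ℕ.+ i ℕ.* suc i ≡ suc i ℕ.* suc (suc i)
      expand = ℕ-Solver.solve-∀
    odd-term : ∀ i → squares (suc (i ℕ.+ i)) ≋ q * D (D (D (q ^ T i)))
    odd-term i = begin
      squares (suc (i ℕ.+ i))             ≈⟨ squares≋q^ (suc (i ℕ.+ i)) ⟩
      q ^ (suc (i ℕ.+ i) ℕ.* suc (i ℕ.+ i)) ≡⟨ cong (λ m → q ^ m) (rearrange i) ⟩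
      q * q ^ ((t ℕ.+ t) ℕ.+ (t ℕ.+ t))   ≡⟨ cong (λ t → q * q ^ ((t ℕ.+ t) ℕ.+ (t ℕ.+ t))) (sym (T-double i)) ⟩
      q * q ^ ((u ℕ.+ u) ℕ.+ (u ℕ.+ u))
        ≈⟨ *-congˡ q (≋-sym (≋-trans (D-cong (≋-trans (D-cong (q^-double (T i))) (q^-double u))) (q^-double (u ℕ.+ u)))) ⟩
      q * D (D (D (q ^ T i))) ∎
      where
      t = i ℕ.* suc i
      u = T i ℕ.+ T i
      rearrange : ∀ i → suc (i ℕ.+ i) ℕ.* suc (i ℕ.+ i) ≡ suc ((i ℕ.* suc i ℕ.+ i ℕ.* suc i) ℕ.+ (i ℕ.* suc i ℕ.+ i ℕ.* suc i))
      rearrange = ℕ-Solver.solve-∀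

  φ-dissection : φ ≋ D (D φ) + const (+ 2) * (q * D (D (D ψ)))
  φ-dissection = begin
    ∑∞ squares + ∑∞ squares - 1#
      ≈⟨ +-congʳ (- 1#) (+-cong ∑squares-dissection ∑squares-dissection) ⟩
    (s + r) + (s + r) - 1#
      ≈⟨ solve 2 (λ s r → (s :+ r) :+ (s :+ r) :- con 1ℤ := (s :+ s :- con 1ℤ) :+ con (+ 2) :* r) ≋-refl s r ⟩
    (s + s - 1#) + const (+ 2) * r
      ≈⟨ +-congʳ (const (+ 2) * r) (≋-sym (≋-trans (D-cong (D-lin (∑∞ squares))) (D-lin (D (∑∞ squares))))) ⟩
    D (D φ) + const (+ 2) * r ∎
    where
    s = D (D (∑∞ squares))
    r = q * D (D (D ψ))
    D-lin : ∀ f → D (f + f - 1#) ≋ D f + D f - 1#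
    D-lin f = ≋-trans (D-+ (f + f) (- 1#)) (+-cong (D-+ f f) (≋-trans (D-- 1#) (-‿cong D-1#)))

  -- Gauss's quotient for ψ without division. It later lets powers of `a` absorb powers of ψ.
  DE≋aψ : D E ≋ a * ψ
  DE≋aψ = begin
    D E                  ≈⟨ ≋-trans (D-cong E-split) (D-* a (D E)) ⟩
    D a * D (D E)        ≈⟨ *-congʳ (D (D E)) (≋-sym a*b) ⟩
    a * b * D (D E)      ≈⟨ R.*-assoc a b (D (D E)) ⟩
    a * (b * D (D E))    ≈⟨ *-congˡ a (≋-sym ψ-product) ⟩
    a * ψ                ∎

  Dφ⁻-product : D φ⁻ ≋ D a * D E
  Dφ⁻-product = begin
    D φ⁻                       ≈⟨ ≋-trans (D-cong φ⁻-product) (≋-trans (D-* (a * a) (D E)) (*-congʳ (D (D E)) (D-* a a))) ⟩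
    D a * D a * D (D E)        ≈⟨ R.*-assoc (D a) (D a) (D (D E)) ⟩
    D a * (D a * D (D E))      ≈⟨ *-congˡ (D a) (≋-sym (≋-trans (D-cong E-split) (D-* a (D E)))) ⟩
    D a * D E                  ∎

  φ*φ⁻ : φ * φ⁻ ≋ D φ⁻ * D φ⁻
  φ*φ⁻ = begin
    φ * φ⁻
      ≈⟨ *-cong φ-product φ⁻-product ⟩
    b * b * D E * (a * a * D E)
      ≈⟨ solve 3 (λ a b e → b :* b :* e :* (a :* a :* e) := a :* b :* e :* (a :* b :* e)) ≋-refl a b (D E) ⟩
    a * b * D E * (a * b * D E)
      ≈⟨ *-cong (≋-trans (*-congʳ (D E) a*b) (≋-sym Dφ⁻-product)) (≋-trans (*-congʳ (D E) a*b) (≋-sym Dφ⁻-product)) ⟩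
    D φ⁻ * D φ⁻ ∎

  ψ² : ψ * ψ ≋ φ * D ψ
  ψ² = ≋-sym (begin
    φ * D ψ
      ≈⟨ *-cong φ-product (≋-trans (D-cong ψ-product) (D-* b (D (D E)))) ⟩
    b * b * D E * (D b * D (D (D E)))
      ≈⟨ *-congʳ (D b * D (D (D E))) (*-congˡ (b * b) (≋-trans (D-cong E-split) (D-* a (D E)))) ⟩
    b * b * (D a * e) * (D b * D e)
      ≈⟨ solve 5 (λ b a e c f → b :* b :* (a :* e) :* (c :* f) := b :* e :* b :* ((a :* c) :* f)) ≋-refl b (D a) e (D b) (D e) ⟩
    b * e * b * ((D a * D b) * D e)
      ≈⟨ *-congˡ (b * e * b) (*-congʳ (D e) (≋-trans (≋-sym (D-* a b)) (D-cong a*b))) ⟩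
    b * e * b * (D (D a) * D e)
      ≈⟨ *-congˡ (b * e * b) (≋-sym (≋-trans (D-cong (≋-trans (D-cong E-split) (D-* a (D E)))) (D-* (D a) e))) ⟩
    b * e * b * e
      ≈⟨ R.*-assoc (b * e) b e ⟩
    b * e * (b * e)
      ≈⟨ ≋-sym (*-cong ψ-product ψ-product) ⟩
    ψ * ψ ∎)
    where
    e = D (D E)

  G*Dφ⁻ : G 0 * D φ⁻ ≋ φ * φ
  G*Dφ⁻ = begin
    G 0 * D φ⁻
      ≈⟨ *-congˡ (G 0) (≋-trans Dφ⁻-product (*-congʳ (D E) (≋-sym a*b))) ⟩
    G 0 * (a * b * D E)
      ≈⟨ solve 4 (λ g a b e → g :* (a :* b :* e) := (a :* g) :* (b :* e)) ≋-refl (G 0) a b (D E) ⟩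
    (a * G 0) * (b * D E)
      ≈⟨ *-congʳ (b * D E) even-part-product ⟩
    b * φ * (b * D E)
      ≈⟨ solve 3 (λ b f e → b :* f :* (b :* e) := f :* (b :* b :* e)) ≋-refl b φ (D E) ⟩
    φ * (b * b * D E)
      ≈⟨ *-congˡ φ (≋-sym φ-product) ⟩
    φ * φ ∎

  φ⁻-dissection : φ⁻ ≋ D (D φ) - const (+ 2) * (q * D (D (D ψ)))
  φ⁻-dissection = begin
    σ φ
      ≈⟨ ≋-trans (σ-cong φ-dissection) (σ-+ (D (D φ)) (const (+ 2) * (q * r))) ⟩
    σ (D (D φ)) + σ (const (+ 2) * (q * r))
      ≈⟨ +-cong (σ-D (D φ)) (≋-trans (σ-* (const (+ 2)) (q * r)) (*-cong (σ-const (+ 2)) (≋-trans (σ-* q r) (*-cong σ-q (σ-D (D (D ψ))))))) ⟩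
    D (D φ) + const (+ 2) * (- q * r)
      ≈⟨ +-congˡ (D (D φ)) (solve 2 (λ q r → con (+ 2) :* (:- q :* r) := :- (con (+ 2) :* (q :* r))) ≋-refl q r) ⟩
    D (D φ) - const (+ 2) * (q * r) ∎
    where
    r = D (D (D ψ))

  D-product-of-const : ∀ c f → D (const c * f) ≋ const c * D f
  D-product-of-const c f = ≋-trans (D-* (const c) f) (*-congʳ (D f) (D-const c))

  -- `D` is injective, so q may be replaced by q². Then the left side becomes φ φ⁻, and the
  -- dissections of φ and φ⁻ differ only in one sign, which makes their product a difference of
  -- squares.
  φ⁻² : φ⁻ * φ⁻ ≋ D φ * D φ - const (+ 4) * (q * (D (D ψ) * D (D ψ)))
  φ⁻² = D-injective (begin
    D (φ⁻ * φ⁻)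
      ≈⟨ ≋-trans (D-* φ⁻ φ⁻) (≋-sym φ*φ⁻) ⟩
    φ * φ⁻
      ≈⟨ *-cong φ-dissection φ⁻-dissection ⟩
    (s + const (+ 2) * (q * r)) * (s - const (+ 2) * (q * r))
      ≈⟨ solve 3 (λ s q r → (s :+ con (+ 2) :* (q :* r)) :* (s :- con (+ 2) :* (q :* r)) := s :* s :- con (+ 4) :* (q :* q :* (r :* r))) ≋-refl s q r ⟩
    s * s - const (+ 4) * (q * q * (r * r))
      ≈⟨ ≋-sym (≋-trans (D-+ (D φ * D φ) (- t)) (+-cong (D-* (D φ) (D φ)) (≋-trans (D-- t) (-‿cong D-t)))) ⟩
    D (D φ * D φ - t) ∎)
    where
    s = D (D φ)
    r = D (D (D ψ))
    t = const (+ 4) * (q * (D (D ψ) * D (D ψ)))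
    D-t : D t ≋ const (+ 4) * (q * q * (r * r))
    D-t = ≋-trans (D-product-of-const (+ 4) (q * (D (D ψ) * D (D ψ)))) (*-congˡ (const (+ 4))
      (≋-trans (D-* q (D (D ψ) * D (D ψ))) (*-cong D-q (D-* (D (D ψ)) (D (D ψ))))))

  σ-involutive : ∀ f → σ (σ f) ≋ f
  σ-involutive f = mk λ k → go k f
    where
    σ-neg : ∀ k f → σ (- f) k ≡ ℤ.- σ f k
    σ-neg zero    f = refl
    σ-neg (suc k) f = cong (λ x → ℤ.- x) (σ-neg k (tail f))
    go : ∀ k f → σ (σ f) k ≡ f k
    go zero    f = refl
    go (suc k) f = trans (cong (λ x → ℤ.- x) (σ-neg k (σ (tail f)))) (trans (ℤₚ.neg-involutive _) (go k (tail f)))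

  -- The substitution q → -q in `φ⁻²`. The right side is first brought to the form D f + q · D g,
  -- where `σ` just negates the second term.
  φ² : φ * φ ≋ D φ * D φ + const (+ 4) * (q * (D (D ψ) * D (D ψ)))
  φ² = begin
    φ * φ
      ≈⟨ ≋-sym (≋-trans (σ-* φ⁻ φ⁻) (*-cong (σ-involutive φ) (σ-involutive φ))) ⟩
    σ (φ⁻ * φ⁻)
      ≈⟨ σ-cong (≋-trans φ⁻² (+-cong (≋-sym (D-* φ φ)) (≋-trans
           (solve 2 (λ q r → :- (con (+ 4) :* (q :* r)) := q :* (con (ℤ.- (+ 4)) :* r)) ≋-refl q (Q * Q))
           (*-congˡ q (≋-trans (*-congˡ (const (ℤ.- (+ 4))) (≋-sym (D-* (D ψ) (D ψ)))) (≋-sym (D-product-of-const (ℤ.- (+ 4)) (D ψ * D ψ)))))))) ⟩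
    σ (D (φ * φ) + q * D (const (ℤ.- (+ 4)) * (D ψ * D ψ)))
      ≈⟨ ≋-trans (σ-+ (D (φ * φ)) (q * D r)) (+-cong (σ-D (φ * φ)) (≋-trans (σ-* q (D r)) (*-cong σ-q (σ-D r)))) ⟩
    D (φ * φ) + - q * D (const (ℤ.- (+ 4)) * (D ψ * D ψ))
      ≈⟨ +-cong (D-* φ φ) (*-congˡ (- q) (≋-trans (D-product-of-const (ℤ.- (+ 4)) (D ψ * D ψ)) (*-congˡ (const (ℤ.- (+ 4))) (D-* (D ψ) (D ψ))))) ⟩
    D φ * D φ + - q * (const (ℤ.- (+ 4)) * (Q * Q))
      ≈⟨ +-congˡ (D φ * D φ) (solve 2 (λ q r → :- q :* (con (ℤ.- (+ 4)) :* r) := con (+ 4) :* (q :* r)) ≋-refl q (Q * Q)) ⟩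
    D φ * D φ + const (+ 4) * (q * (Q * Q)) ∎
    where
    Q = D (D ψ)
    r = const (ℤ.- (+ 4)) * (D ψ * D ψ)

-- Successive 2-dissections leading to v₀(32n + 4).

module Dissection where

  open PowerSeries
  open Operators
  open Convergence
  open EvenPart
  open ThetaProducts
  open import Algebra.Bundles using (CommutativeRing)
  open import Data.Integer using (1ℤ; +_)
  open PowerSeries.Solver using (solve; _:+_; _:*_; _:=_; _:-_; :-_; con)
  open import Relation.Binary.Reasoning.Setoid seriesSetoid
  private module R = CommutativeRing seriesRing

  -- The coefficients of `g₁`, `g₂`, `g₃` are 2 v₀(8n+4), 2 v₀(16n+4), 2 v₀(32n+4). Passing to odd
  -- exponents in `g₁` also removes the -1 contained in `G 0`.
  g₀ g₁ g₂ g₃ : Series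
  g₀ = U (G 0)
  g₁ = U′ g₀
  g₂ = U g₁
  g₃ = U g₂

  private
    D-*-D : ∀ {f f′ g g′} → D f ≋ f′ → D g ≋ g′ → D (f * g) ≋ f′ * g′
    D-*-D {f} {g = g} p r = ≋-trans (D-* f g) (*-cong p r)

    D-const* : ∀ c {f f′} → D f ≋ f′ → D (const c * f) ≋ const c * f′
    D-const* c {f} p = ≋-trans (D-product-of-const c f) (*-congˡ (const c) p)

    D-+-D : ∀ {f f′ g g′} → D f ≋ f′ → D g ≋ g′ → D (f + g) ≋ f′ + g′
    D-+-D {f} {g = g} p r = ≋-trans (D-+ f g) (+-cong p r)

    P Q R′ : Series
    P  = D φ
    R′ = D ψ
    Q  = D (D ψ)

  -- Multiplying by a power of φ turns the power of φ⁻ in front of gᵢ into a series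
  -- in q², by φ*φ⁻; the even or odd part then gives the equation for gᵢ₊₁.
  φ⁻g₀ : φ⁻ * g₀ ≋ φ * φ
  φ⁻g₀ = begin
    φ⁻ * U (G 0)
      ≈⟨ ≋-sym (U-D-* φ⁻ (G 0)) ⟩
    U (D φ⁻ * G 0)
      ≈⟨ U-cong (≋-trans (R.*-comm (D φ⁻) (G 0)) (≋-trans G*Dφ⁻ (≋-trans φ² split))) ⟩
    U (D (φ * φ) + q * D (const (+ 4) * (R′ * R′)))
      ≈⟨ U-odd (φ * φ) (const (+ 4) * (R′ * R′)) ⟩
    φ * φ ∎
    where
    split : P * P + const (+ 4) * (q * (Q * Q)) ≋ D (φ * φ) + q * D (const (+ 4) * (R′ * R′))
    split = ≋-trans (solve 3 (λ P q Q → P :* P :+ con (+ 4) :* (q :* (Q :* Q)) := P :* P :+ q :* (con (+ 4) :* (Q :* Q))) ≋-refl P q Q)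
      (≋-sym (+-cong (D-* φ φ) (*-congˡ q (D-const* (+ 4) (D-* R′ R′)))))

  R² : R′ * R′ ≋ P * Q
  R² = ≋-trans (≋-sym (D-* ψ ψ)) (≋-trans (D-cong ψ²) (D-* φ (D ψ)))

  φ⁻²g₁ : φ⁻ * φ⁻ * g₁ ≋ const (+ 6) * (P * P * Q) + const (+ 8) * (q * (Q * Q * Q))
  φ⁻²g₁ = begin
    φ⁻ * φ⁻ * U′ g₀
      ≈⟨ ≋-sym (U′-D-* (φ⁻ * φ⁻) g₀) ⟩
    U′ (D (φ⁻ * φ⁻) * g₀)
      ≈⟨ U′-cong expand ⟩
    U′ (D e + q * D o)
      ≈⟨ U′-odd e o ⟩
    o
      ≈⟨ +-congˡ (const (+ 2) * (Q * (φ * φ))) (*-congˡ (const (+ 4)) (*-congˡ P R²)) ⟩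
    const (+ 2) * (Q * (φ * φ)) + const (+ 4) * (P * (P * Q))
      ≈⟨ +-congʳ (const (+ 4) * (P * (P * Q))) (*-congˡ (const (+ 2)) (*-congˡ Q φ²)) ⟩
    const (+ 2) * (Q * (P * P + const (+ 4) * (q * (Q * Q)))) + const (+ 4) * (P * (P * Q))
      ≈⟨ solve 3 (λ P Q q → con (+ 2) :* (Q :* (P :* P :+ con (+ 4) :* (q :* (Q :* Q)))) :+ con (+ 4) :* (P :* (P :* Q))
           := con (+ 6) :* (P :* P :* Q) :+ con (+ 8) :* (q :* (Q :* Q :* Q))) ≋-refl P Q q ⟩
    const (+ 6) * (P * P * Q) + const (+ 8) * (q * (Q * Q * Q)) ∎
    where
    -- The even and odd parts of φ³, read off from the product of the dissections of φ and of φ².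
    e o : Series
    e = P * (φ * φ) + const (+ 8) * (q * (Q * (R′ * R′)))
    o = const (+ 2) * (Q * (φ * φ)) + const (+ 4) * (P * (R′ * R′))
    expand : D (φ⁻ * φ⁻) * g₀ ≋ D e + q * D o
    expand = begin
      D (φ⁻ * φ⁻) * g₀
        ≈⟨ *-congʳ g₀ (≋-trans (D-* φ⁻ φ⁻) (≋-sym φ*φ⁻)) ⟩
      φ * φ⁻ * g₀
        ≈⟨ ≋-trans (R.*-assoc φ φ⁻ g₀) (*-congˡ φ φ⁻g₀) ⟩
      φ * (φ * φ)
        ≈⟨ *-cong φ-dissection φ² ⟩
      (D P + const (+ 2) * (q * D Q)) * (P * P + const (+ 4) * (q * (Q * Q)))
        ≈⟨ solve 5 (λ p q r P Q → (p :+ con (+ 2) :* (q :* r)) :* (P :+ con (+ 4) :* (q :* Q))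
             := (p :* P :+ con (+ 8) :* (q :* q :* (r :* Q))) :+ q :* (con (+ 2) :* (r :* P) :+ con (+ 4) :* (p :* Q)))
             ≋-refl (D P) q (D Q) (P * P) (Q * Q) ⟩
      (D P * (P * P) + const (+ 8) * (q * q * (D Q * (Q * Q)))) + q * (const (+ 2) * (D Q * (P * P)) + const (+ 4) * (D P * (Q * Q)))
        ≈⟨ ≋-sym (+-cong
             (D-+-D (D-*-D ≋-refl (D-* φ φ)) (D-const* (+ 8) (D-*-D D-q (D-*-D ≋-refl (D-* R′ R′)))))
             (*-congˡ q (D-+-D (D-const* (+ 2) (D-*-D ≋-refl (D-* φ φ))) (D-const* (+ 4) (D-*-D ≋-refl (D-* R′ R′)))))) ⟩
      D e + q * D o ∎

  φ⁻⁴ : Series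
  φ⁻⁴ = φ⁻ * φ⁻ * (φ⁻ * φ⁻)

  φ⁻⁸ : Series
  φ⁻⁸ = φ⁻⁴ * φ⁻⁴

  D-φ⁻⁴ : D φ⁻⁴ ≋ φ⁻ * φ⁻ * (φ * φ)
  D-φ⁻⁴ = ≋-trans (D-*-D (≋-trans (D-* φ⁻ φ⁻) (≋-sym φ*φ⁻)) (≋-trans (D-* φ⁻ φ⁻) (≋-sym φ*φ⁻)))
    (solve 2 (λ f g → f :* g :* (f :* g) := g :* g :* (f :* f)) ≋-refl φ φ⁻)

  φ⁻⁴g₂ : φ⁻⁴ * g₂ ≋ const (+ 6) * (φ * φ * (φ * φ) * R′) + const (+ 32) * (q * (R′ * R′ * (R′ * R′) * R′))
  φ⁻⁴g₂ = begin
    φ⁻⁴ * U g₁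
      ≈⟨ ≋-sym (U-D-* φ⁻⁴ g₁) ⟩
    U (D φ⁻⁴ * g₁)
      ≈⟨ U-cong expand ⟩
    U (D e + q * D o)
      ≈⟨ U-odd e o ⟩
    e ∎
    where
    e o : Series
    e = const (+ 6) * (φ * φ * (φ * φ) * R′) + const (+ 32) * (q * (R′ * R′ * (R′ * R′) * R′))
    o = const (+ 32) * (φ * φ * (R′ * R′ * R′))
    expand : D φ⁻⁴ * g₁ ≋ D e + q * D o
    expand = begin
      D φ⁻⁴ * g₁
        ≈⟨ *-congʳ g₁ D-φ⁻⁴ ⟩
      φ⁻ * φ⁻ * (φ * φ) * g₁
        ≈⟨ solve 3 (λ f h g → f :* h :* g := f :* g :* h) ≋-refl (φ⁻ * φ⁻) (φ * φ) g₁ ⟩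
      φ⁻ * φ⁻ * g₁ * (φ * φ)
        ≈⟨ *-cong φ⁻²g₁ φ² ⟩
      (const (+ 6) * (P * P * Q) + const (+ 8) * (q * (Q * Q * Q))) * (P * P + const (+ 4) * (q * (Q * Q)))
        ≈⟨ solve 3 (λ P Q q → (con (+ 6) :* (P :* P :* Q) :+ con (+ 8) :* (q :* (Q :* Q :* Q))) :* (P :* P :+ con (+ 4) :* (q :* (Q :* Q)))
             := (con (+ 6) :* (P :* P :* (P :* P) :* Q) :+ con (+ 32) :* (q :* q :* (Q :* Q :* (Q :* Q) :* Q))) :+ q :* (con (+ 32) :* (P :* P :* (Q :* Q :* Q))))
             ≋-refl P Q q ⟩
      (const (+ 6) * (P * P * (P * P) * Q) + const (+ 32) * (q * q * (Q * Q * (Q * Q) * Q))) + q * (const (+ 32) * (P * P * (Q * Q * Q)))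
        ≈⟨ ≋-sym (+-cong
             (D-+-D (D-const* (+ 6) (D-*-D (D-*-D (D-* φ φ) (D-* φ φ)) ≋-refl))
                    (D-const* (+ 32) (D-*-D D-q (D-*-D (D-*-D (D-* R′ R′) (D-* R′ R′)) ≋-refl))))
             (*-congˡ q (D-const* (+ 32) (D-*-D (D-* φ φ) (D-*-D (D-* R′ R′) ≋-refl))))) ⟩
      D e + q * D o ∎

  φ⁴ S⁴ : Series
  φ⁴ = φ * φ * (φ * φ)
  S⁴ = R′ * R′ * (R′ * R′)

  S⁴≋P²Q² : S⁴ ≋ P * P * (Q * Q)
  S⁴≋P²Q² = ≋-trans (*-cong R² R²) (solve 2 (λ P Q → P :* Q :* (P :* Q) := P :* P :* (Q :* Q)) ≋-refl P Q)

  φ⁻⁸g₃-raw : φ⁻⁸ * g₃ ≋ ψ * (const (+ 6) * ((φ⁴ + const (+ 16) * (q * S⁴)) * (φ⁴ + const (+ 16) * (q * S⁴))) + const (+ 640) * (q * (φ⁴ * S⁴)))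
  φ⁻⁸g₃-raw = begin
    φ⁻⁸ * U g₂
      ≈⟨ ≋-sym (U-D-* φ⁻⁸ g₂) ⟩
    U (D φ⁻⁸ * g₂)
      ≈⟨ U-cong expand ⟩
    U (D e + q * D o)
      ≈⟨ U-odd e o ⟩
    e ∎
    where
    e o P² Q² : Series
    e = ψ * (const (+ 6) * ((φ⁴ + const (+ 16) * (q * S⁴)) * (φ⁴ + const (+ 16) * (q * S⁴))) + const (+ 640) * (q * (φ⁴ * S⁴)))
    o = ψ * (const (+ 128) * (φ * φ * (R′ * R′) * (φ⁴ + const (+ 16) * (q * S⁴))))
    P² = P * P
    Q² = Q * Q
    D-sum : D (φ⁴ + const (+ 16) * (q * S⁴)) ≋ P² * P² + const (+ 16) * (q * q * (Q² * Q²))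
    D-sum = D-+-D (D-*-D (D-* φ φ) (D-* φ φ)) (D-const* (+ 16) (D-*-D D-q (D-*-D (D-* R′ R′) (D-* R′ R′))))
    expand : D φ⁻⁸ * g₂ ≋ D e + q * D o
    expand = begin
      D φ⁻⁸ * g₂
        ≈⟨ *-congʳ g₂ (D-*-D D-φ⁻⁴ D-φ⁻⁴) ⟩
      φ⁻ * φ⁻ * (φ * φ) * (φ⁻ * φ⁻ * (φ * φ)) * g₂
        ≈⟨ solve 3 (λ f h g → f :* h :* (f :* h) :* g := f :* f :* g :* (h :* h)) ≋-refl (φ⁻ * φ⁻) (φ * φ) g₂ ⟩
      φ⁻⁴ * g₂ * φ⁴
        ≈⟨ *-congʳ φ⁴ φ⁻⁴g₂ ⟩
      (const (+ 6) * (φ⁴ * R′) + const (+ 32) * (q * (S⁴ * R′))) * φ⁴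
        ≈⟨ *-congʳ φ⁴ (+-congˡ (const (+ 6) * (φ⁴ * R′)) (*-congˡ (const (+ 32)) (*-congˡ q (*-congʳ R′ S⁴≋P²Q²)))) ⟩
      (const (+ 6) * (φ⁴ * R′) + const (+ 32) * (q * (P² * Q² * R′))) * φ⁴
        ≈⟨ *-cong (+-congʳ (const (+ 32) * (q * (P² * Q² * R′))) (*-congˡ (const (+ 6)) (*-congʳ R′ (*-cong φ² φ²)))) (*-cong φ² φ²) ⟩
      (const (+ 6) * ((P² + const (+ 4) * (q * Q²)) * (P² + const (+ 4) * (q * Q²)) * R′) + const (+ 32) * (q * (P² * Q² * R′)))
        * ((P² + const (+ 4) * (q * Q²)) * (P² + const (+ 4) * (q * Q²)))
        -- Here s = t + 8 q P Q with t a series in q². So 6 s² + 32 q P Q s has even part 6 t² + (6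
        -- · 64 + 32 · 8) q² P² Q², whence 640, and odd part (96 + 32) q P Q t, whence 128.
        ≈⟨ solve 4 (λ P Q q R → let s = (P :+ con (+ 4) :* (q :* Q)) :* (P :+ con (+ 4) :* (q :* Q)) in
             let t = P :* P :+ con (+ 16) :* (q :* q :* (Q :* Q)) in
             (con (+ 6) :* (s :* R) :+ con (+ 32) :* (q :* (P :* Q :* R))) :* s
             := R :* (con (+ 6) :* (t :* t) :+ con (+ 640) :* (q :* q :* (P :* P :* (Q :* Q)))) :+ q :* (R :* (con (+ 128) :* (P :* Q :* t))))
             ≋-refl P² Q² q R′ ⟩
      R′ * (const (+ 6) * (t * t) + const (+ 640) * (q * q * (P² * P² * (Q² * Q²)))) + q * (R′ * (const (+ 128) * (P² * Q² * t)))
        ≈⟨ ≋-sym (+-cong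
             (D-*-D ≋-refl (D-+-D (D-const* (+ 6) (D-*-D D-sum D-sum))
               (D-const* (+ 640) (D-*-D D-q (D-*-D (D-*-D (D-* φ φ) (D-* φ φ)) (D-*-D (D-* R′ R′) (D-* R′ R′)))))))
             (*-congˡ q (D-*-D ≋-refl (D-const* (+ 128) (D-*-D (D-*-D (D-* φ φ) (D-* R′ R′)) D-sum))))) ⟩
      D e + q * D o ∎
      where
      t = P² * P² + const (+ 16) * (q * q * (Q² * Q²))

  -- `φ²` and `φ⁻²` have the forms X + Y and X - Y with X = φ(q²)² and Y = 4 q ψ(q⁴)², and the
  -- squares of these differ by 4 X Y. Then φ(q²)² ψ(q⁴)² = ψ(q²)⁴.
  φ⁻⁴+16qS⁴ : φ⁴ ≋ φ⁻⁴ + const (+ 16) * (q * S⁴)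
  φ⁻⁴+16qS⁴ = begin
    φ⁴
      ≈⟨ *-cong φ² φ² ⟩
    (P² + const (+ 4) * (q * Q²)) * (P² + const (+ 4) * (q * Q²))
      ≈⟨ solve 3 (λ P q Q → (P :+ con (+ 4) :* (q :* Q)) :* (P :+ con (+ 4) :* (q :* Q))
           := (P :- con (+ 4) :* (q :* Q)) :* (P :- con (+ 4) :* (q :* Q)) :+ con (+ 16) :* (q :* (P :* Q))) ≋-refl P² q Q² ⟩
    (P² - const (+ 4) * (q * Q²)) * (P² - const (+ 4) * (q * Q²)) + const (+ 16) * (q * (P² * Q²))
      ≈⟨ ≋-sym (+-cong (*-cong φ⁻² φ⁻²) (*-congˡ (const (+ 16)) (*-congˡ q S⁴≋P²Q²))) ⟩
    φ⁻⁴ + const (+ 16) * (q * S⁴) ∎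
    where
    P² Q² : Series
    P² = P * P
    Q² = Q * Q

  ψ⁸ : Series
  ψ⁸ = ψ * ψ * (ψ * ψ) * (ψ * ψ * (ψ * ψ))

  -- Put f = φ⁻⁴ and z = 16 q S⁴, so that φ⁴ = f + z. Then 6 (f + 2z)² + 40 z (f + z) = 6 f² + 64 z
  -- (f + z), in which f + z is φ⁴ again, and φ⁴ S⁴ = ψ⁸ by `ψ²`. The constant is 64 · 16 = 1024.
  φ⁻⁸g₃ : φ⁻⁸ * g₃ ≋ const (+ 6) * (ψ * φ⁻⁸) + const (+ 1024) * (q * (ψ * ψ⁸))
  φ⁻⁸g₃ = begin
    φ⁻⁸ * g₃
      ≈⟨ φ⁻⁸g₃-raw ⟩
    ψ * (const (+ 6) * ((φ⁴ + const (+ 16) * (q * S⁴)) * (φ⁴ + const (+ 16) * (q * S⁴))) + const (+ 640) * (q * (φ⁴ * S⁴)))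
      ≈⟨ *-congˡ ψ (+-cong (*-congˡ (const (+ 6)) (*-cong (+-congʳ z φ⁻⁴+16qS⁴) (+-congʳ z φ⁻⁴+16qS⁴)))
           (*-congˡ (const (+ 640)) (*-congˡ q (*-congʳ S⁴ φ⁻⁴+16qS⁴)))) ⟩
    ψ * (const (+ 6) * ((φ⁻⁴ + z + z) * (φ⁻⁴ + z + z)) + const (+ 640) * (q * ((φ⁻⁴ + z) * S⁴)))
      ≈⟨ solve 4 (λ p f q s → let z = con (+ 16) :* (q :* s) in
           p :* (con (+ 6) :* ((f :+ z :+ z) :* (f :+ z :+ z)) :+ con (+ 640) :* (q :* ((f :+ z) :* s)))
           := con (+ 6) :* (p :* (f :* f)) :+ con (+ 1024) :* (q :* (p :* ((f :+ z) :* s)))) ≋-refl ψ φ⁻⁴ q S⁴ ⟩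
    const (+ 6) * (ψ * φ⁻⁸) + const (+ 1024) * (q * (ψ * ((φ⁻⁴ + z) * S⁴)))
      ≈⟨ +-congˡ (const (+ 6) * (ψ * φ⁻⁸)) (*-congˡ (const (+ 1024)) (*-congˡ q (*-congˡ ψ (≋-trans (*-congʳ S⁴ (≋-sym φ⁻⁴+16qS⁴)) φ⁴S⁴)))) ⟩
    const (+ 6) * (ψ * φ⁻⁸) + const (+ 1024) * (q * (ψ * ψ⁸)) ∎
    where
    z = const (+ 16) * (q * S⁴)
    φ⁴S⁴ : φ⁴ * S⁴ ≋ ψ⁸
    φ⁴S⁴ = ≋-trans (solve 2 (λ f s → f :* f :* (f :* f) :* (s :* s :* (s :* s)) := f :* s :* (f :* s) :* (f :* s :* (f :* s))) ≋-refl φ R′)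
      (≋-sym (*-cong (*-cong ψ² ψ²) (*-cong ψ² ψ²)))

  -- φ⁻⁵ contributes ten factors `a`. Nine of them turn ψ⁹ into (D E)⁹ by `DE≋aψ`; the tenth
  -- completes one of the fourteen factors `D E` to `E`.
  ψ⁹φ⁻⁵ : ψ ^ 9 * φ⁻ ^ 5 ≋ E * D E ^ 13
  ψ⁹φ⁻⁵ = begin
    ψ ^ 9 * φ⁻ ^ 5
      ≈⟨ *-congˡ (ψ ^ 9) (≋-trans (^-cong 5 φ⁻-product) (≋-trans (*-^ 5 (a * a) (D E)) (*-congʳ (D E ^ 5) (*-^ 5 a a)))) ⟩
    ψ ^ 9 * (a ^ 5 * a ^ 5 * D E ^ 5)
      ≈⟨ *-congˡ (ψ ^ 9) (*-congʳ (D E ^ 5) (≋-trans (≋-sym (^-+ a 5 5)) (R.*-comm a (a ^ 9)))) ⟩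
    ψ ^ 9 * (a ^ 9 * a * D E ^ 5)
      ≈⟨ solve 4 (λ p x a e → p :* (x :* a :* e) := a :* ((x :* p) :* e)) ≋-refl (ψ ^ 9) (a ^ 9) a (D E ^ 5) ⟩
    a * ((a ^ 9 * ψ ^ 9) * D E ^ 5)
      ≈⟨ *-congˡ a (*-congʳ (D E ^ 5) (≋-trans (≋-sym (*-^ 9 a ψ)) (^-cong 9 (≋-sym DE≋aψ)))) ⟩
    a * (D E ^ 9 * D E ^ 5)
      ≈⟨ *-congˡ a (≋-sym (^-+ (D E) 9 5)) ⟩
    a * (D E * D E ^ 13)
      ≈⟨ ≋-trans (≋-sym (R.*-assoc a (D E) (D E ^ 13))) (*-congʳ (D E ^ 13) (≋-sym E-split)) ⟩
    E * D E ^ 13 ∎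

  φ⁻¹³g₃ : φ⁻ ^ 13 * g₃ ≋ const (+ 6) * (φ⁻ ^ 13 * ψ) + const (+ 1024) * (D E ^ 13 * (q * E))
  φ⁻¹³g₃ = begin
    φ⁻ ^ 13 * g₃
      ≈⟨ *-congʳ g₃ power ⟩
    φ⁻⁸ * φ⁻ ^ 5 * g₃
      ≈⟨ solve 3 (λ x y g → x :* y :* g := y :* (x :* g)) ≋-refl φ⁻⁸ (φ⁻ ^ 5) g₃ ⟩
    φ⁻ ^ 5 * (φ⁻⁸ * g₃)
      ≈⟨ *-congˡ (φ⁻ ^ 5) φ⁻⁸g₃ ⟩
    φ⁻ ^ 5 * (const (+ 6) * (ψ * φ⁻⁸) + const (+ 1024) * (q * (ψ * ψ⁸)))
      ≈⟨ solve 5 (λ y p x q s → y :* (con (+ 6) :* (p :* x) :+ con (+ 1024) :* (q :* s)) := con (+ 6) :* (x :* y :* p) :+ con (+ 1024) :* (q :* (s :* y)))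
           ≋-refl (φ⁻ ^ 5) ψ φ⁻⁸ q (ψ * ψ⁸) ⟩
    const (+ 6) * (φ⁻⁸ * φ⁻ ^ 5 * ψ) + const (+ 1024) * (q * (ψ * ψ⁸ * φ⁻ ^ 5))
      ≈⟨ +-cong (*-congˡ (const (+ 6)) (*-congʳ ψ (≋-sym power)))
           (*-congˡ (const (+ 1024)) (≋-trans (*-congˡ q (≋-trans (*-congʳ (φ⁻ ^ 5) (eighth ψ)) ψ⁹φ⁻⁵))
             (solve 3 (λ q e f → q :* (e :* f) := f :* (q :* e)) ≋-refl q E (D E ^ 13)))) ⟩
    const (+ 6) * (φ⁻ ^ 13 * ψ) + const (+ 1024) * (D E ^ 13 * (q * E)) ∎
    where
    octo : ∀ f → f * f * (f * f) * (f * f * (f * f)) ≋ f ^ 8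
    octo = solve 1 (λ f → f :* f :* (f :* f) :* (f :* f :* (f :* f)) := f :* (f :* (f :* (f :* (f :* (f :* (f :* (f :* con 1ℤ)))))))) ≋-refl
    eighth : ∀ f → f * (f * f * (f * f) * (f * f * (f * f))) ≋ f ^ 9
    eighth f = *-congˡ f (octo f)
    power : φ⁻ ^ 13 ≋ φ⁻⁸ * φ⁻ ^ 5
    power = ≋-trans (^-+ φ⁻ 8 5) (*-congʳ (φ⁻ ^ 5) (≋-sym (octo φ⁻)))

-- Thirteenth powers of series modulo 13.

module Frobenius where

  open PowerSeries
  open Operators
  open Convergence
  open import Algebra.Bundles using (CommutativeRing)
  import Algebra.Properties.CommutativeSemiring.Binomial
  open Algebra.Properties.CommutativeSemiring.Binomial (CommutativeRing.commutativeSemiring seriesRing)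
    using (binomialTerm) renaming (theorem to binomial-theorem)
  import Algebra.Properties.Monoid.Sum
  open Algebra.Properties.Monoid.Sum (CommutativeRing.+-monoid seriesRing) using (sum; sum-init-last)
  import Algebra.Properties.Monoid.Mult
  open Algebra.Properties.Monoid.Mult (CommutativeRing.+-monoid seriesRing) using () renaming (_×_ to _⊗_)
  open import Data.Fin as Fin using (Fin; toℕ; inject₁)
  import Data.Fin.Properties as Finₚ
  open import Data.Integer as ℤ using (ℤ; 0ℤ; +_)
  open import Data.Integer.Divisibility.Signed
    using (_∣_; divides; ∣m∣n⇒∣m+n)
  import Data.Integer.Properties as ℤₚ
  import Data.Integer.Tactic.RingSolver as ℤ-Solver
  open import Data.Nat as ℕ using (ℕ; zero; suc; z≤n; s≤s)
  open import Data.Nat.Combinatorics using (_C_)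
  import Data.Nat.Divisibility as ℕ∣
  open import Data.Nat.DivMod using (m≡m%n+[m/n]*n; m%n<n)
  import Data.Nat.Properties as ℕₚ
  open import Data.Vec.Functional using (init)
  open import Function using (_∘_)
  open import Relation.Binary.PropositionalEquality
  open import Relation.Nullary using (¬_; contradiction)
  open import Relation.Nullary.Decidable using (from-yes)
  private module R = CommutativeRing seriesRing

  13∣0 : + 13 ∣ 0ℤ
  13∣0 = divides 0ℤ refl

  ≡0⇒13∣ : ∀ {x} → x ≡ 0ℤ → + 13 ∣ x
  ≡0⇒13∣ refl = 13∣0

  ∑≤-∣ : ∀ n f → (∀ i → i ℕ.≤ n → + 13 ∣ f i) → + 13 ∣ ∑≤ n f
  ∑≤-∣ zero    f h = h 0 z≤n
  ∑≤-∣ (suc n) f h = ∣m∣n⇒∣m+n (h 0 z≤n) (∑≤-∣ n (f ∘ suc) (λ i i≤n → h (suc i) (s≤s i≤n)))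

  ⊗-at : ∀ m f k → (m ⊗ f) k ≡ + m ℤ.* f k
  ⊗-at zero    f k = refl
  ⊗-at (suc m) f k = trans (cong (λ x → f k ℤ.+ x) (⊗-at m f k)) (sym (ℤₚ.suc-* (+ m) (f k)))

  ⊗-∣ : ∀ {m} f k → 13 ℕ∣.∣ m → + 13 ∣ (m ⊗ f) k
  ⊗-∣ {m} f k (ℕ∣.divides c refl) = divides (+ c ℤ.* f k) (trans (⊗-at (c ℕ.* 13) f k)
    (trans (cong (ℤ._* f k) (ℤₚ.pos-* c 13)) (rearrange (+ c) (f k))))
    where
    rearrange : ∀ c x → c ℤ.* + 13 ℤ.* x ≡ c ℤ.* x ℤ.* + 13
    rearrange = ℤ-Solver.solve-∀

  sum-∣ : ∀ n (t : Fin n → Series) k → (∀ i → + 13 ∣ t i k) → + 13 ∣ sum t k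
  sum-∣ zero    t k h = 13∣0
  sum-∣ (suc n) t k h = ∣m∣n⇒∣m+n (h Fin.zero) (sum-∣ n (t ∘ Fin.suc) k (h ∘ Fin.suc))

  -- The inner lower indices 1, ..., 12, written in the form that `sum-init-last` produces in
  -- `freshman`.
  13∣binomial : ∀ i → 13 ℕ∣.∣ (13 C toℕ (Fin.suc (inject₁ {12} i)))
  13∣binomial = from-yes (Finₚ.all? (λ i → 13 ℕ∣.∣? (13 C toℕ (Fin.suc (inject₁ {12} i)))))

  freshman : ∀ f g k → + 13 ∣ (f ^ 13) k → + 13 ∣ (g ^ 13) k → + 13 ∣ ((f + g) ^ 13) k
  freshman f g k 13∣f 13∣g = subst (+ 13 ∣_)
    (sym (trans (at (binomial-theorem 13 f g) k)
      (cong (λ x → t Fin.zero k ℤ.+ x) (at (sum-init-last (t ∘ Fin.suc)) k))))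
    (∣m∣n⇒∣m+n (subst (+ 13 ∣_) (sym (at first k)) 13∣g)
      (∣m∣n⇒∣m+n (sum-∣ 12 (init (t ∘ Fin.suc)) k (λ i → ⊗-∣ _ k (13∣binomial i)))
        (subst (+ 13 ∣_) (sym (at final k)) 13∣f)))
    where
    t : Fin 14 → Series
    t = binomialTerm f g 13
    first : 1 ⊗ (1# * g ^ 13) ≋ g ^ 13
    first = ≋-trans (R.+-identityʳ (1# * g ^ 13)) (R.*-identityˡ (g ^ 13))
    final : 1 ⊗ (f ^ 13 * 1#) ≋ f ^ 13
    final = ≋-trans (R.+-identityʳ (f ^ 13 * 1#)) (R.*-identityʳ (f ^ 13))

  q^-*-shift : ∀ e g k → (q ^ e * g) (k ℕ.+ e) ≡ g k
  q^-*-shift zero    g k = trans (*-identityˡ g (k ℕ.+ 0)) (cong g (ℕₚ.+-identityʳ k))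
  q^-*-shift (suc e) g k = trans (cong (q * q ^ e * g) (ℕₚ.+-suc k e))
    (trans (*-assoc q (q ^ e) g (suc (k ℕ.+ e)))
      (trans (q-*-suc (q ^ e * g) (k ℕ.+ e)) (q^-*-shift e g k)))

  const-^ : ∀ c n → const c ^ n ≋ const (c ℤ.^ n)
  const-^ c zero    = 1#≋const
  const-^ c (suc n) = ≋-trans (*-congˡ (const c) (const-^ c n)) (mk λ where
    zero    → refl
    (suc k) → trans (const-* c (const (c ℤ.^ n)) (suc k)) (ℤₚ.*-zeroʳ c))

  head-tail : ∀ f → f ≋ const (f 0) + q * tail f
  head-tail f = mk λ where
    zero    → sym (ℤₚ.+-identityʳ (f 0))
    (suc k) → sym (trans (ℤₚ.+-identityˡ _) (q-*-suc (tail f) k))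

  const-suc : ∀ c k → ¬ k ≡ 0 → const c k ≡ 0ℤ
  const-suc c zero    k≢0 = contradiction refl k≢0
  const-suc c (suc k) k≢0 = refl

  private
    power-step : ∀ f k → ¬ k ≡ 0 → + 13 ∣ (q ^ 13 * tail f ^ 13) k → + 13 ∣ (f ^ 13) k
    power-step f k k≢0 h = subst (+ 13 ∣_) (sym (at (^-cong 13 (head-tail f)) k))
      (freshman (const (f 0)) (q * tail f) k
        (≡0⇒13∣ (trans (at (const-^ (f 0) 13) k) (const-suc (f 0 ℤ.^ 13) k k≢0)))
        (subst (+ 13 ∣_) (sym (at (*-^ 13 q (tail f)) k)) h))

    low : ∀ e g r → r ℕ.< e → + 13 ∣ (q ^ e * g) (r ℕ.+ 0)
    low e g r r<e = ≡0⇒13∣ (below (order-*ʳ g (order-q^ e)) (r ℕ.+ 0) (subst (ℕ._< e) (sym (ℕₚ.+-identityʳ r)) r<e))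

    high : ∀ e g r m → + 13 ∣ g (r ℕ.+ m) → + 13 ∣ (q ^ e * g) (r ℕ.+ (e ℕ.+ m))
    high e g r m h = subst (λ n → + 13 ∣ (q ^ e * g) n) rearrange
      (subst (+ 13 ∣_) (sym (q^-*-shift e g (r ℕ.+ m))) h)
      where
      rearrange : r ℕ.+ m ℕ.+ e ≡ r ℕ.+ (e ℕ.+ m)
      rearrange = trans (ℕₚ.+-assoc r m e) (cong (λ n → r ℕ.+ n) (ℕₚ.+-comm m e))

    -- Modulo 13, f^13 is f(0)^13 + q^13 (tail f)^13. Away from exponent 0, the coefficient at r +
    -- 13 j thus comes from that of (tail f)^13 at r + 13 (j - 1), and for j = 0 nothing is left
    -- since r < 13.
    residue-support : ∀ j r → r ℕ.< 13 → ¬ r ≡ 0 → ∀ f → + 13 ∣ (f ^ 13) (r ℕ.+ j ℕ.* 13)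
    residue-support zero    r r<13 r≢0 f = power-step f (r ℕ.+ 0) (r≢0 ∘ ℕₚ.m+n≡0⇒m≡0 r)
      (low 13 (tail f ^ 13) r r<13)
    residue-support (suc j) r r<13 r≢0 f = power-step f (r ℕ.+ (13 ℕ.+ j ℕ.* 13)) (r≢0 ∘ ℕₚ.m+n≡0⇒m≡0 r)
      (high 13 (tail f ^ 13) r (j ℕ.* 13) (residue-support j r r<13 r≢0 (tail f)))

  frobenius : ∀ f k → ¬ 13 ℕ∣.∣ k → + 13 ∣ (f ^ 13) k
  frobenius f k 13∤k = subst (λ n → + 13 ∣ (f ^ 13) n) (sym (m≡m%n+[m/n]*n k 13))
    (residue-support (k ℕ./ 13) (k ℕ.% 13) (m%n<n k 13) (λ k%13≡0 → 13∤k (ℕ∣.m%n≡0⇒n∣m k 13 k%13≡0)) f)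

-- Admissible exponents modulo 13 and the congruence itself.

module Modulo13 where

  open PowerSeries
  open Operators
  open Convergence
  open JacobiTripleProduct
  open EvenPart
  open ThetaProducts
  open Dissection
  open Frobenius
  open import Algebra.Bundles using (CommutativeRing)
  open import Data.Fin as Fin using (Fin; toℕ; fromℕ<)
  import Data.Fin.Properties as Finₚ
  open import Data.Integer as ℤ using (ℤ; 0ℤ; 1ℤ; +_)
  open import Data.Integer.Divisibility.Signed
    using (_∣_; divides; ∣m∣n⇒∣m+n; ∣m+n∣n⇒∣m; ∣m⇒∣m*n; ∣n⇒∣m*n)
  import Data.Integer.Properties as ℤₚ
  import Data.Integer.Tactic.RingSolver as ℤ-Solver
  open import Data.List using (List; _∷_; [])
  open import Data.List.Membership.Propositional using (_∈_)
  open import Data.Nat as ℕ using (ℕ; zero; suc; s≤s)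
  open import Data.List.Membership.DecPropositional ℕ._≟_ using (_∈?_)
  import Data.Nat.Divisibility as ℕ∣
  open import Data.Nat.DivMod
    using (m%n<n; [m+kn]%n≡m%n; %-distribˡ-+; %-distribˡ-*; m%n%n≡m%n; m*n≤o⇒[o∸m*n]%n≡o%n)
  import Data.Nat.Properties as ℕₚ
  import Data.Nat.Tactic.RingSolver as ℕ-Solver
  open import Function using (_∘_)
  open import Relation.Binary.PropositionalEquality
  open import Relation.Nullary using (¬_; Dec; yes; no; contradiction)
  open import Relation.Nullary.Decidable using (from-yes; _→-dec_; ¬?)
  open PowerSeries.Solver using (solve; _:+_; _:*_; _:=_; _:-_; :-_; con)
  open import Relation.Binary.Reasoning.Setoid seriesSetoid
  private module R = CommutativeRing seriesRing

  -- These are the k for which 8k + 1, equivalently 24k + 3, is not a square modulo 13.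
  nonresidues : List ℕ
  nonresidues = 4 ∷ 5 ∷ 7 ∷ 9 ∷ 11 ∷ 12 ∷ []

  Nonresidue : ℕ → Set
  Nonresidue k = k ℕ.% 13 ∈ nonresidues

  -- Both sides depend only on residues, so a table over 13 × 13 pairs is evaluated. The multiplier
  -- 24 suits both kinds of exponents: it completes the square for triangular as well as pentagonal
  -- numbers.
  nonresidue-square : ∀ k s → Nonresidue k → ¬ (24 ℕ.* k ℕ.+ 3) ℕ.% 13 ≡ (s ℕ.* s) ℕ.% 13
  nonresidue-square k s k-bad eq = table (k mod13) (s mod13)
    (subst₂ (λ k s → (24 ℕ.* k ℕ.+ 3) ℕ.% 13 ≡ (s ℕ.* s) ℕ.% 13) (sym (toℕ-mod13 k)) (sym (toℕ-mod13 s)) reduced)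
    (subst Nonresidue (sym (toℕ-mod13 k)) (subst (_∈ nonresidues) (sym (m%n%n≡m%n k 13)) k-bad))
    where
    _mod13 : ℕ → Fin 13
    n mod13 = fromℕ< (m%n<n n 13)
    toℕ-mod13 : ∀ n → toℕ (n mod13) ≡ n ℕ.% 13
    toℕ-mod13 n = Finₚ.toℕ-fromℕ< (m%n<n n 13)
    Compatible : Fin 13 → Fin 13 → Set
    Compatible r s = (24 ℕ.* toℕ r ℕ.+ 3) ℕ.% 13 ≡ (toℕ s ℕ.* toℕ s) ℕ.% 13 → ¬ Nonresidue (toℕ r)
    compatible? : ∀ r s → Dec (Compatible r s)
    compatible? r s = ((24 ℕ.* toℕ r ℕ.+ 3) ℕ.% 13 ℕ.≟ (toℕ s ℕ.* toℕ s) ℕ.% 13) →-dec ¬? (toℕ r ℕ.% 13 ∈? nonresidues)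
    table : ∀ r s → Compatible r s
    table = from-yes (Finₚ.all? λ r → Finₚ.all? (compatible? r))
    linear : ∀ k → (24 ℕ.* (k ℕ.% 13) ℕ.+ 3) ℕ.% 13 ≡ (24 ℕ.* k ℕ.+ 3) ℕ.% 13
    linear k = trans (%-distribˡ-+ (24 ℕ.* (k ℕ.% 13)) 3 13)
      (trans (cong (λ x → (x ℕ.+ 3) ℕ.% 13) (trans (%-distribˡ-* 24 (k ℕ.% 13) 13)
        -- 11 is 24 reduced modulo 13, as left behind by `%-distribˡ-*`.
        (trans (cong (λ x → (11 ℕ.* x) ℕ.% 13) (m%n%n≡m%n k 13)) (sym (%-distribˡ-* 24 k 13)))))
        (sym (%-distribˡ-+ (24 ℕ.* k) 3 13)))
    reduced : (24 ℕ.* (k ℕ.% 13) ℕ.+ 3) ℕ.% 13 ≡ (s ℕ.% 13 ℕ.* (s ℕ.% 13)) ℕ.% 13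
    reduced = trans (linear k) (trans eq (%-distribˡ-* s s 13))

  nonresidue-∸ : ∀ k i → i ℕ.≤ k → 13 ℕ∣.∣ i → Nonresidue k → Nonresidue (k ℕ.∸ i)
  nonresidue-∸ k i i≤k (ℕ∣.divides c refl) = subst (_∈ nonresidues) (sym (m*n≤o⇒[o∸m*n]%n≡o%n c i≤k))

  Vanishes : Series → Set
  Vanishes f = ∀ k → Nonresidue k → + 13 ∣ f k

  -- Modulo 13 only the terms `f i` with 13 dividing i survive, and removing such an i from k keeps
  -- its residue class.
  vanishes-* : ∀ f g → (∀ i → ¬ 13 ℕ∣.∣ i → + 13 ∣ f i) → Vanishes g → Vanishes (f * g)
  vanishes-* f g f-support g-vanishes k k-bad = ∑≤-∣ k _ term
    where
    term : ∀ i → i ℕ.≤ k → + 13 ∣ f i ℤ.* g (k ℕ.∸ i)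
    term i i≤k with 13 ℕ∣.∣? i
    ... | yes 13∣i = ∣n⇒∣m*n (f i) (g-vanishes (k ℕ.∸ i) (nonresidue-∸ k i i≤k 13∣i k-bad))
    ... | no  13∤i = ∣m⇒∣m*n (g (k ℕ.∸ i)) (f-support i 13∤i)

  -- Strong induction on k. In coefficient k of f g, every term besides f(0) g(k) is either
  -- divisible by 13 through `f` or involves `g` at a smaller index of the same class. The first
  -- argument of `go` bounds the recursion.
  vanishes-*-cancel : ∀ f g → f 0 ≡ 1ℤ → (∀ i → ¬ 13 ℕ∣.∣ i → + 13 ∣ f i) → Vanishes (f * g) → Vanishes g
  vanishes-*-cancel f g f0 f-support fg-vanishes k = go (suc k) k ℕₚ.≤-refl
    where
    head-term : ∀ k → f 0 ℤ.* g k ≡ g k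
    head-term k = trans (cong (ℤ._* g k) f0) (ℤₚ.*-identityˡ (g k))
    go : ∀ n k → k ℕ.< n → Nonresidue k → + 13 ∣ g k
    go (suc n) zero    _         k-bad = subst (+ 13 ∣_) (head-term 0) (fg-vanishes 0 k-bad)
    go (suc n) (suc k) (s≤s k<n) k-bad = subst (+ 13 ∣_) (head-term (suc k))
      (∣m+n∣n⇒∣m (fg-vanishes (suc k) k-bad) (∑≤-∣ k _ term))
      where
      term : ∀ i → i ℕ.≤ k → + 13 ∣ f (suc i) ℤ.* g (k ℕ.∸ i)
      term i i≤k with 13 ℕ∣.∣? suc i
      ... | yes 13∣i = ∣n⇒∣m*n (f (suc i)) (go n (k ℕ.∸ i) (ℕₚ.≤-<-trans (ℕₚ.m∸n≤m k i) k<n)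
                         (nonresidue-∸ (suc k) (suc i) (s≤s i≤k) 13∣i k-bad))
      ... | no  13∤i = ∣m⇒∣m*n (g (k ℕ.∸ i)) (f-support (suc i) 13∤i)

  -- Records the exponent and leaves the coefficient free, so that signed and unsigned powers of q
  -- are treated alike.
  Monomial : ℕ → Series → Set
  Monomial e f = ∀ k → ¬ k ≡ e → f k ≡ 0ℤ

  monomial-* : ∀ {d e f g} → Monomial d f → Monomial e g → Monomial (d ℕ.+ e) (f * g)
  monomial-* {d} {e} {f} {g} mf mg k k≢d+e = ∑≤-zero k _ term
    where
    term : ∀ i → i ℕ.≤ k → f i ℤ.* g (k ℕ.∸ i) ≡ 0ℤ
    term i i≤k with i ℕ.≟ d
    ... | no  i≢d  = cong (ℤ._* g (k ℕ.∸ i)) (mf i i≢d)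
    ... | yes refl = trans (cong (λ x → f i ℤ.* x) (mg (k ℕ.∸ i) λ k∸i≡e →
                       k≢d+e (trans (sym (ℕₚ.m+[n∸m]≡n i≤k)) (cong (λ n → i ℕ.+ n) k∸i≡e)))) (ℤₚ.*-zeroʳ (f i))

  monomial-1 : Monomial 0 1#
  monomial-1 zero    k≢0 = contradiction refl k≢0
  monomial-1 (suc k) k≢0 = refl

  monomial-q : Monomial 1 q
  monomial-q zero    k≢1 = refl
  monomial-q (suc k) k≢1 = monomial-1 k (k≢1 ∘ cong suc)

  monomial-neg : ∀ {e f} → Monomial e f → Monomial e (- f)
  monomial-neg m k k≢e = cong (λ x → ℤ.- x) (m k k≢e)

  monomial-^ : ∀ {e f} n → Monomial e f → Monomial (n ℕ.* e) (f ^ n)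
  monomial-^ zero    m = monomial-1
  monomial-^ (suc n) m = monomial-* m (monomial-^ n m)

  monomial-q^ : ∀ n → Monomial n (q ^ n)
  monomial-q^ zero    = monomial-1
  monomial-q^ (suc n) = monomial-* monomial-q (monomial-q^ n)

  8T+1 : ∀ i → 8 ℕ.* T i ℕ.+ 1 ≡ suc (i ℕ.+ i) ℕ.* suc (i ℕ.+ i)
  8T+1 zero    = refl
  8T+1 (suc i) = trans (unfold i (T i)) (trans (cong (ℕ._+ 8 ℕ.* suc i) (8T+1 i)) (square i))
    where
    unfold : ∀ i t → 8 ℕ.* (suc i ℕ.+ t) ℕ.+ 1 ≡ 8 ℕ.* t ℕ.+ 1 ℕ.+ 8 ℕ.* suc i
    unfold = ℕ-Solver.solve-∀
    square : ∀ i → suc (i ℕ.+ i) ℕ.* suc (i ℕ.+ i) ℕ.+ 8 ℕ.* suc i ≡ suc (suc i ℕ.+ suc i) ℕ.* suc (suc i ℕ.+ suc i)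
    square = ℕ-Solver.solve-∀

  -- 24 T i + 3 = 3 (2i + 1)² is a square modulo 13 because 3 = 4² there.
  T-residue : ∀ i → ¬ Nonresidue (T i)
  T-residue i bad = nonresidue-square (T i) (4 ℕ.* m) bad (trans (sym ([m+kn]%n≡m%n (24 ℕ.* T i ℕ.+ 3) (m ℕ.* m) 13))
    (cong (ℕ._% 13) (trans (cong (ℕ._+ m ℕ.* m ℕ.* 13) (trans (triple (T i)) (cong (3 ℕ.*_) (8T+1 i)))) (square m))))
    where
    m = suc (i ℕ.+ i)
    triple : ∀ t → 24 ℕ.* t ℕ.+ 3 ≡ 3 ℕ.* (8 ℕ.* t ℕ.+ 1)
    triple = ℕ-Solver.solve-∀
    square : ∀ m → 3 ℕ.* (m ℕ.* m) ℕ.+ m ℕ.* m ℕ.* 13 ≡ 4 ℕ.* m ℕ.* (4 ℕ.* m)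
    square = ℕ-Solver.solve-∀

  ψ-vanishes : Vanishes ψ
  ψ-vanishes k k-bad = ≡0⇒13∣ (∑≤-zero k _ λ i _ → monomial-q^ (T i) k λ where refl → T-residue i k-bad)

  -- Euler's pentagonal number theorem: the triple product at x = -q, y = -q², p = q³, once the
  -- factors 1 - q^n are sorted by n modulo 3.
  E-series : E ≋ ∑∞ (θ (q * (q * q)) (- (q * q)) ∘ suc) + ∑∞ (θ (q * (q * q)) (- q))
  E-series = begin
    E
      ≈⟨ ∏∞-blocks 3 euler-order ⟩
    ∏∞ (λ i → ∏ 3 (λ j → euler q (j ℕ.+ i ℕ.* 3)))
      ≈⟨ ∏∞-cong block ⟩
    ∏∞ (λ i → factor p x i * factor p y i * euler p i)
      ≈⟨ ∏∞-* (multipliable-* (mult x-order) (mult y-order)) (euler-multipliable x y p xy x-order y-order) ⟩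
    ∏∞ (λ i → factor p x i * factor p y i) * ∏∞ (euler p)
      ≈⟨ *-congʳ (∏∞ (euler p)) (∏∞-* (mult x-order) (mult y-order)) ⟩
    ∏∞ (factor p x) * ∏∞ (factor p y) * ∏∞ (euler p)
      ≈⟨ triple-product x y p xy x-order y-order ⟩
    ∑∞ (θ p y ∘ suc) + ∑∞ (θ p x) ∎
    where
    p x y : Series
    p = q * (q * q)
    x = - q
    y = - (q * q)
    xy : x * y ≋ p
    xy = solve 1 (λ q → :- q :* :- (q :* q) := q :* (q :* q)) ≋-refl q
    x-order : x ≈[ 1 ] 0#
    x-order = ≈[]-neg order-q
    y-order : y ≈[ 1 ] 0#
    y-order = ≈[]-neg (order-*ʳ q order-q)
    mult : ∀ {z} → z ≈[ 1 ] 0# → Multipliable (factor p z)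
    mult = factor-multipliable x y p xy x-order y-order
    q^-3 : ∀ i → q ^ (i ℕ.* 3) ≋ p ^ i
    q^-3 i = ≋-trans (^-^ q 3 i) (^-cong i (*-congˡ q (*-congˡ q (R.*-identityʳ q))))
    block : ∀ i → ∏ 3 (λ j → euler q (j ℕ.+ i ℕ.* 3)) ≋ factor p x i * factor p y i * euler p i
    block i = begin
      1# * (1# - q * u) * (1# - q * (q * u)) * (1# - q * (q * (q * u)))
        ≈⟨ *-cong (*-cong (*-congˡ 1# (+-congˡ 1# (-‿cong (*-congˡ q u≋)))) (+-congˡ 1# (-‿cong (*-congˡ q (*-congˡ q u≋)))))
             (+-congˡ 1# (-‿cong (*-congˡ q (*-congˡ q (*-congˡ q u≋))))) ⟩
      1# * (1# - q * w) * (1# - q * (q * w)) * (1# - q * (q * (q * w)))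
        ≈⟨ *-cong (*-cong (solve 2 (λ q w → con 1ℤ :* (con 1ℤ :- q :* w) := con 1ℤ :+ :- q :* w) ≋-refl q w)
             (solve 2 (λ q w → con 1ℤ :- q :* (q :* w) := con 1ℤ :+ :- (q :* q) :* w) ≋-refl q w))
             (solve 2 (λ q w → con 1ℤ :- q :* (q :* (q :* w)) := con 1ℤ :- q :* (q :* q) :* w) ≋-refl q w) ⟩
      (1# + x * w) * (1# + y * w) * (1# - p * w) ∎
      where
      u = q ^ (i ℕ.* 3)
      w = p ^ i
      u≋ = q^-3 i

  -- pentagonal 1 j and pentagonal 2 j are the pentagonal numbers j(3j − 1)/2 and j(3j + 1)/2.
  pentagonal : ℕ → ℕ → ℕ
  pentagonal c zero    = 0
  pentagonal c (suc j) = pentagonal c j ℕ.+ (c ℕ.+ j ℕ.* 3)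

  θ-monomial : ∀ {c z} → Monomial c z → ∀ j → Monomial (pentagonal c j) (θ (q * (q * q)) z j)
  θ-monomial m zero    = monomial-1
  θ-monomial m (suc j) = monomial-* (θ-monomial m j)
    (monomial-* m (monomial-^ j (monomial-* monomial-q (monomial-* monomial-q monomial-q))))

  -- Completing the square gives (6j - 1)² for index j. Starting at index 1 avoids the subtraction:
  -- 6 (j + 1) - 1 = 6j + 5.
  24pentagonal₁+1 : ∀ j → 24 ℕ.* pentagonal 1 (suc j) ℕ.+ 1 ≡ (6 ℕ.* j ℕ.+ 5) ℕ.* (6 ℕ.* j ℕ.+ 5)
  24pentagonal₁+1 zero    = refl
  24pentagonal₁+1 (suc j) = trans (unfold j (pentagonal 1 (suc j))) (trans (cong (ℕ._+ 24 ℕ.* (1 ℕ.+ suc j ℕ.* 3)) (24pentagonal₁+1 j)) (square j))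
    where
    unfold : ∀ j t → 24 ℕ.* (t ℕ.+ (1 ℕ.+ suc j ℕ.* 3)) ℕ.+ 1 ≡ 24 ℕ.* t ℕ.+ 1 ℕ.+ 24 ℕ.* (1 ℕ.+ suc j ℕ.* 3)
    unfold = ℕ-Solver.solve-∀
    square : ∀ j → (6 ℕ.* j ℕ.+ 5) ℕ.* (6 ℕ.* j ℕ.+ 5) ℕ.+ 24 ℕ.* (1 ℕ.+ suc j ℕ.* 3) ≡ (6 ℕ.* suc j ℕ.+ 5) ℕ.* (6 ℕ.* suc j ℕ.+ 5)
    square = ℕ-Solver.solve-∀

  24pentagonal₂+1 : ∀ j → 24 ℕ.* pentagonal 2 j ℕ.+ 1 ≡ (6 ℕ.* j ℕ.+ 1) ℕ.* (6 ℕ.* j ℕ.+ 1)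
  24pentagonal₂+1 zero    = refl
  24pentagonal₂+1 (suc j) = trans (unfold j (pentagonal 2 j)) (trans (cong (ℕ._+ 24 ℕ.* (2 ℕ.+ j ℕ.* 3)) (24pentagonal₂+1 j)) (square j))
    where
    unfold : ∀ j t → 24 ℕ.* (t ℕ.+ (2 ℕ.+ j ℕ.* 3)) ℕ.+ 1 ≡ 24 ℕ.* t ℕ.+ 1 ℕ.+ 24 ℕ.* (2 ℕ.+ j ℕ.* 3)
    unfold = ℕ-Solver.solve-∀
    square : ∀ j → (6 ℕ.* j ℕ.+ 1) ℕ.* (6 ℕ.* j ℕ.+ 1) ℕ.+ 24 ℕ.* (2 ℕ.+ j ℕ.* 3) ≡ (6 ℕ.* suc j ℕ.+ 1) ℕ.* (6 ℕ.* suc j ℕ.+ 1)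
    square = ℕ-Solver.solve-∀

  -- The shift by the factor q in q E is what fits: 24 (e + 1) + 3 exceeds 24 e + 1 by 26 = 2 · 13.
  suc-residue : ∀ e m → 24 ℕ.* e ℕ.+ 1 ≡ m ℕ.* m → ¬ Nonresidue (suc e)
  suc-residue e m eq bad = nonresidue-square (suc e) m bad
    (trans (cong (ℕ._% 13) (trans (rearrange e) (cong (ℕ._+ 2 ℕ.* 13) eq))) ([m+kn]%n≡m%n (m ℕ.* m) 2 13))
    where
    rearrange : ∀ e → 24 ℕ.* suc e ℕ.+ 3 ≡ 24 ℕ.* e ℕ.+ 1 ℕ.+ 2 ℕ.* 13
    rearrange = ℕ-Solver.solve-∀

  qE-vanishes : Vanishes (q * E)
  qE-vanishes zero    _     = 13∣0
  qE-vanishes (suc k) k-bad = ≡0⇒13∣ (trans (q-*-suc E k) (trans (at E-series k)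
    (cong₂ ℤ._+_
      (∑≤-zero k _ λ j _ → θ-monomial (monomial-neg (monomial-* monomial-q monomial-q)) (suc j) k
        λ where refl → suc-residue (pentagonal 2 (suc j)) (6 ℕ.* suc j ℕ.+ 1) (24pentagonal₂+1 (suc j)) k-bad)
      (∑≤-zero k _ λ j _ → θ-monomial (monomial-neg monomial-q) j k (negative j)))))
    where
    negative : ∀ j → ¬ k ≡ pentagonal 1 j
    -- The constant term of the series, with 24 · 0 + 1 = 1², lies outside the range of
    -- `24pentagonal₁+1`.
    negative zero    refl = suc-residue 0 1 refl k-bad
    negative (suc j) refl = suc-residue (pentagonal 1 (suc j)) (6 ℕ.* j ℕ.+ 5) (24pentagonal₁+1 j) k-bad

  φ⁻¹³g₃-vanishes : Vanishes (φ⁻ ^ 13 * g₃)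
  φ⁻¹³g₃-vanishes k k-bad = subst (+ 13 ∣_) (sym (at φ⁻¹³g₃ k)) (∣m∣n⇒∣m+n
    (subst (+ 13 ∣_) (sym (const-* (+ 6) (φ⁻ ^ 13 * ψ) k)) (∣n⇒∣m*n (+ 6) (vanishes-* (φ⁻ ^ 13) ψ (frobenius φ⁻) ψ-vanishes k k-bad)))
    (subst (+ 13 ∣_) (sym (const-* (+ 1024) (D E ^ 13 * (q * E)) k)) (∣n⇒∣m*n (+ 1024) (vanishes-* (D E ^ 13) (q * E) (frobenius (D E)) qE-vanishes k k-bad))))

  g₃-vanishes : Vanishes g₃
  g₃-vanishes = vanishes-*-cancel (φ⁻ ^ 13) g₃ refl (frobenius φ⁻) φ⁻¹³g₃-vanishes

  g₃-at : ∀ k → g₃ k ≡ v₀ (32 ℕ.* k ℕ.+ 4) ℤ.+ v₀ (32 ℕ.* k ℕ.+ 4)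
  g₃-at k = trans (U-at g₂ k) (trans (U-at g₁ (k ℕ.+ k)) (trans (U-at (tail g₀) l)
    -- The -1 in `G 0` affects coefficient 0 only; the index reached here is 16k + 2, so it
    -- contributes 0.
    (trans (U-at (G 0) (suc (l ℕ.+ l))) (trans (ℤₚ.+-identityʳ _) (cong₂ ℤ._+_ half half)))))
    where
    l m : ℕ
    l = (k ℕ.+ k) ℕ.+ (k ℕ.+ k)
    m = suc (l ℕ.+ l) ℕ.+ suc (l ℕ.+ l)
    index : ∀ k → let l = (k ℕ.+ k) ℕ.+ (k ℕ.+ k) in let m = suc (l ℕ.+ l) ℕ.+ suc (l ℕ.+ l) in m ℕ.+ m ≡ 32 ℕ.* k ℕ.+ 4
    index = ℕ-Solver.solve-∀
    half : U (A 0) m ≡ v₀ (32 ℕ.* k ℕ.+ 4)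
    half = trans (U-at (A 0) m) (trans (sym (at v₀≋A (m ℕ.+ m))) (cong v₀ (index k)))

  -- 2 is invertible modulo 13, explicitly by 1 = 13 - 6 · 2.
  13∣double⇒13∣ : ∀ v → + 13 ∣ v ℤ.+ v → + 13 ∣ v
  13∣double⇒13∣ v (divides c eq) = divides (v ℤ.- + 6 ℤ.* c)
    (trans (halve v) (trans (cong (λ x → + 13 ℤ.* v ℤ.- + 6 ℤ.* x) eq) (collect v c)))
    where
    halve : ∀ v → v ≡ + 13 ℤ.* v ℤ.- + 6 ℤ.* (v ℤ.+ v)
    halve = ℤ-Solver.solve-∀
    collect : ∀ v c → + 13 ℤ.* v ℤ.- + 6 ℤ.* (c ℤ.* + 13) ≡ (v ℤ.- + 6 ℤ.* c) ℤ.* + 13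
    collect = ℤ-Solver.solve-∀

  v₀-vanishes : ∀ k → Nonresidue k → + 13 ∣ v₀ (32 ℕ.* k ℕ.+ 4)
  v₀-vanishes k k-bad = 13∣double⇒13∣ (v₀ (32 ℕ.* k ℕ.+ 4)) (subst (+ 13 ∣_) (g₃-at k) (g₃-vanishes k k-bad))

  -- 416 = 32 · 13, so a step in n adds 13 to the index k of v₀(32k + 4) and preserves its class.
  v₀-416 : ∀ n c → Nonresidue c → + 13 ∣ v₀ (416 ℕ.* n ℕ.+ (32 ℕ.* c ℕ.+ 4))
  v₀-416 n c c-bad = subst (λ m → + 13 ∣ v₀ m) (index n c)
    (v₀-vanishes (c ℕ.+ n ℕ.* 13) (subst (_∈ nonresidues) (sym ([m+kn]%n≡m%n c n 13)) c-bad))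
    where
    index : ∀ n c → 32 ℕ.* (c ℕ.+ n ℕ.* 13) ℕ.+ 4 ≡ 416 ℕ.* n ℕ.+ (32 ℕ.* c ℕ.+ 4)
    index = ℕ-Solver.solve-∀

open import Defs using (v₀)
open import Data.Nat using (ℕ; _+_; _*_)
open import Data.Integer using (+_)
open import Data.Integer.Divisibility using (_∣_)
open import Data.Integer.Divisibility.Signed using (∣⇒∣ᵤ)
open import Data.List using (_∷_; [])
open import Data.List.Membership.Propositional using (_∈_)
open import Data.List.Relation.Unary.Any using (here; there)
open import Relation.Binary.PropositionalEquality using (refl)
open Modulo13 using (v₀-416)

theorem5p2 : (n r : ℕ) → r ∈ 132 ∷ 164 ∷ 228 ∷ 292 ∷ 356 ∷ 388 ∷ [] → (+ 13) ∣ v₀ (416 * n + r)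
-- The listed values of r are 32 c + 4 for the entries c of `nonresidues`, in the same order, so
-- each membership proof carries over by position.
theorem5p2 n r (here refl)                                 = ∣⇒∣ᵤ (v₀-416 n 4 (here refl))
theorem5p2 n r (there (here refl))                         = ∣⇒∣ᵤ (v₀-416 n 5 (there (here refl)))
theorem5p2 n r (there (there (here refl)))                 = ∣⇒∣ᵤ (v₀-416 n 7 (there (there (here refl))))
theorem5p2 n r (there (there (there (here refl))))         = ∣⇒∣ᵤ (v₀-416 n 9 (there (there (there (here refl)))))
theorem5p2 n r (there (there (there (there (here refl))))) = ∣⇒∣ᵤ (v₀-416 n 11 (there (there (there (there (here refl))))))
theorem5p2 n r (there (there (there (there (there (here refl)))))) =
  ∣⇒∣ᵤ (v₀-416 n 12 (there (there (there (there (there (here refl)))))))
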